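{- Let $K$ be a field, $S=K[x_1,\ldots,x_n]$, and let $I\subset S$ be a monomial ideal such that $S/I$ is Cohen–Macaulay. Let $I^p\subset T$ be the polarization of $I$. If $I$ is a Stanley ideal (i.e. $S/I$ has a Stanley decomposition $S/I=\bigoplus_{i}u_iK[Z_i]$ with $|Z_i|\ge\operatorname{depth}(S/I)$ for all $i$), then $I^p$ is a Stanley ideal (i.e. $T/I^p$ has a Stanley decomposition $T/I^p=\bigoplus_i v_iK[W_i]$ with $|W_i|\ge\operatorname{depth}(T/I^p)$ for all $i$).
   Context: For a monomial ideal $J$ in a polynomial ring $R$ over $K$ with variable set $X$, a Stanley space is a $K$-subspace $uK[Z]$ of $R/J$, with $u$ a monomial and $Z\subseteq X$, spanned by all $uv$ with $v$ a monomial in $K[Z]$, which is a free $K[Z]$-module; a Stanley decomposition of $R/J$ is a decomposition of $R/J$ as a finite direct sum of Stanley spaces. Polarization: for a monomial $u=\prod_{i=1}^n x_i^{a_i}$, its polarization is $u^p=\prod_{i=1}^n\prod_{j=1}^{a_i}x_{ij}$. If $I$ is minimally generated by monomials $u_1,\ldots,u_s$, with $u_j=x_1^{a_{j1}}\cdots x_n^{a_{jn}}$, set $r_i=\max_j a_{ji}$; then $I^p=(u_1^p,\ldots,u_s^p)$ is an ideal of $T=K[x_{ij}: 1\le i\le n,\ 1\le j\le r_i]$. -}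

module Defs where

open import Level using (Level; _⊔_) renaming (suc to lsuc)
open import Algebra.Bundles using (CommutativeRing)
open import Data.Nat as ℕ using (ℕ; zero; suc; _≤_; _<ᵇ_)
  renaming (_+_ to _+ℕ_; _⊔_ to _⊔ℕ_)
open import Data.Bool using (Bool; true; false; if_then_else_)
open import Data.Fin as Fin using (Fin; toℕ; inject₁) renaming (_≟_ to _≟ᶠ_)
open import Relation.Nullary.Decidable using (⌊_⌋)
open import Data.List.Membership.Propositional using () renaming (_∈_ to _∈ₗ_)
open import Data.Fin.Subset using (Subset; ∣_∣)
open import Data.Vec as V using (Vec; _∷_; []; lookup; tabulate; zipWith; replicate; allFin)
open import Data.Vec.Properties using (≡-dec)
open import Data.List as L using (List; _∷_; []; _++_; length)
open import Data.Product using (Σ; ∃; ∃-syntax; _×_; _,_)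
open import Data.Sum using (_⊎_)
open import Relation.Nullary using (¬_; yes; no)
open import Relation.Binary.PropositionalEquality using (_≡_)

record Field c ℓ : Set (lsuc (c ⊔ ℓ)) where
  field
    commutativeRing : CommutativeRing c ℓ
  open CommutativeRing commutativeRing public
  field
    1≉0     : ¬ (1# ≈ 0#)
    inverse : ∀ x → ¬ (x ≈ 0#) → ∃[ y ] (x * y ≈ 1#)

Mon : ℕ → Set
Mon m = Vec ℕ m

_·ₘ_ : ∀ {m} → Mon m → Mon m → Mon m
u ·ₘ v = zipWith _+ℕ_ u v

oneₘ : ∀ {m} → Mon m
oneₘ = replicate _ 0

_∣ₘ_ : ∀ {m} → Mon m → Mon m → Set
u ∣ₘ w = ∃[ v ] (u ·ₘ v ≡ w)

SupportedIn : ∀ {m} → Mon m → Subset m → Set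
SupportedIn v Z = ∀ j → lookup Z j ≡ false → lookup v j ≡ 0

MinimalGens : ∀ {n s} → (Fin s → Mon n) → Set
MinimalGens {s = s} u = ∀ (k l : Fin s) → ¬ (k ≡ l) → ¬ (u k ∣ₘ u l)

polR : ∀ {n s} → (Fin s → Mon n) → Fin n → ℕ
polR {s = s} u i = V.foldr (λ _ → ℕ) (λ a b → a ⊔ℕ b) 0 (V.map (λ k → lookup (u k) i) (allFin s))

blocks : ∀ n → (Fin n → ℕ) → ℕ
blocks zero    r = 0
blocks (suc n) r = r Fin.zero +ℕ blocks n (λ i → r (Fin.suc i))

-- The variables of T = K[x_{ij} : 1 ≤ j ≤ r_i] are laid out block by block:
-- block i has length r_i and its (j-1)-th entry (0-based) is x_{ij}.
-- block k a : exponent vector of x_{i1}⋯x_{ia} inside a block of length k.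
block : (k a : ℕ) → Vec ℕ k
block k a = tabulate (λ j → if toℕ j <ᵇ a then 1 else 0)

-- polarization u^p of a monomial u with exponents a_i ≤ r_i
polarize : ∀ {n} (r : Fin n → ℕ) → Mon n → Mon (blocks n r)
polarize {zero}  r []      = []
polarize {suc n} r (a ∷ u) = block (r Fin.zero) a V.++ polarize (λ i → r (Fin.suc i)) u

polVars : ∀ {n s} → (Fin s → Mon n) → ℕ
polVars {n} u = blocks n (polR u)

polGens : ∀ {n s} (u : Fin s → Mon n) → Fin s → Mon (polVars u)
polGens u k = polarize (polR u) (u k)

module PolyRing {c ℓ} (F : Field c ℓ) (m : ℕ) where
  open Field F

  Poly : Set c
  Poly = List (Carrier × Mon m)

  coeff : Poly → Mon m → Carrier
  coeff []             w = 0#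
  coeff ((a , v) ∷ p) w with ≡-dec ℕ._≟_ v w
  ... | yes _ = a + coeff p w
  ... | no  _ = coeff p w

  _≃_ : Poly → Poly → Set ℓ
  p ≃ q = ∀ w → coeff p w ≈ coeff q w

  zeroₚ : Poly
  zeroₚ = []

  oneₚ : Poly
  oneₚ = (1# , oneₘ) ∷ []

  monomial : Mon m → Poly
  monomial w = (1# , w) ∷ []

  var : Fin m → Poly
  var j = monomial (tabulate (λ i → if ⌊ i ≟ᶠ j ⌋ then 1 else 0))

  _+ₚ_ : Poly → Poly → Poly
  p +ₚ q = p ++ q

  _*ₚ_ : Poly → Poly → Poly
  p *ₚ q = L.concatMap (λ { (a , u) → L.map (λ { (b , v) → (a * b , u ·ₘ v) }) q }) p

  combine : List Poly → List Poly → Poly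
  combine []       _        = zeroₚ
  combine (_ ∷ _)  []       = zeroₚ
  combine (h ∷ hs) (g ∷ gs) = (h *ₚ g) +ₚ combine hs gs

  _∈⟨_⟩ : Poly → List Poly → Set (c ⊔ ℓ)
  f ∈⟨ gs ⟩ = ∃[ hs ] (length hs ≡ length gs × f ≃ combine hs gs)

  InMax : Poly → Set (c ⊔ ℓ)
  InMax f = f ∈⟨ L.map var (V.toList (allFin m)) ⟩

  NonZeroDivisor : List Poly → Poly → Set (c ⊔ ℓ)
  NonZeroDivisor gs f = ∀ g → (g *ₚ f) ∈⟨ gs ⟩ → g ∈⟨ gs ⟩

  RegularSeq : List Poly → List Poly → Set (c ⊔ ℓ)
  RegularSeq gs []       = ¬ (oneₚ ∈⟨ gs ⟩)
  RegularSeq gs (f ∷ fs) =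
    InMax f × NonZeroDivisor gs f × RegularSeq (gs ++ (f ∷ [])) fs

  IsDepth : List Poly → ℕ → Set (c ⊔ ℓ)
  IsDepth gs d =
    (∃[ fs ] (RegularSeq gs fs × length fs ≡ d)) ×
    (∀ fs → RegularSeq gs fs → length fs ≤ d)

  record IsPrimeIdeal (P : Poly → Set (c ⊔ ℓ)) : Set (c ⊔ ℓ) where
    field
      respects : ∀ {f g} → f ≃ g → P f → P g
      has-zero : P zeroₚ
      +-closed : ∀ {f g} → P f → P g → P (f +ₚ g)
      *-closed : ∀ g {f} → P f → P (g *ₚ f)
      proper   : ¬ P oneₚ
      prime    : ∀ f g → P (f *ₚ g) → P f ⊎ P g

  record PrimeChain (gs : List Poly) (e : ℕ) : Set (lsuc (c ⊔ ℓ)) where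
    field
      P        : Fin (suc e) → Poly → Set (c ⊔ ℓ)
      isPrime  : ∀ i → IsPrimeIdeal (P i)
      contains : ∀ i g → g ∈ₗ gs → P i g
      ascending : ∀ (i : Fin e) f → P (inject₁ i) f → P (Fin.suc i) f
      strict   : ∀ (i : Fin e) → ∃[ f ] (P (Fin.suc i) f × ¬ P (inject₁ i) f)

  IsDim : List Poly → ℕ → Set (lsuc (c ⊔ ℓ))
  IsDim gs d = PrimeChain gs d × (∀ e → PrimeChain gs e → e ≤ d)

  CohenMacaulay : List Poly → Set (lsuc (c ⊔ ℓ))
  CohenMacaulay gs = ∃[ d ] (IsDepth gs d × IsDim gs d)

  -- A Stanley decomposition  S/J = ⊕_{i<k} u_i K[Z_i]  of S/J, J = (gs),
  -- with |Z_i| ≥ d for all i.  Since the monomials not in J form a K-basis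
  -- of S/J, this says: every u_i v (v ∈ K[Z_i] a monomial) is nonzero in S/J
  -- (u_i K[Z_i] is a free K[Z_i]-module), and every monomial not in J is
  -- u_i v for exactly one pair (i , v).
  record StanleyDecomposition (gs : List Poly) (d : ℕ) : Set (c ⊔ ℓ) where
    field
      k     : ℕ
      u     : Fin k → Mon m
      Z     : Fin k → Subset m
      free  : ∀ i v → SupportedIn v (Z i) → ¬ (monomial (u i ·ₘ v) ∈⟨ gs ⟩)
      cover : ∀ w → ¬ (monomial w ∈⟨ gs ⟩) →
              ∃[ i ] ∃[ v ] (SupportedIn v (Z i) × u i ·ₘ v ≡ w)
      disjoint : ∀ i i' v v' → SupportedIn v (Z i) → SupportedIn v' (Z i') →
                 u i ·ₘ v ≡ u i' ·ₘ v' → i ≡ i' × v ≡ v'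
      large : ∀ i → d ≤ ∣ Z i ∣

  monIdeal : ∀ {s} → (Fin s → Mon m) → List Poly
  monIdeal {s} w = L.map (λ k → monomial (w k)) (V.toList (allFin s))

  IsStanleyIdeal : ∀ {s} → (Fin s → Mon m) → Set (c ⊔ ℓ)
  IsStanleyIdeal w = ∃[ d ] (IsDepth (monIdeal w) d × StanleyDecomposition (monIdeal w) d)

{-# OPTIONS --safe #-}

-- A monomial w of T avoids I^p exactly when x^e(w) avoids I, where e(w)_i is
-- the length of the longest initial segment x_{i1}, x_{i2}, … of row i that
-- divides w.  Pulling a Stanley decomposition ⊕ u_t K[Z_t] of S/I back along e
-- gives ⊕ u_t^p K[W_t], where W_t omits x_{i,a_i+1} for i ∉ Z_t (a_i the exponent
-- of x_i in u_t), so the codimensions do not grow and it remains to compute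
-- depth T/I^p = N - (n - d) =: D, with d = depth S/I and N the number of
-- variables of T.
--
-- The constants in a prime of S, together with the variables outside a face Z
-- of I, generate a prime containing I; as dim S/I = d, no face
-- has more than d elements, so all squarefree monomials of degree > D are in
-- I^p.  Hence the elementary symmetric polynomials θ_k with k > D lie in I^p, and
-- by Vieta the variables of T are nilpotent modulo I^p + (θ_1, …, θ_D).  Depth is
-- read off from the vanishing of Koszul homology, which survives
--   * dividing out or restoring a nonzerodivisor,
--   * dropping from the Koszul complex an element nilpotent modulo the others.
-- A regular sequence on T/I^p longer than D would give H_0(θ; T/I^p) = 0, which is
-- absurd.  Conversely let B = K[x_i, z_q] with one z_q for every variable of T.
-- The given regular sequence on S/I, the z_q, and then one polarization after
-- the other (z_q - x_i is a nonzerodivisor before and after the step) give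
-- H_i(θ, x; B/I^pB) = 0 for i > 0; all θ_k being homogeneous, graded Nakayama makes
-- θ_1, …, θ_D a regular sequence on B/(I^p, x) = T/I^p.

module Submission where

-- `RegularSeq` allows inhomogeneous elements of a polynomial ring that is not local, and such
-- sequences cannot in general be permuted or exchanged. Vanishing of Koszul homology does not see
-- the order, so through it the given sequence, the z_q and the differences z_q - x_i can be traded
-- for the θ_k; homogeneity is asked only of the θ_k and the x_i, where Nakayama needs it. The
-- common ring B is there because S/I and T/I^p are both quotients of it. Elementary symmetric
-- polynomials are taken since K may be finite, and then T/I^p may lack a linear system of
-- parameters. Equality in K is not assumed decidable. Hence face primes are built over the
-- constants of a prime that the Cohen-Macaulay hypothesis supplies, and the ring laws of
-- polynomials are checked against linear functionals.

open import Defs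
open import Algebra.Bundles using (CommutativeRing; RawRing)
import Algebra.Properties.AbelianGroup
import Algebra.Properties.Ring
import Algebra.Properties.Semiring.Exp
import Algebra.Properties.Semiring.Mult
import Algebra.Solver.Ring
open import Algebra.Solver.Ring.AlmostCommutativeRing using (fromCommutativeRing; _-Raw-AlmostCommutative⟶_; Induced-equivalence)
import Algebra.Solver.Ring.NaturalCoefficients.Default
open import Data.Bool as Bool using (Bool; true; false; if_then_else_; not)
open import Data.Bool.Properties using (T-≡)
open import Data.Empty using (⊥)
open import Data.Fin as Fin using (Fin; toℕ; _↑ˡ_; _↑ʳ_)
import Data.Fin.Properties as Finₚ
open import Data.Fin.Subset as Subset using (Subset; ∣_∣; _∈_; ∁; inside; outside) renaming (⊥ to ∅)
import Data.Fin.Subset.Properties as Subsetₚ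
open import Data.List as L using (List; []; _∷_; length; _++_)
open import Data.List.Membership.Propositional using () renaming (_∈_ to _∈ₗ_)
open import Data.List.Membership.Propositional.Properties using (∈-++⁺ˡ; ∈-++⁺ʳ; ∈-tabulate⁺; ∈-map⁺; ∈-filter⁺; ∈-filter⁻; ∈-allFin; ∈-lookup)
import Data.List.Properties as Lₚ
open import Data.List.Relation.Unary.All as All using (All; []; _∷_)
import Data.List.Relation.Unary.All.Properties as Allₚ
open import Data.List.Relation.Unary.AllPairs using ([]; _∷_)
open import Data.List.Relation.Unary.Any using (here; there; index)
import Data.List.Relation.Unary.Any.Properties as Anyₚ
open import Data.List.Relation.Unary.Unique.Propositional using (Unique)
import Data.List.Relation.Unary.Unique.Propositional.Properties as Uniqueₚ
open import Data.Maybe using (Maybe; just; nothing; maybe′)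
open import Data.Nat as ℕ using (ℕ; zero; suc; z≤n; s≤s)
import Data.Nat.Properties as ℕₚ
open import Data.Product using (∃-syntax; _×_; _,_; proj₁; proj₂)
open import Data.Sum as Sum using (_⊎_; inj₁; inj₂)
open import Data.Vec as V using (Vec; []; _∷_)
open import Data.Vec.Membership.Propositional.Properties using (∈-toList⁺) renaming (∈-allFin⁺ to ∈ᵥ-allFin)
import Data.Vec.Properties as Vₚ
open import Function using (_∘_)
open import Function.Bundles using (Equivalence)
open import Level using (_⊔_; Lift; lift; lower)
import Relation.Binary.Reasoning.Setoid
open import Relation.Binary.Definitions using (WeaklyDecidable; tri<; tri≈; tri>)
open import Relation.Binary.PropositionalEquality as ≡ using (_≡_; _≢_)
open import Relation.Nullary using (¬_; Dec; yes; no; contradiction)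
open import Relation.Nullary.Decidable using (⌊_⌋; _×-dec_; _⊎-dec_; _→-dec_) renaming (map′ to map-dec)
open import Relation.Unary using (Decidable)

-- A ring solver whose coefficients (a , b) stand for the integer a - b.
module RingSolver {c ℓ} (R : CommutativeRing c ℓ) where
  open CommutativeRing R
  open Algebra.Properties.Semiring.Mult semiring using (×-homo-+; ×1-homo-*; ×-homo-1) renaming (_×_ to _·_)
  open Algebra.Properties.Ring ring using (-‿distribˡ-*; -‿distribʳ-*; -‿involutive; -0#≈0#)
  open Algebra.Properties.AbelianGroup +-abelianGroup using (⁻¹-∙-comm)
  open Algebra.Solver.Ring.NaturalCoefficients.Default commutativeSemiring
    using (solve; _:=_; _:+_; _:*_)
  open Relation.Binary.Reasoning.Setoid setoid

  private
    -- One entry of a reduced pair is 0, so every integer has a single reduced form; 1 - 1, for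
    -- instance, becomes the literal `(0 , 0)`.
    cancel : ℕ × ℕ → ℕ × ℕ
    cancel (a , b) = a ℕ.∸ b , b ℕ.∸ a

  differences : RawRing _ _
  differences = record
    { Carrier = ℕ × ℕ
    ; _≈_ = _≡_
    ; _+_ = λ (a , b) (c , d) → cancel (a ℕ.+ c , b ℕ.+ d)
    ; _*_ = λ (a , b) (c , d) → cancel (a ℕ.* c ℕ.+ b ℕ.* d , a ℕ.* d ℕ.+ b ℕ.* c)
    ; -_ = λ (a , b) → b , a
    ; 0# = 0 , 0
    ; 1# = 1 , 0
    }

  private
    open RawRing differences using () renaming (_*_ to _*ᵈ_)

    ⟦_⟧ᵈ : ℕ × ℕ → Carrier
    ⟦ a , b ⟧ᵈ = a · 1# + - (b · 1#)

    difference-eq : ∀ a b c d → a ℕ.+ d ≡ c ℕ.+ b → ⟦ a , b ⟧ᵈ ≈ ⟦ c , d ⟧ᵈ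
    difference-eq a b c d eq = begin
      p + - q                 ≈⟨ +-identityʳ _ ⟨
      (p + - q) + 0#          ≈⟨ +-congˡ (-‿inverseʳ s) ⟨
      (p + - q) + (s + - s)   ≈⟨ solve 4 (λ x y z w → (x :+ y) :+ (z :+ w) := (x :+ z) :+ (y :+ w)) refl _ _ _ _ ⟩
      (p + s) + (- q + - s)   ≈⟨ +-congʳ p+s≈r+q ⟩
      (r + q) + (- q + - s)   ≈⟨ solve 4 (λ x y z w → (x :+ y) :+ (z :+ w) := (x :+ w) :+ (y :+ z)) refl _ _ _ _ ⟩
      (r + - s) + (q + - q)   ≈⟨ +-congˡ (-‿inverseʳ q) ⟩
      (r + - s) + 0#          ≈⟨ +-identityʳ _ ⟩
      r + - s ∎
      where
      p = a · 1#
      q = b · 1#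
      r = c · 1#
      s = d · 1#
      p+s≈r+q : p + s ≈ r + q
      p+s≈r+q = begin
        p + s             ≈⟨ ×-homo-+ 1# a d ⟨
        (a ℕ.+ d) · 1#    ≡⟨ ≡.cong (_· 1#) eq ⟩
        (c ℕ.+ b) · 1#    ≈⟨ ×-homo-+ 1# c b ⟩
        r + q ∎

    ⟦cancel⟧ : ∀ a b → ⟦ cancel (a , b) ⟧ᵈ ≈ ⟦ a , b ⟧ᵈ
    ⟦cancel⟧ a b = difference-eq (a ℕ.∸ b) (b ℕ.∸ a) a b (balanced a b)
      where
      balanced : ∀ a b → (a ℕ.∸ b) ℕ.+ b ≡ a ℕ.+ (b ℕ.∸ a)
      balanced zero zero = ≡.refl
      balanced zero (suc b) = ≡.refl
      balanced (suc a) zero = ≡.refl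
      balanced (suc a) (suc b) = ≡.trans (ℕₚ.+-suc _ b) (≡.cong suc (balanced a b))

    -- ⟦_⟧ᶜ evaluates the literals (0 , 0) and (1 , 0) to 0# and 1# definitionally.
    ⟦_⟧ᶜ : ℕ × ℕ → Carrier
    ⟦ zero , zero ⟧ᶜ = 0#
    ⟦ suc zero , zero ⟧ᶜ = 1#
    ⟦ x ⟧ᶜ = ⟦ x ⟧ᵈ

    ᶜ≈ᵈ : ∀ x → ⟦ x ⟧ᶜ ≈ ⟦ x ⟧ᵈ
    ᶜ≈ᵈ (zero , zero) = sym (trans (+-identityˡ _) -0#≈0#)
    ᶜ≈ᵈ (suc zero , zero) = sym (trans (+-cong (×-homo-1 1#) -0#≈0#) (+-identityʳ 1#))
    ᶜ≈ᵈ (zero , suc _) = refl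
    ᶜ≈ᵈ (suc zero , suc _) = refl
    ᶜ≈ᵈ (suc (suc _) , _) = refl

    +-homo : ∀ x y → ⟦ RawRing._+_ differences x y ⟧ᵈ ≈ ⟦ x ⟧ᵈ + ⟦ y ⟧ᵈ
    +-homo (a , b) (a′ , b′) = begin
      ⟦ cancel (a ℕ.+ a′ , b ℕ.+ b′) ⟧ᵈ
        ≈⟨ ⟦cancel⟧ (a ℕ.+ a′) (b ℕ.+ b′) ⟩
      (a ℕ.+ a′) · 1# + - ((b ℕ.+ b′) · 1#)
        ≈⟨ +-cong (×-homo-+ 1# a a′) (-‿cong (×-homo-+ 1# b b′)) ⟩
      (a · 1# + a′ · 1#) + - (b · 1# + b′ · 1#)
        ≈⟨ +-congˡ (⁻¹-∙-comm _ _) ⟨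
      (a · 1# + a′ · 1#) + (- (b · 1#) + - (b′ · 1#))
        ≈⟨ solve 4 (λ p q r s → (p :+ q) :+ (r :+ s) := (p :+ r) :+ (q :+ s)) refl _ _ _ _ ⟩
      (a · 1# + - (b · 1#)) + (a′ · 1# + - (b′ · 1#)) ∎

    *-homo : ∀ x y → ⟦ x *ᵈ y ⟧ᵈ ≈ ⟦ x ⟧ᵈ * ⟦ y ⟧ᵈ
    *-homo (a , b) (a′ , b′) = begin
      ⟦ cancel (a ℕ.* a′ ℕ.+ b ℕ.* b′ , a ℕ.* b′ ℕ.+ b ℕ.* a′) ⟧ᵈ
        ≈⟨ ⟦cancel⟧ (a ℕ.* a′ ℕ.+ b ℕ.* b′) (a ℕ.* b′ ℕ.+ b ℕ.* a′) ⟩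
      (a ℕ.* a′ ℕ.+ b ℕ.* b′) · 1# + - ((a ℕ.* b′ ℕ.+ b ℕ.* a′) · 1#)
        ≈⟨ +-cong (mult a a′ b b′) (-‿cong (mult a b′ b a′)) ⟩
      (p * p′ + q * q′) + - (p * q′ + q * p′)
        ≈⟨ +-cong (+-congˡ (-‿involutive _)) (⁻¹-∙-comm _ _) ⟨
      (p * p′ + - - (q * q′)) + (- (p * q′) + - (q * p′))
        ≈⟨ +-cong (+-congˡ (trans (-‿cong (-‿distribˡ-* q q′)) (-‿distribʳ-* (- q) q′)))
                  (+-cong (-‿distribʳ-* p q′) (-‿distribˡ-* q p′)) ⟩
      (p * p′ + - q * - q′) + (p * - q′ + - q * p′)
        ≈⟨ solve 4 (λ x y z w → (x :* y :+ z :* w) :+ (x :* w :+ z :* y) := (x :+ z) :* (y :+ w)) refl _ _ _ _ ⟩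
      (p + - q) * (p′ + - q′) ∎
      where
      p = a · 1#
      q = b · 1#
      p′ = a′ · 1#
      q′ = b′ · 1#
      mult : ∀ i j k l → (i ℕ.* j ℕ.+ k ℕ.* l) · 1# ≈ (i · 1#) * (j · 1#) + (k · 1#) * (l · 1#)
      mult i j k l = trans (×-homo-+ 1# (i ℕ.* j) (k ℕ.* l)) (+-cong (×1-homo-* i j) (×1-homo-* k l))

    morphism : differences -Raw-AlmostCommutative⟶ fromCommutativeRing R
    morphism = record
      { ⟦_⟧ = ⟦_⟧ᶜ
      ; +-homo = λ x y → trans (ᶜ≈ᵈ (RawRing._+_ differences x y)) (trans (+-homo x y) (sym (+-cong (ᶜ≈ᵈ x) (ᶜ≈ᵈ y))))
      ; *-homo = λ x y → trans (ᶜ≈ᵈ (x *ᵈ y)) (trans (*-homo x y) (sym (*-cong (ᶜ≈ᵈ x) (ᶜ≈ᵈ y))))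
      ; -‿homo = λ x → trans (ᶜ≈ᵈ (RawRing.-_ differences x)) (trans (-‿homo x) (sym (-‿cong (ᶜ≈ᵈ x))))
      ; 0-homo = refl
      ; 1-homo = refl
      }
      where
      -‿homo : ∀ ((a , b) : ℕ × ℕ) → ⟦ b , a ⟧ᵈ ≈ - ⟦ a , b ⟧ᵈ
      -‿homo (a , b) = trans (trans (+-comm _ _) (+-congˡ (sym (-‿involutive _)))) (⁻¹-∙-comm _ _)

    _≟ᵈ_ : WeaklyDecidable (Induced-equivalence morphism)
    (a , b) ≟ᵈ (c , d) with a ℕ.+ d ℕ.≟ c ℕ.+ b
    ... | yes eq = just (trans (ᶜ≈ᵈ (a , b)) (trans (difference-eq a b c d eq) (sym (ᶜ≈ᵈ (c , d)))))
    ... | no _ = nothing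

  open Algebra.Solver.Ring differences (fromCommutativeRing R) morphism _≟ᵈ_ public
    using (solve; _:=_; _:+_; _:*_; _:-_; :-_; con; Polynomial)

  :0 :1 : ∀ {n} → Polynomial n
  :0 = con (0 , 0)
  :1 = con (1 , 0)

-- Ideals and Koszul complexes

module Ideals {c ℓ} (R : CommutativeRing c ℓ) where
  open CommutativeRing R
  open RingSolver R
  open Algebra.Properties.Ring ring using (-1*x≈-x; -0#≈0#)

  x+r-x≈r : ∀ x r → (x + r) - x ≈ r
  x+r-x≈r = solve 2 (λ x r → (x :+ r) :- x := r) refl

  f≈x+[f-x] : ∀ x f → f ≈ x + (f - x)
  f≈x+[f-x] = solve 2 (λ x f → f := x :+ (f :- x)) refl

  *-distrib-sub : ∀ z x f → (z - x) * f ≈ z * f - x * f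
  *-distrib-sub = solve 3 (λ z x f → (z :- x) :* f := z :* f :- x :* f) refl

  sub-*-cancel : ∀ z x y w → w ≈ z * y → w - (z - x) * y ≈ x * y
  sub-*-cancel z x y w e = trans (+-congʳ e) (solve 3 (λ z x y → z :* y :- (z :- x) :* y := x :* y) refl z x y)

  sub-*-cancel′ : ∀ z x y w → w ≈ x * y → w + (z - x) * y ≈ z * y
  sub-*-cancel′ z x y w e = trans (+-congʳ e) (solve 3 (λ z x y → x :* y :+ (z :- x) :* y := z :* y) refl z x y)

  add-*-cancel : ∀ f t r g → f ≈ t + r → f * g + - (t * g) ≈ r * g
  add-*-cancel f t r g e = trans (+-congʳ (*-congʳ e)) (solve 3 (λ t r g → (t :+ r) :* g :+ :- (t :* g) := r :* g) refl t r g)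

  sub-add-cancel : ∀ a x → (a - x) + x ≈ a
  sub-add-cancel = solve 2 (λ a x → (a :- x) :+ x := a) refl

  record IsIdeal (G : Carrier → Set (c ⊔ ℓ)) : Set (c ⊔ ℓ) where
    field
      resp : ∀ {x y} → x ≈ y → G x → G y
      0∈   : G 0#
      +∈   : ∀ {x y} → G x → G y → G (x + y)
      *∈   : ∀ r {x} → G x → G (r * x)

    -∈ : ∀ {x} → G x → G (- x)
    -∈ {x} p = resp (-1*x≈-x x) (*∈ (- 1#) p)

    *∈ʳ : ∀ r {x} → G x → G (x * r)
    *∈ʳ r p = resp (*-comm _ _) (*∈ r p)

  open IsIdeal

  ≈⇒-∈ : ∀ {G} → IsIdeal G → ∀ {x y} → x ≈ y → G (x - y)
  ≈⇒-∈ I {x} {y} e = resp I (trans (sym (-‿inverseʳ y)) (+-congʳ (sym e))) (0∈ I)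

  infixl 7 _/_
  -- The quotient keeps the carrier and only coarsens the equality. A chain over R is thus a chain
  -- over every quotient, and exactness modulo two ideals can be compared without transport.
  _/_ : ∀ {G} → CommutativeRing c ℓ → IsIdeal G → CommutativeRing c (c ⊔ ℓ)
  _/_ {G} _ I = record
    { Carrier = Carrier ; _≈_ = _∼_ ; _+_ = _+_ ; _*_ = _*_ ; -_ = -_ ; 0# = 0# ; 1# = 1#
    ; isCommutativeRing = record
      { isRing = record
        { +-isAbelianGroup = record
          { isGroup = record
            { isMonoid = record
              { isSemigroup = record
                { isMagma = record
                  { isEquivalence = record
                    { refl = ≈⇒∼ refl
                    ; sym = λ {x} {y} p → resp I (solve 2 (λ x y → :- (x :- y) := y :- x) refl x y) (-∈ I p)
                    ; trans = λ {x} {y} {z} p q → resp I (solve 3 (λ x y z → (x :- y) :+ (y :- z) := x :- z) refl x y z) (+∈ I p q)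
                    }
                  ; ∙-cong = λ {x} {y} {u} {v} p q → resp I
                      (solve 4 (λ x y u v → (x :- y) :+ (u :- v) := (x :+ u) :- (y :+ v)) refl x y u v) (+∈ I p q)
                  }
                ; assoc = λ x y z → ≈⇒∼ (+-assoc x y z)
                }
              ; identity = (λ x → ≈⇒∼ (+-identityˡ x)) , (λ x → ≈⇒∼ (+-identityʳ x))
              }
            ; inverse = (λ x → ≈⇒∼ (-‿inverseˡ x)) , (λ x → ≈⇒∼ (-‿inverseʳ x))
            ; ⁻¹-cong = λ {x} {y} p → resp I (solve 2 (λ x y → :- (x :- y) := :- x :- :- y) refl x y) (-∈ I p)
            }
          ; comm = λ x y → ≈⇒∼ (+-comm x y)
          }
        ; *-cong = λ {x} {y} {u} {v} p q → resp I
            (solve 4 (λ x y u v → u :* (x :- y) :+ y :* (u :- v) := x :* u :- y :* v) refl x y u v)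
            (+∈ I (*∈ I u p) (*∈ I y q))
        ; *-assoc = λ x y z → ≈⇒∼ (*-assoc x y z)
        ; *-identity = (λ x → ≈⇒∼ (*-identityˡ x)) , (λ x → ≈⇒∼ (*-identityʳ x))
        ; distrib = (λ x y z → ≈⇒∼ (distribˡ x y z)) , (λ x y z → ≈⇒∼ (distribʳ x y z))
        }
      ; *-comm = λ x y → ≈⇒∼ (*-comm x y)
      }
    }
    where
    _∼_ : Carrier → Carrier → Set _
    x ∼ y = G (x - y)
    ≈⇒∼ : ∀ {x y} → x ≈ y → x ∼ y
    ≈⇒∼ = ≈⇒-∈ I

  ∈⇒∼0 : ∀ {G} (I : IsIdeal G) {x} → G x → G (x - 0#)
  ∈⇒∼0 I {x} = resp I (solve 1 (λ x → x := x :- :0) refl x)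

  infix 4 _⊆ᵢ_
  _⊆ᵢ_ : (G H : Carrier → Set (c ⊔ ℓ)) → Set (c ⊔ ℓ)
  G ⊆ᵢ H = ∀ {x} → G x → H x

  NZD : (G : Carrier → Set (c ⊔ ℓ)) → Carrier → Set (c ⊔ ℓ)
  NZD G f = ∀ a → G (f * a) → G a

  -- The ideal G + (xs).
  Comb : (Carrier → Set (c ⊔ ℓ)) → List Carrier → Carrier → Set (c ⊔ ℓ)
  Comb G [] f = G f
  Comb G (x ∷ xs) f = ∃[ r ] Comb G xs (f - r * x)

  module _ {G : Carrier → Set (c ⊔ ℓ)} (I : IsIdeal G) where

    comb-ideal : ∀ xs → IsIdeal (Comb G xs)
    comb-ideal [] = I
    comb-ideal (x ∷ xs) = record
      { resp = λ e (r , p) → r , resp J (+-congʳ e) p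
      ; 0∈ = 0# , resp J (solve 1 (λ x → :0 := :0 :- :0 :* x) refl x) (0∈ J)
      ; +∈ = λ {a} {b} (r , p) (s , q) → r + s , resp J
          (solve 5 (λ a b r s x → (a :- r :* x) :+ (b :- s :* x) := (a :+ b) :- (r :+ s) :* x) refl a b r s x)
          (+∈ J p q)
      ; *∈ = λ t {a} (r , p) → t * r , resp J
          (solve 4 (λ t a r x → t :* (a :- r :* x) := t :* a :- (t :* r) :* x) refl t a r x)
          (*∈ J t p)
      }
      where J = comb-ideal xs

    comb-cons : ∀ y xs → Comb G xs ⊆ᵢ Comb G (y ∷ xs)
    comb-cons y xs {f} p = 0# , resp (comb-ideal xs) (solve 2 (λ f y → f := f :- :0 :* y) refl f y) p

    comb-base : ∀ xs → G ⊆ᵢ Comb G xs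
    comb-base [] p = p
    comb-base (x ∷ xs) p = comb-cons x xs (comb-base xs p)

    comb-gen : ∀ {xs} {x} → x ∈ₗ xs → Comb G xs x
    comb-gen {x ∷ xs} (here ≡.refl) = 1# , resp (comb-ideal xs)
      (solve 1 (λ x → :0 := x :- :1 :* x) refl x) (0∈ (comb-ideal xs))
    comb-gen {y ∷ xs} (there p) = comb-cons y xs (comb-gen p)

    comb-elim : ∀ {H} → IsIdeal H → G ⊆ᵢ H → ∀ xs → All H xs → Comb G xs ⊆ᵢ H
    comb-elim J inc [] [] p = inc p
    comb-elim J inc (x ∷ xs) (px ∷ pxs) {f} (r , p) = resp J
      (solve 3 (λ f r x → (f :- r :* x) :+ r :* x := f) refl f r x)
      (+∈ J (comb-elim J inc xs pxs p) (*∈ J r px))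

    comb-mono : ∀ xs ys → (∀ {x} → x ∈ₗ xs → Comb G ys x) → Comb G xs ⊆ᵢ Comb G ys
    comb-mono xs ys f = comb-elim (comb-ideal ys) (comb-base ys) xs (All.tabulate f)

module Koszul {c ℓ} (R : CommutativeRing c ℓ) where
  open CommutativeRing R using (Carrier; _+_; _*_; -_; _-_; 0#; 1#)
  open Ideals R public

  -- Chains of the Koszul complex: the value at S is the coefficient of the
  -- wedge of the basis vectors selected by S.
  K : List Carrier → Set c
  K xs = Vec Bool (length xs) → Carrier

  -- Recursively the mapping cone of multiplication by `x` on the complex of `xs`; the minus sign on
  -- the `true` half makes the square vanish.
  ∂ : ∀ xs → K xs → K xs
  ∂ [] z _ = 0#
  ∂ (x ∷ xs) z (false ∷ S) = x * z (true ∷ S) + ∂ xs (λ T → z (false ∷ T)) S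
  ∂ (x ∷ xs) z (true ∷ S) = - ∂ xs (λ T → z (true ∷ T)) S

  pt : ∀ {m} → Carrier → Vec Bool m → Carrier
  pt a [] = a
  pt a (false ∷ S) = pt a S
  pt a (true ∷ S) = 0#

  -- A chain that vanishes in low degrees modulo one ideal need not do so modulo a smaller one.
  -- Overwriting these values by `0#` makes them vanish modulo every ideal and leaves the chain
  -- unchanged modulo the first.
  trunc : ∀ {m} → ℕ → (Vec Bool m → Carrier) → Vec Bool m → Carrier
  trunc k z S with ∣ S ∣ ℕ.<? k
  ... | yes _ = 0#
  ... | no _ = z S

  module Cycles {G : Carrier → Set (c ⊔ ℓ)} (I : IsIdeal G) where
    open CommutativeRing (R / I) public
      renaming (_≈_ to _∼_) hiding (Carrier; _+_; _*_; -_; _-_; 0#; 1#)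
    open RingSolver (R / I) public
    open Relation.Binary.Reasoning.Setoid setoid public
    open Algebra.Properties.Ring ring public using (-0#≈0#)

    ∂-cong : ∀ xs {z w : K xs} → (∀ S → z S ∼ w S) → ∀ S → ∂ xs z S ∼ ∂ xs w S
    ∂-cong [] e S = refl
    ∂-cong (x ∷ xs) e (false ∷ S) = +-cong (*-congˡ (e _)) (∂-cong xs (λ T → e _) S)
    ∂-cong (x ∷ xs) e (true ∷ S) = -‿cong (∂-cong xs (λ T → e _) S)

    ∂-linear : ∀ xs r (z w : K xs) S → ∂ xs (λ T → r * z T + w T) S ∼ r * ∂ xs z S + ∂ xs w S
    ∂-linear [] r z w S = solve 1 (λ r → :0 := r :* :0 :+ :0) refl r
    ∂-linear (x ∷ xs) r z w (false ∷ S) = trans (+-congˡ (∂-linear xs r _ _ S))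
      (solve 6 (λ x r a b p q → x :* (r :* a :+ b) :+ (r :* p :+ q) := r :* (x :* a :+ p) :+ (x :* b :+ q))
        refl x r _ _ _ _)
    ∂-linear (x ∷ xs) r z w (true ∷ S) = trans (-‿cong (∂-linear xs r _ _ S))
      (solve 3 (λ r p q → :- (r :* p :+ q) := r :* :- p :+ :- q) refl r _ _)

    ∂-zero : ∀ xs {z : K xs} → (∀ S → z S ∼ 0#) → ∀ S → ∂ xs z S ∼ 0#
    ∂-zero [] e S = refl
    ∂-zero (x ∷ xs) e (false ∷ S) = trans (+-cong (*-congˡ (e _)) (∂-zero xs (λ T → e _) S))
      (solve 1 (λ x → x :* :0 :+ :0 := :0) refl x)
    ∂-zero (x ∷ xs) e (true ∷ S) = trans (-‿cong (∂-zero xs (λ T → e _) S)) -0#≈0#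

    ∂∂ : ∀ xs (z : K xs) S → ∂ xs (∂ xs z) S ∼ 0#
    ∂∂ [] z S = refl
    ∂∂ (x ∷ xs) z (false ∷ S) = begin
      x * - ∂ xs z₁ S + ∂ xs (λ T → x * z₁ T + ∂ xs z₀ T) S
        ≈⟨ +-congˡ (∂-linear xs x z₁ (∂ xs z₀) S) ⟩
      x * - ∂ xs z₁ S + (x * ∂ xs z₁ S + ∂ xs (∂ xs z₀) S)
        ≈⟨ +-congˡ (+-congˡ (∂∂ xs z₀ S)) ⟩
      x * - ∂ xs z₁ S + (x * ∂ xs z₁ S + 0#)
        ≈⟨ solve 2 (λ x a → x :* :- a :+ (x :* a :+ :0) := :0) refl x _ ⟩
      0# ∎
      where
      z₀ = λ T → z (false ∷ T)
      z₁ = λ T → z (true ∷ T)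
    ∂∂ (x ∷ xs) z (true ∷ S) = begin
      - ∂ xs (λ T → - ∂ xs z₁ T) S
        ≈⟨ -‿cong (∂-cong xs (λ T → solve 1 (λ a → :- a := :- :1 :* a :+ :0) refl _) S) ⟩
      - ∂ xs (λ T → - 1# * ∂ xs z₁ T + 0#) S
        ≈⟨ -‿cong (∂-linear xs (- 1#) (∂ xs z₁) (λ _ → 0#) S) ⟩
      - (- 1# * ∂ xs (∂ xs z₁) S + ∂ xs (λ _ → 0#) S)
        ≈⟨ -‿cong (+-cong (*-congˡ (∂∂ xs z₁ S)) (∂-zero xs (λ _ → refl) S)) ⟩
      - (- 1# * 0# + 0#)
        ≈⟨ solve 0 (:- (:- :1 :* :0 :+ :0) := :0) refl ⟩
      0# ∎
      where z₁ = λ T → z (true ∷ T)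

    -- For f = Σ rᵢ xᵢ modulo G, exterior multiplication with Σ rᵢ eᵢ is a
    -- homotopy between 0 and multiplication by f.
    homotopy : ∀ xs {f} → Comb G xs f → K xs → K xs
    homotopy [] p z S = 0#
    homotopy (x ∷ xs) (r , p) z (false ∷ S) = homotopy xs p (λ T → z (false ∷ T)) S
    homotopy (x ∷ xs) (r , p) z (true ∷ S) =
      r * z (false ∷ S) + - homotopy xs p (λ T → z (true ∷ T)) S

    homotopy-cong : ∀ xs {f} (p : Comb G xs f) {z w : K xs} → (∀ S → z S ∼ w S) →
      ∀ S → homotopy xs p z S ∼ homotopy xs p w S
    homotopy-cong [] p e S = refl
    homotopy-cong (x ∷ xs) (r , p) e (false ∷ S) = homotopy-cong xs p (λ T → e _) S
    homotopy-cong (x ∷ xs) (r , p) e (true ∷ S) =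
      +-cong (*-congˡ (e _)) (-‿cong (homotopy-cong xs p (λ T → e _) S))

    homotopy-linear : ∀ xs {f} (p : Comb G xs f) s (z w : K xs) S →
      homotopy xs p (λ T → s * z T + w T) S ∼ s * homotopy xs p z S + homotopy xs p w S
    homotopy-linear [] p s z w S = solve 1 (λ s → :0 := s :* :0 :+ :0) refl s
    homotopy-linear (x ∷ xs) (r , p) s z w (false ∷ S) = homotopy-linear xs p s _ _ S
    homotopy-linear (x ∷ xs) (r , p) s z w (true ∷ S) =
      trans (+-congˡ (-‿cong (homotopy-linear xs p s _ _ S)))
        (solve 6 (λ r s a b p q → r :* (s :* a :+ b) :+ :- (s :* p :+ q) := s :* (r :* a :+ :- p) :+ (r :* b :+ :- q))
          refl r s _ _ _ _)

    homotopy-zero : ∀ xs {f} (p : Comb G xs f) {z : K xs} → (∀ S → z S ∼ 0#) →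
      ∀ S → homotopy xs p z S ∼ 0#
    homotopy-zero [] p e S = refl
    homotopy-zero (x ∷ xs) (r , p) e (false ∷ S) = homotopy-zero xs p (λ T → e _) S
    homotopy-zero (x ∷ xs) (r , p) e (true ∷ S) =
      trans (+-cong (*-congˡ (e _)) (-‿cong (homotopy-zero xs p (λ T → e _) S)))
        (solve 1 (λ r → r :* :0 :+ :- :0 := :0) refl r)

    homotopy-eq : ∀ xs {f} (p : Comb G xs f) (z : K xs) S →
      ∂ xs (homotopy xs p z) S + homotopy xs p (∂ xs z) S ∼ f * z S
    homotopy-eq [] {f} p z S = begin
      0# + 0#    ≈⟨ solve 1 (λ a → :0 :+ :0 := :0 :* a) refl (z S) ⟩
      0# * z S   ≈⟨ *-congʳ (∈⇒∼0 I p) ⟨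
      f * z S ∎
    homotopy-eq (x ∷ xs) {f} (r , p) z (false ∷ S) = begin
      (x * (r * z₀ S + - h z₁ S) + ∂ xs (h z₀) S) + h (λ T → x * z₁ T + ∂ xs z₀ T) S
        ≈⟨ +-congˡ (homotopy-linear xs p x z₁ (∂ xs z₀) S) ⟩
      (x * (r * z₀ S + - h z₁ S) + ∂ xs (h z₀) S) + (x * h z₁ S + h (∂ xs z₀) S)
        ≈⟨ solve 6 (λ x r a b c d → (x :* (r :* a :+ :- b) :+ c) :+ (x :* b :+ d) := r :* x :* a :+ (c :+ d))
             refl x r _ _ _ _ ⟩
      r * x * z₀ S + (∂ xs (h z₀) S + h (∂ xs z₀) S)
        ≈⟨ +-congˡ (homotopy-eq xs p z₀ S) ⟩
      r * x * z₀ S + (f + - (r * x)) * z₀ S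
        ≈⟨ solve 3 (λ f y a → y :* a :+ (f :+ :- y) :* a := f :* a) refl f (r * x) _ ⟩
      f * z₀ S ∎
      where
      h = homotopy xs p
      z₀ = λ T → z (false ∷ T)
      z₁ = λ T → z (true ∷ T)
    homotopy-eq (x ∷ xs) {f} (r , p) z (true ∷ S) = begin
      - ∂ xs (λ T → r * z₀ T + - h z₁ T) S + (r * (x * z₁ S + ∂ xs z₀ S) + - h (λ T → - ∂ xs z₁ T) S)
        ≈⟨ +-cong (-‿cong (trans (∂-linear xs r z₀ _ S) (+-congˡ (negate-∂ (h z₁))))) (+-congˡ (-‿cong negate-h)) ⟩
      - (r * ∂ xs z₀ S + - ∂ xs (h z₁) S) + (r * (x * z₁ S + ∂ xs z₀ S) + - - h (∂ xs z₁) S)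
        ≈⟨ solve 6 (λ x r a b c d → :- (r :* a :+ :- c) :+ (r :* (x :* b :+ a) :+ :- :- d) := r :* x :* b :+ (c :+ d))
             refl x r _ _ _ _ ⟩
      r * x * z₁ S + (∂ xs (h z₁) S + h (∂ xs z₁) S)
        ≈⟨ +-congˡ (homotopy-eq xs p z₁ S) ⟩
      r * x * z₁ S + (f + - (r * x)) * z₁ S
        ≈⟨ solve 3 (λ f y a → y :* a :+ (f :+ :- y) :* a := f :* a) refl f (r * x) _ ⟩
      f * z₁ S ∎
      where
      h = homotopy xs p
      z₀ = λ T → z (false ∷ T)
      z₁ = λ T → z (true ∷ T)
      neg : ∀ a → - a ∼ - 1# * a + 0#
      neg = solve 1 (λ a → :- a := :- :1 :* a :+ :0) refl
      negate-∂ : ∀ w → ∂ xs (λ T → - w T) S ∼ - ∂ xs w S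
      negate-∂ w = trans (∂-cong xs (λ T → neg (w T)) S)
        (trans (∂-linear xs (- 1#) w (λ _ → 0#) S) (trans (+-congˡ (∂-zero xs (λ _ → refl) S)) (sym (neg _))))
      negate-h : h (λ T → - ∂ xs z₁ T) S ∼ - h (∂ xs z₁) S
      negate-h = trans (homotopy-cong xs p (λ T → neg (∂ xs z₁ T)) S)
        (trans (homotopy-linear xs p (- 1#) (∂ xs z₁) (λ _ → 0#) S)
          (trans (+-congˡ (homotopy-zero xs p (λ _ → refl) S)) (sym (neg _))))

    -- Chains concentrated in degrees ≥ k modulo G.
    From : ℕ → ∀ {m} → (Vec Bool m → Carrier) → Set (c ⊔ ℓ)
    From k z = ∀ S → ∣ S ∣ ℕ.< k → z S ∼ 0#

    -- Exact k xs : Hᵢ(xs; R/G) = 0 for all i ≥ k.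
    Exact : ℕ → List Carrier → Set (c ⊔ ℓ)
    Exact k xs = ∀ (z : K xs) → From k z → (∀ S → ∂ xs z S ∼ 0#) →
      ∃[ w ] (From (suc k) w × (∀ S → ∂ xs w S ∼ z S))

    ∂-From : ∀ xs {k} {z : K xs} → From (suc k) z → From k (∂ xs z)
    ∂-From [] p S lt = refl
    ∂-From (x ∷ xs) p (false ∷ S) lt =
      trans (+-cong (*-congˡ (p (true ∷ S) (s≤s lt))) (∂-From xs (λ T lt → p (false ∷ T) lt) S lt))
        (solve 1 (λ x → x :* :0 :+ :0 := :0) refl x)
    ∂-From (x ∷ xs) {suc k} p (true ∷ S) (s≤s lt) =
      trans (-‿cong (∂-From xs (λ T lt → p (true ∷ T) (s≤s lt)) S lt)) -0#≈0#

    homotopy-From : ∀ xs {f} (p : Comb G xs f) {k} {z : K xs} → From k z → From (suc k) (homotopy xs p z)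
    homotopy-From [] p q S lt = refl
    homotopy-From (x ∷ xs) (r , p) q (false ∷ S) lt = homotopy-From xs p (λ T lt → q (false ∷ T) lt) S lt
    homotopy-From (x ∷ xs) (r , p) {suc k} q (true ∷ S) (s≤s lt) =
      trans (+-cong (*-congˡ (q (false ∷ S) lt))
                    (-‿cong (homotopy-From xs p (λ T lt → q (true ∷ T) (s≤s lt)) S lt)))
        (solve 1 (λ r → r :* :0 :+ :- :0 := :0) refl r)
    homotopy-From (x ∷ xs) (r , p) {zero} q (true ∷ S) (s≤s ())

    trunc-From : ∀ k {m} (z : Vec Bool m → Carrier) → From k (trunc k z)
    trunc-From k z S lt with ∣ S ∣ ℕ.<? k
    ... | yes _ = refl
    ... | no ¬lt = contradiction lt ¬lt

    trunc-∼ : ∀ {k m} {z : Vec Bool m → Carrier} → From k z → ∀ S → trunc k z S ∼ z S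
    trunc-∼ {k} p S with ∣ S ∣ ℕ.<? k
    ... | yes lt = sym (p S lt)
    ... | no _ = refl

    -- No subset has more elements than the list, so nothing lives in these degrees. This is the
    -- start of every induction on regular sequences.
    exact-above-length : ∀ {k} xs → length xs ℕ.< k → Exact k xs
    exact-above-length xs lt z p _ = (λ _ → 0#) , (λ _ _ → refl) ,
      λ S → trans (∂-zero xs (λ _ → refl) S) (sym (p S (ℕₚ.≤-<-trans (Subsetₚ.∣p∣≤n S) lt)))

    ∂-pt : ∀ xs a S → ∂ xs (pt a) S ∼ 0#
    ∂-pt [] a S = refl
    ∂-pt (x ∷ xs) a (false ∷ S) = trans (+-congˡ (∂-pt xs a S)) (solve 1 (λ x → x :* :0 :+ :0 := :0) refl x)
    ∂-pt (x ∷ xs) a (true ∷ S) = trans (-‿cong (∂-zero xs (λ _ → refl) S)) -0#≈0#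

    pt-∅ : ∀ {m} a (S : Vec Bool m) → ∣ S ∣ ℕ.< 1 → pt a S ∼ a
    pt-∅ a [] lt = refl
    pt-∅ a (false ∷ S) lt = pt-∅ a S lt
    pt-∅ a (true ∷ S) (s≤s ())

    pt-linear : ∀ {m} r a b (S : Vec Bool m) → pt (r * a + b) S ∼ r * pt a S + pt b S
    pt-linear r a b [] = refl
    pt-linear r a b (false ∷ S) = pt-linear r a b S
    pt-linear r a b (true ∷ S) = solve 1 (λ r → :0 := r :* :0 :+ :0) refl r

    pt-cong : ∀ {m} {a b} → a ∼ b → (S : Vec Bool m) → pt a S ∼ pt b S
    pt-cong e [] = e
    pt-cong e (false ∷ S) = pt-cong e S
    pt-cong e (true ∷ S) = refl

    ∂-Comb : ∀ xs (w : K xs) S → Comb G xs (∂ xs w S)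
    ∂-Comb [] w S = 0∈
      where open IsIdeal I
    ∂-Comb (x ∷ xs) w (false ∷ S) = +∈ (*∈ʳ _ (comb-gen I {x ∷ xs} (here ≡.refl))) (comb-cons I x xs (∂-Comb xs _ S))
      where open IsIdeal (comb-ideal I (x ∷ xs))
    ∂-Comb (x ∷ xs) w (true ∷ S) = -∈ (comb-cons I x xs (∂-Comb xs _ S))
      where open IsIdeal (comb-ideal I (x ∷ xs))

    comb-resp : ∀ xs {a b} → a ∼ b → Comb G xs a → Comb G xs b
    comb-resp xs {a} {b} e p = resp (R-solve a b) (+∈ (-∈ (comb-base I xs e)) p)
      where
      open IsIdeal (comb-ideal I xs)
      module Q = RingSolver R
      R-solve : ∀ a b → CommutativeRing._≈_ R (- (a - b) + a) b
      R-solve = Q.solve 2 (λ a b → Q.:- (a Q.:- b) Q.:+ a Q.:= b) (CommutativeRing.refl R)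

    ∣∅∣<1 : ∀ m → ∣ ∅ {m} ∣ ℕ.< 1
    ∣∅∣<1 m = s≤s (ℕₚ.≤-reflexive (Subsetₚ.∣⊥∣≡0 m))

    -- H₀ is R/(G + (xs)): the degree-0 chain `pt 1#` is a cycle, and every coefficient of a
    -- boundary lies in G + (xs).
    exact-0⇒1∈ : ∀ xs → Exact 0 xs → Comb G xs 1#
    exact-0⇒1∈ xs ex with ex (pt 1#) (λ _ ()) (∂-pt xs 1#)
    ... | w , _ , e = comb-resp xs (trans (e ∅) (pt-∅ 1# (∅ {length xs}) (∣∅∣<1 (length xs)))) (∂-Comb xs w ∅)

    -- The 1-chain Σ rᵢ eᵢ, where the rᵢ are the coefficients in f = Σ rᵢ xᵢ that the membership
    -- proof records.
    linear-chain : ∀ xs {f} → Comb G xs f → K xs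
    linear-chain [] p S = 0#
    linear-chain (x ∷ xs) (r , p) (false ∷ S) = linear-chain xs p S
    linear-chain (x ∷ xs) (r , p) (true ∷ S) = pt r S

    linear-chain-From : ∀ xs {f} (p : Comb G xs f) → From 1 (linear-chain xs p)
    linear-chain-From [] p S lt = refl
    linear-chain-From (x ∷ xs) (r , p) (false ∷ S) lt = linear-chain-From xs p S lt
    linear-chain-From (x ∷ xs) (r , p) (true ∷ S) (s≤s ())

    ∂-linear-chain : ∀ xs {f} (p : Comb G xs f) S → ∂ xs (linear-chain xs p) S ∼ pt f S
    ∂-linear-chain [] p [] = sym (∈⇒∼0 I p)
    ∂-linear-chain (x ∷ xs) {f} (r , p) (false ∷ S) = begin
      x * pt r S + ∂ xs (linear-chain xs p) S   ≈⟨ +-congˡ (∂-linear-chain xs p S) ⟩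
      x * pt r S + pt (f - r * x) S             ≈⟨ pt-linear x r _ S ⟨
      pt (x * r + (f - r * x)) S                ≈⟨ pt-cong (solve 3 (λ x r f → x :* r :+ (f :- r :* x) := f) refl x r f) S ⟩
      pt f S ∎
    ∂-linear-chain (x ∷ xs) (r , p) (true ∷ S) = trans (-‿cong (∂-pt xs r S)) -0#≈0#

    -- A relation y a = Σ rᵢ xᵢ modulo G is the 1-cycle a e_y - Σ rᵢ eᵢ. If it bounds, its
    -- e_y-coefficient `a` is, up to sign, a coefficient of a boundary in the complex of `xs`.
    exact-1⇒NZD : ∀ y xs → Exact 1 (y ∷ xs) → NZD (Comb G xs) y
    exact-1⇒NZD y xs ex a ya∈ with ex z z-From z-cycle
      where
      z : K (y ∷ xs)
      z (false ∷ S) = - linear-chain xs ya∈ S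
      z (true ∷ S) = pt a S
      z-From : From 1 z
      z-From (false ∷ S) lt = trans (-‿cong (linear-chain-From xs ya∈ S lt)) -0#≈0#
      z-From (true ∷ S) (s≤s ())
      z-cycle : ∀ S → ∂ (y ∷ xs) z S ∼ 0#
      z-cycle (false ∷ S) = begin
        y * pt a S + ∂ xs (λ T → - linear-chain xs ya∈ T) S
          ≈⟨ +-congˡ (∂-cong xs (λ T → solve 1 (λ a → :- a := :- :1 :* a :+ :0) refl _) S) ⟩
        y * pt a S + ∂ xs (λ T → - 1# * linear-chain xs ya∈ T + 0#) S
          ≈⟨ +-congˡ (∂-linear xs (- 1#) _ _ S) ⟩
        y * pt a S + (- 1# * ∂ xs (linear-chain xs ya∈) S + ∂ xs (λ _ → 0#) S)
          ≈⟨ +-congˡ (+-cong (*-congˡ (trans (∂-linear-chain xs ya∈ S) (pt-cong (sym (+-identityʳ _)) S))) (∂-zero xs (λ _ → refl) S)) ⟩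
        y * pt a S + (- 1# * pt (y * a + 0#) S + 0#)
          ≈⟨ +-congˡ (+-congʳ (*-congˡ (trans (pt-linear y a 0# S) (+-congˡ (pt-0 S))))) ⟩
        y * pt a S + (- 1# * (y * pt a S + 0#) + 0#)
          ≈⟨ solve 1 (λ p → p :+ (:- :1 :* (p :+ :0) :+ :0) := :0) refl _ ⟩
        0# ∎
        where
        pt-0 : ∀ {m} (S : Vec Bool m) → pt 0# S ∼ 0#
        pt-0 [] = refl
        pt-0 (false ∷ S) = pt-0 S
        pt-0 (true ∷ S) = refl
      z-cycle (true ∷ S) = trans (-‿cong (∂-pt xs a S)) -0#≈0#
    ... | w , _ , e = comb-resp xs (trans (e (true ∷ ∅)) (pt-∅ a (∅ {length xs}) (∣∅∣<1 (length xs))))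
                        (-∈ (∂-Comb xs (λ T → w (true ∷ T)) ∅))
      where open IsIdeal (comb-ideal I xs)

-- Koszul homology before and after dividing out a nonzerodivisor

module ChangeOfIdeal {c ℓ} (R : CommutativeRing c ℓ) where
  open CommutativeRing R using (Carrier; _+_; _*_; -_; _-_; 0#; 1#)
  open Koszul R
  private
    module R = CommutativeRing R
    module RS = RingSolver R

  module _ {G H : Carrier → Set (c ⊔ ℓ)} (I : IsIdeal G) (J : IsIdeal H) (G⊆H : G ⊆ᵢ H)
    {f : Carrier} (f∈H : H f) (split : ∀ {a} → H a → ∃[ b ] G (a - f * b)) (nzd : NZD G f) where

    private
      module CH = Cycles J
    open Cycles I

    private
      cancel : ∀ {a b} → f * a ∼ f * b → a ∼ b
      cancel {a} {b} p = nzd (a - b) (IsIdeal.resp I (RS.solve 3 (λ f a b → f RS.:* a RS.:- f RS.:* b RS.:= f RS.:* (a RS.:- b)) R.refl f a b) p)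

      cancel₀ : ∀ {a} → f * a ∼ 0# → a ∼ 0#
      cancel₀ p = cancel (trans p (solve 1 (λ f → :0 := f :* :0) refl f))

      split′ : ∀ {a b} → a CH.∼ b → ∃[ q ] (a ∼ b + f * q)
      split′ {a} {b} p = proj₁ (split p) ,
        IsIdeal.resp I (RS.solve 4 (λ a b f q → (a RS.:- b) RS.:- f RS.:* q RS.:= a RS.:- (b RS.:+ f RS.:* q)) R.refl a b f _)
          (proj₂ (split p))

      f*∼0 : ∀ a → f * a CH.∼ 0#
      f*∼0 a = ∈⇒∼0 J (IsIdeal.*∈ʳ J a f∈H)

    -- In the long exact sequence of 0 → R/G → R/G → R/H → 0, with first map f, multiplication by f
    -- is zero on Koszul homology because f lies in G + (xs). So Hᵢ(R/G) is a quotient of Hᵢ₊₁(R/H).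
    -- On chains: the homotopy gives w₀ with boundary f z, modulo H it bounds some v, and dividing
    -- w₀ - ∂v by f gives the chain sought.
    exact-descend : ∀ {k} xs → Comb G xs f → CH.Exact (suc k) xs → Exact k xs
    exact-descend {k} xs p ex z zF zc = b , bF , λ S → cancel (f∂b S)
      where
      w₀ = homotopy xs p z
      ∂w₀ : ∀ S → ∂ xs w₀ S ∼ f * z S
      ∂w₀ S = begin
        ∂ xs w₀ S                                 ≈⟨ +-identityʳ _ ⟨
        ∂ xs w₀ S + 0#                            ≈⟨ +-congˡ (homotopy-zero xs p zc S) ⟨
        ∂ xs w₀ S + homotopy xs p (∂ xs z) S      ≈⟨ homotopy-eq xs p z S ⟩
        f * z S ∎
      w₀F = homotopy-From xs p zF
      bound = ex w₀ (λ S lt → G⊆H (w₀F S lt)) (λ S → CH.trans (G⊆H (∂w₀ S)) (f*∼0 (z S)))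
      -- The bounding chain vanishes in low degrees only modulo H, while `bF` needs this modulo G.
      v = trunc (suc (suc k)) (proj₁ bound)
      ∂v : ∀ S → w₀ S CH.∼ ∂ xs v S
      ∂v S = CH.sym (CH.trans (CH.∂-cong xs (CH.trunc-∼ (proj₁ (proj₂ bound))) S) (proj₂ (proj₂ bound) S))
      b : K xs
      b S = proj₁ (split′ (∂v S))
      b-eq : ∀ S → w₀ S ∼ ∂ xs v S + f * b S
      b-eq S = proj₂ (split′ (∂v S))
      bF : From (suc k) b
      bF S lt = cancel₀ (begin
        f * b S                  ≈⟨ +-identityˡ _ ⟨
        0# + f * b S             ≈⟨ +-congʳ (∂-From xs (trunc-From (suc (suc k)) (proj₁ bound)) S lt) ⟨
        ∂ xs v S + f * b S       ≈⟨ b-eq S ⟨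
        w₀ S                     ≈⟨ w₀F S lt ⟩
        0# ∎)
      f∂b : ∀ S → f * ∂ xs b S ∼ f * z S
      f∂b S = begin
        f * ∂ xs b S                         ≈⟨ +-identityʳ _ ⟨
        f * ∂ xs b S + 0#                    ≈⟨ +-congˡ (∂∂ xs v S) ⟨
        f * ∂ xs b S + ∂ xs (∂ xs v) S       ≈⟨ ∂-linear xs f b (∂ xs v) S ⟨
        ∂ xs (λ T → f * b T + ∂ xs v T) S    ≈⟨ ∂-cong xs (λ T → trans (+-comm _ _) (sym (b-eq T))) S ⟩
        ∂ xs w₀ S                            ≈⟨ ∂w₀ S ⟩
        f * z S ∎

    -- The other end of the same long exact sequence: Hᵢ(R/H) sits between Hᵢ(R/G) and Hᵢ₋₁(R/G).
    -- For this reason exactness of R/G is asked one degree lower as well.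
    exact-ascend : ∀ {k} xs → Exact k xs → Exact (suc k) xs → CH.Exact (suc k) xs
    exact-ascend {k} xs ex ex′ z zF zc = w , (λ S lt → G⊆H (wF S lt)) ,
      λ S → CH.trans (G⊆H (∂w S)) (CH.trans (u∼z′ S) (CH.trunc-∼ zF S))
      where
      z′ = trunc (suc k) z
      z′F = trunc-From (suc k) z
      z′c : ∀ S → ∂ xs z′ S CH.∼ 0#
      z′c S = CH.trans (CH.∂-cong xs (CH.trunc-∼ zF) S) (zc S)
      b : K xs
      b S = proj₁ (split′ (z′c S))
      b-eq : ∀ S → ∂ xs z′ S ∼ f * b S
      b-eq S = trans (proj₂ (split′ (z′c S))) (+-identityˡ _)
      bF : From k b
      bF S lt = cancel₀ (trans (sym (b-eq S)) (∂-From xs z′F S lt))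
      linear₀ : ∀ r u S → ∂ xs (λ T → r * u T) S ∼ r * ∂ xs u S
      linear₀ r u S = begin
        ∂ xs (λ T → r * u T) S            ≈⟨ ∂-cong xs (λ T → +-identityʳ _) S ⟨
        ∂ xs (λ T → r * u T + 0#) S       ≈⟨ ∂-linear xs r u (λ _ → 0#) S ⟩
        r * ∂ xs u S + ∂ xs (λ _ → 0#) S  ≈⟨ +-congˡ (∂-zero xs (λ _ → refl) S) ⟩
        r * ∂ xs u S + 0#                 ≈⟨ +-identityʳ _ ⟩
        r * ∂ xs u S ∎
      bc : ∀ S → ∂ xs b S ∼ 0#
      bc S = cancel₀ (trans (sym (linear₀ f b S)) (trans (∂-cong xs (λ T → sym (b-eq T)) S) (∂∂ xs z′ S)))
      y-bound = ex b bF bc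
      y = proj₁ y-bound
      -- The boundary of z′ is f b with b a cycle modulo G, hence b = ∂y. Subtracting f y turns z′
      -- into a cycle modulo G without changing it modulo H.
      u : K xs
      u S = - f * y S + z′ S
      uF : From (suc k) u
      uF S lt = trans (+-cong (*-congˡ (proj₁ (proj₂ y-bound) S lt)) (z′F S lt)) (solve 1 (λ f → :- f :* :0 :+ :0 := :0) refl f)
      uc : ∀ S → ∂ xs u S ∼ 0#
      uc S = begin
        ∂ xs u S                           ≈⟨ ∂-linear xs (- f) y z′ S ⟩
        - f * ∂ xs y S + ∂ xs z′ S         ≈⟨ +-cong (*-congˡ (proj₂ (proj₂ y-bound) S)) (b-eq S) ⟩
        - f * b S + f * b S                ≈⟨ solve 2 (λ f b → :- f :* b :+ f :* b := :0) refl f _ ⟩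
        0# ∎
      w-bound = ex′ u uF uc
      w = proj₁ w-bound
      wF = proj₁ (proj₂ w-bound)
      ∂w = proj₂ (proj₂ w-bound)
      u∼z′ : ∀ S → u S CH.∼ z′ S
      u∼z′ S = CH.trans (CH.+-congʳ (CH.trans (CH.solve 2 (λ f y → CH.:- f CH.:* y CH.:= f CH.:* CH.:- y) CH.refl f (y S)) (f*∼0 (- y S))))
        (CH.+-identityˡ _)

-- Removing elements from a Koszul complex

module KoszulProperties {c ℓ} (R : CommutativeRing c ℓ) where
  open CommutativeRing R using (Carrier; _+_; _*_; -_; _-_; 0#; 1#)
  open Koszul R
  open Algebra.Properties.Semiring.Exp (CommutativeRing.semiring R) using (_^_)

  module _ {G : Carrier → Set (c ⊔ ℓ)} (I : IsIdeal G) where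
    open Cycles I

    Boundary : ℕ → ∀ xs → K xs → Set (c ⊔ ℓ)
    Boundary k xs z = ∃[ w ] (From k w × (∀ S → ∂ xs w S ∼ z S))

    -- Exactness of the cone from degree `suc k` on makes multiplication by y injective on Hᵢ(xs)
    -- for i ≥ k. There it is also nilpotent, since elements of G + (xs) act as zero on homology, so
    -- Hᵢ(xs) vanishes.
    exact-uncons : ∀ {k} y t xs → Comb G xs (y ^ t) → Exact (suc k) (y ∷ xs) → Exact k xs
    exact-uncons {k} y t xs yᵗ∈ ex z zF zc = strip t (homotopy xs yᵗ∈ z , homotopy-From xs yᵗ∈ zF , λ S → begin
        ∂ xs (homotopy xs yᵗ∈ z) S                                     ≈⟨ +-identityʳ _ ⟨
        ∂ xs (homotopy xs yᵗ∈ z) S + 0#                                ≈⟨ +-congˡ (homotopy-zero xs yᵗ∈ zc S) ⟨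
        ∂ xs (homotopy xs yᵗ∈ z) S + homotopy xs yᵗ∈ (∂ xs z) S        ≈⟨ homotopy-eq xs yᵗ∈ z S ⟩
        (y ^ t) * z S ∎)
      where
      -- Injectivity of y on chains: if y u = ∂w, then w together with -u is a cycle of the cone,
      -- and the y-component of a chain bounding it bounds u up to sign.
      step : ∀ u → From k u → (∀ S → ∂ xs u S ∼ 0#) → Boundary (suc k) xs (λ S → y * u S) → Boundary (suc k) xs u
      step u uF uc (w , wF , ∂w) with ex v vF vc
        where
        v : K (y ∷ xs)
        v (false ∷ S) = w S
        v (true ∷ S) = - u S
        vF : From (suc k) v
        vF (false ∷ S) lt = wF S lt
        vF (true ∷ S) (s≤s lt) = trans (-‿cong (uF S lt)) -0#≈0#
        vc : ∀ S → ∂ (y ∷ xs) v S ∼ 0#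
        vc (false ∷ S) = trans (+-congˡ (∂w S)) (solve 2 (λ y u → y :* :- u :+ y :* u := :0) refl y _)
        vc (true ∷ S) = begin
          - ∂ xs (λ T → - u T) S
            ≈⟨ -‿cong (∂-cong xs (λ T → solve 1 (λ a → :- a := :- :1 :* a :+ :0) refl _) S) ⟩
          - ∂ xs (λ T → - 1# * u T + 0#) S
            ≈⟨ -‿cong (trans (∂-linear xs (- 1#) u (λ _ → 0#) S) (+-cong (*-congˡ (uc S)) (∂-zero xs (λ _ → refl) S))) ⟩
          - (- 1# * 0# + 0#)
            ≈⟨ solve 0 (:- (:- :1 :* :0 :+ :0) := :0) refl ⟩
          0# ∎
      ... | q , qF , ∂q = (λ S → q (true ∷ S)) , (λ S lt → qF (true ∷ S) (s≤s lt)) ,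
            λ S → trans (solve 1 (λ a → a := :- :- a) refl _) (trans (-‿cong (∂q (true ∷ S))) (solve 1 (λ a → :- :- a := a) refl _))
      strip : ∀ t → Boundary (suc k) xs (λ S → (y ^ t) * z S) → Boundary (suc k) xs z
      strip zero (w , wF , ∂w) = w , wF , λ S → trans (∂w S) (*-identityˡ _)
      strip (suc t) (w , wF , ∂w) = strip t (step (λ S → (y ^ t) * z S)
        (λ S lt → trans (*-congˡ (zF S lt)) (zeroʳ _))
        (λ S → begin
          ∂ xs (λ T → (y ^ t) * z T) S                  ≈⟨ ∂-cong xs (λ T → +-identityʳ _) S ⟨
          ∂ xs (λ T → (y ^ t) * z T + 0#) S             ≈⟨ ∂-linear xs (y ^ t) z (λ _ → 0#) S ⟩
          (y ^ t) * ∂ xs z S + ∂ xs (λ _ → 0#) S        ≈⟨ +-cong (*-congˡ (zc S)) (∂-zero xs (λ _ → refl) S) ⟩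
          (y ^ t) * 0# + 0#                             ≈⟨ solve 1 (λ a → a :* :0 :+ :0 := :0) refl _ ⟩
          0# ∎)
        (w , wF , λ S → trans (∂w S) (*-assoc y (y ^ t) (z S))))

    exact-drop : ∀ {k} ys xs → All (λ y → ∃[ t ] Comb G xs (y ^ t)) ys →
      Exact (length ys ℕ.+ k) (ys ++ xs) → Exact k xs
    exact-drop [] xs [] ex = ex
    exact-drop (y ∷ ys) xs ((t , p) ∷ ps) ex = exact-drop ys xs ps
      (exact-uncons y t (ys ++ xs) (comb-mono I xs (ys ++ xs) (λ x∈ → comb-gen I (∈-++⁺ʳ ys x∈)) p) ex)

    -- τ e truncates to the part of degree < e.
    record Truncation : Set (c ⊔ ℓ) where
      field
        τ : ℕ → Carrier → Carrier
        τ-cong : ∀ e {a b} → a ∼ b → τ e a ∼ τ e b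
        τ-+ : ∀ e a b → τ e (a + b) ∼ τ e a + τ e b
        τ-zero : ∀ a → τ 0 a ∼ 0#
        τ-bound : ∀ a → ∃[ d ] (∀ e → d ℕ.≤ e → τ e a ∼ a)

      -- Commuting with truncation is all that Nakayama uses of the grading. For e < k the monus
      -- gives `τ 0`, which is zero, as it must be: a multiple of an element of degree k has no part
      -- below degree k.
      Homogeneous : ℕ → Carrier → Set (c ⊔ ℓ)
      Homogeneous k x = ∀ e a → τ e (x * a) ∼ x * τ (e ℕ.∸ k) a

    max-over : ∀ {m} (f : Vec Bool m → ℕ) → ∃[ d ] (∀ S → f S ℕ.≤ d)
    max-over {zero} f = f [] , λ { [] → ℕₚ.≤-refl }
    max-over {suc m} f with max-over (λ S → f (false ∷ S)) | max-over (λ S → f (true ∷ S))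
    ... | d , p | e , q = d ℕ.⊔ e , λ
      { (false ∷ S) → ℕₚ.≤-trans (p S) (ℕₚ.m≤m⊔n d e)
      ; (true ∷ S) → ℕₚ.≤-trans (q S) (ℕₚ.m≤n⊔m d e) }

    module Graded (T : Truncation) where
      open Truncation T

      τ-0# : ∀ e → τ e 0# ∼ 0#
      τ-0# e = begin
        τ e 0#                          ≈⟨ solve 1 (λ a → a := (a :+ a) :- a) refl _ ⟩
        (τ e 0# + τ e 0#) - τ e 0#      ≈⟨ +-congʳ (τ-+ e 0# 0#) ⟨
        τ e (0# + 0#) - τ e 0#          ≈⟨ +-congʳ (τ-cong e (+-identityˡ 0#)) ⟩
        τ e 0# - τ e 0#                 ≈⟨ -‿inverseʳ _ ⟩
        0# ∎

      τ-neg : ∀ e a → τ e (- a) ∼ - τ e a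
      τ-neg e a = begin
        τ e (- a)                            ≈⟨ solve 2 (λ a b → b := (a :+ b) :- a) refl _ _ ⟩
        (τ e a + τ e (- a)) - τ e a          ≈⟨ +-congʳ (τ-+ e a (- a)) ⟨
        τ e (a - a) - τ e a                  ≈⟨ +-congʳ (trans (τ-cong e (-‿inverseʳ a)) (τ-0# e)) ⟩
        0# - τ e a                           ≈⟨ +-identityˡ _ ⟩
        - τ e a ∎

      HomogeneousList : List Carrier → Set (c ⊔ ℓ)
      HomogeneousList = All (λ x → ∃[ k ] Homogeneous k x)

      weight : ∀ {xs} → HomogeneousList xs → Vec Bool (length xs) → ℕ
      weight [] S = 0
      weight (_ ∷ hs) (false ∷ S) = weight hs S
      weight ((k , _) ∷ hs) (true ∷ S) = k ℕ.+ weight hs S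

      -- The differential has degree 0 once e_S is given the degree of x_S.
      truncate : ∀ {xs} → HomogeneousList xs → ℕ → K xs → K xs
      truncate hs e z S = τ (e ℕ.∸ weight hs S) (z S)

      ∂-truncate : ∀ {xs} (hs : HomogeneousList xs) e z S →
        ∂ xs (truncate hs e z) S ∼ truncate hs e (∂ xs z) S
      ∂-truncate [] e z S = sym (τ-0# e)
      ∂-truncate {x ∷ xs} ((k , h) ∷ hs) e z (false ∷ S) = begin
        x * τ (e ℕ.∸ (k ℕ.+ weight hs S)) (z₁ S) + ∂ xs (truncate hs e z₀) S
          ≡⟨ ≡.cong (λ j → x * τ j (z₁ S) + ∂ xs (truncate hs e z₀) S) (swap k (weight hs S)) ⟩
        x * τ (e ℕ.∸ weight hs S ℕ.∸ k) (z₁ S) + ∂ xs (truncate hs e z₀) S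
          ≈⟨ +-cong (sym (h _ _)) (∂-truncate hs e z₀ S) ⟩
        τ (e ℕ.∸ weight hs S) (x * z₁ S) + τ (e ℕ.∸ weight hs S) (∂ xs z₀ S)
          ≈⟨ τ-+ _ _ _ ⟨
        τ (e ℕ.∸ weight hs S) (x * z₁ S + ∂ xs z₀ S) ∎
        where
        z₀ = λ T → z (false ∷ T)
        z₁ = λ T → z (true ∷ T)
        swap : ∀ a b → e ℕ.∸ (a ℕ.+ b) ≡ e ℕ.∸ b ℕ.∸ a
        swap a b = ≡.trans (≡.cong (e ℕ.∸_) (ℕₚ.+-comm a b)) (≡.sym (ℕₚ.∸-+-assoc e b a))
      ∂-truncate {x ∷ xs} ((k , h) ∷ hs) e z (true ∷ S) = begin
        - ∂ xs (λ T → τ (e ℕ.∸ (k ℕ.+ weight hs T)) (z₁ T)) S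
          ≈⟨ -‿cong (∂-cong xs (λ T → reflexive (≡.cong (λ j → τ j (z₁ T)) (≡.sym (ℕₚ.∸-+-assoc e k _)))) S) ⟩
        - ∂ xs (truncate hs (e ℕ.∸ k) z₁) S
          ≈⟨ -‿cong (∂-truncate hs (e ℕ.∸ k) z₁ S) ⟩
        - τ (e ℕ.∸ k ℕ.∸ weight hs S) (∂ xs z₁ S)
          ≈⟨ τ-neg _ _ ⟨
        τ (e ℕ.∸ k ℕ.∸ weight hs S) (- ∂ xs z₁ S)
          ≡⟨ ≡.cong (λ j → τ j (- ∂ xs z₁ S)) (ℕₚ.∸-+-assoc e k _) ⟩
        τ (e ℕ.∸ (k ℕ.+ weight hs S)) (- ∂ xs z₁ S) ∎
        where z₁ = λ T → z (true ∷ T)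

      -- Here exactness of the cone gives surjectivity of y on Hᵢ(xs) for i ≥ 1, where
      -- `exact-uncons` used injectivity. The degree of y is `suc k` because an element of degree 0,
      -- such as a unit, would prove nothing.
      exact-1-uncons : ∀ {k} y xs → Homogeneous (suc k) y → HomogeneousList xs →
        Exact 1 (y ∷ xs) → Exact 1 xs
      exact-1-uncons {k} y xs yh hs ex z zF zc =
        proj₁ bounding , proj₁ (proj₂ bounding) , λ S → trans (proj₂ (proj₂ bounding) S) (untruncated S)
        where
        swap : ∀ e a b → e ℕ.∸ a ℕ.∸ b ≡ e ℕ.∸ b ℕ.∸ a
        swap e a b = ≡.trans (ℕₚ.∸-+-assoc e a b) (≡.trans (≡.cong (e ℕ.∸_) (ℕₚ.+-comm a b)) (≡.sym (ℕₚ.∸-+-assoc e b a)))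

        -- If z = y q₁ + ∂q₀ and q₁, truncated `suc k` lower, is ∂p, then z truncated at e is the
        -- boundary of y p plus the truncation of q₀.
        step : ∀ e (q : K (y ∷ xs)) → From 2 q → ∀ z → (∀ S → ∂ (y ∷ xs) q (false ∷ S) ∼ z S) →
          Boundary 2 xs (truncate hs (e ℕ.∸ suc k) (λ S → q (true ∷ S))) → Boundary 2 xs (truncate hs e z)
        step e q qF z ∂q (p , pF , ∂p) = (λ S → y * p S + truncate hs e q₀ S) ,
          (λ S lt → trans (+-cong (*-congˡ (pF S lt)) (trans (τ-cong _ (qF (false ∷ S) lt)) (τ-0# _)))
                          (solve 1 (λ y → y :* :0 :+ :0 := :0) refl y)) ,
          λ S → begin
            ∂ xs (λ T → y * p T + truncate hs e q₀ T) S
              ≈⟨ ∂-linear xs y p (truncate hs e q₀) S ⟩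
            y * ∂ xs p S + ∂ xs (truncate hs e q₀) S
              ≈⟨ +-cong (*-congˡ (∂p S)) (∂-truncate hs e q₀ S) ⟩
            y * τ (e ℕ.∸ suc k ℕ.∸ weight hs S) (q₁ S) + τ (e ℕ.∸ weight hs S) (∂ xs q₀ S)
              ≡⟨ ≡.cong (λ j → y * τ j (q₁ S) + τ (e ℕ.∸ weight hs S) (∂ xs q₀ S)) (swap e (suc k) (weight hs S)) ⟩
            y * τ (e ℕ.∸ weight hs S ℕ.∸ suc k) (q₁ S) + τ (e ℕ.∸ weight hs S) (∂ xs q₀ S)
              ≈⟨ +-congʳ (yh (e ℕ.∸ weight hs S) (q₁ S)) ⟨
            τ (e ℕ.∸ weight hs S) (y * q₁ S) + τ (e ℕ.∸ weight hs S) (∂ xs q₀ S)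
              ≈⟨ τ-+ (e ℕ.∸ weight hs S) (y * q₁ S) (∂ xs q₀ S) ⟨
            τ (e ℕ.∸ weight hs S) (y * q₁ S + ∂ xs q₀ S)
              ≈⟨ τ-cong (e ℕ.∸ weight hs S) (∂q S) ⟩
            τ (e ℕ.∸ weight hs S) (z S) ∎
          where
          q₀ = λ T → q (false ∷ T)
          q₁ = λ T → q (true ∷ T)

        -- Graded Nakayama: a cycle is y times a cycle modulo boundaries, and
        -- the truncation degree drops with every such step.
        truncated : ∀ n e → e ℕ.≤ n → ∀ z → From 1 z → (∀ S → ∂ xs z S ∼ 0#) →
          Boundary 2 xs (truncate hs e z)
        truncated n zero _ z _ _ = (λ _ → 0#) , (λ _ _ → refl) , λ S →
          trans (∂-zero xs (λ _ → refl) S)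
            (sym (trans (reflexive (≡.cong (λ j → τ j (z S)) (ℕₚ.0∸n≡0 (weight hs S)))) (τ-zero _)))
        truncated (suc n) (suc e) (s≤s le) z zF zc =
          step (suc e) q qF z (λ S → ∂q (false ∷ S))
            (truncated n (e ℕ.∸ k) (ℕₚ.≤-trans (ℕₚ.m∸n≤m e k) le)
              (λ S → q (true ∷ S)) (λ S lt → qF (true ∷ S) (s≤s lt))
              (λ S → trans (solve 1 (λ a → a := :- :- a) refl (∂ xs (λ T → q (true ∷ T)) S))
                       (trans (-‿cong (∂q (true ∷ S))) -0#≈0#)))
          where
          z⁺ : K (y ∷ xs)
          z⁺ (false ∷ S) = z S
          z⁺ (true ∷ S) = 0#
          z⁺F : From 1 z⁺
          z⁺F (false ∷ S) lt = zF S lt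
          z⁺F (true ∷ S) lt = refl
          z⁺c : ∀ S → ∂ (y ∷ xs) z⁺ S ∼ 0#
          z⁺c (false ∷ S) = trans (+-congˡ (zc S)) (solve 1 (λ y → y :* :0 :+ :0 := :0) refl y)
          z⁺c (true ∷ S) = trans (-‿cong (∂-zero xs (λ _ → refl) S)) -0#≈0#
          bounding⁺ = ex z⁺ z⁺F z⁺c
          q = proj₁ bounding⁺
          qF = proj₁ (proj₂ bounding⁺)
          ∂q = proj₂ (proj₂ bounding⁺)

        -- There are finitely many positions S, so one degree is high enough for the truncation to
        -- leave z unchanged at all of them, even after the weight is subtracted.
        bound : ∃[ e ] (∀ S → proj₁ (τ-bound (z S)) ℕ.+ weight hs S ℕ.≤ e)
        bound = max-over (λ S → proj₁ (τ-bound (z S)) ℕ.+ weight hs S)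

        untruncated : ∀ S → truncate hs (proj₁ bound) z S ∼ z S
        untruncated S = proj₂ (τ-bound (z S)) _ (ℕₚ.m+n≤o⇒m≤o∸n _ (proj₂ bound S))

        bounding : Boundary 2 xs (truncate hs (proj₁ bound) z)
        bounding = truncated (proj₁ bound) (proj₁ bound) ℕₚ.≤-refl z zF zc

      -- The list is reversed because a regular sequence is read from the front while a Koszul
      -- complex grows by consing: the initial segments of `ys` are the tails of the reversed list.
      exact-1-peel : ∀ ys ds → All (λ y → ∃[ k ] Homogeneous (suc k) y) ys → HomogeneousList ds →
        Exact 1 (ys L.ʳ++ ds) → Exact 1 ds
      exact-1-peel [] ds [] hds ex = ex
      exact-1-peel (y ∷ ys) ds ((k , hy) ∷ hys) hds ex =
        exact-1-uncons {k} y ds hy hds (exact-1-peel ys (y ∷ ds) hys ((suc k , hy) ∷ hds) ex)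

-- Homomorphisms and elementary symmetric polynomials

record IsHom {c ℓ} (R S : CommutativeRing c ℓ)
  (φ : CommutativeRing.Carrier R → CommutativeRing.Carrier S) : Set (c ⊔ ℓ) where
  private
    module R = CommutativeRing R
    module S = CommutativeRing S
  field
    φ-cong : ∀ {a b} → a R.≈ b → φ a S.≈ φ b
    φ-+ : ∀ a b → φ (a R.+ b) S.≈ φ a S.+ φ b
    φ-* : ∀ a b → φ (a R.* b) S.≈ φ a S.* φ b
    φ-1 : φ R.1# S.≈ S.1#

  open RingSolver S
  open Relation.Binary.Reasoning.Setoid S.setoid

  φ-0 : φ R.0# S.≈ S.0#
  φ-0 = begin
    φ R.0#                                   ≈⟨ solve 1 (λ a → a := (a :+ a) :- a) S.refl _ ⟩
    (φ R.0# S.+ φ R.0#) S.- φ R.0#           ≈⟨ S.+-congʳ (φ-+ R.0# R.0#) ⟨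
    φ (R.0# R.+ R.0#) S.- φ R.0#             ≈⟨ S.+-congʳ (φ-cong (R.+-identityˡ R.0#)) ⟩
    φ R.0# S.- φ R.0#                        ≈⟨ S.-‿inverseʳ _ ⟩
    S.0# ∎

  φ-neg : ∀ a → φ (R.- a) S.≈ S.- φ a
  φ-neg a = begin
    φ (R.- a)                          ≈⟨ solve 2 (λ a b → b := (a :+ b) :- a) S.refl (φ a) _ ⟩
    (φ a S.+ φ (R.- a)) S.- φ a        ≈⟨ S.+-congʳ (φ-+ a (R.- a)) ⟨
    φ (a R.- a) S.- φ a                ≈⟨ S.+-congʳ (S.trans (φ-cong (R.-‿inverseʳ a)) φ-0) ⟩
    S.0# S.- φ a                       ≈⟨ S.+-identityˡ _ ⟩
    S.- φ a ∎

  φ-sub : ∀ a b → φ (a R.- b) S.≈ φ a S.- φ b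
  φ-sub a b = S.trans (φ-+ a (R.- b)) (S.+-congˡ (φ-neg b))

  preimage-ideal : ∀ {G} → Ideals.IsIdeal S G → Ideals.IsIdeal R (λ a → G (φ a))
  preimage-ideal I = record
    { resp = λ e → resp (φ-cong e)
    ; 0∈ = resp (S.sym φ-0) 0∈
    ; +∈ = λ p q → resp (S.sym (φ-+ _ _)) (+∈ p q)
    ; *∈ = λ r p → resp (S.sym (φ-* _ _)) (*∈ (φ r) p)
    }
    where open Ideals.IsIdeal I

id-isHom : ∀ {c ℓ} (R : CommutativeRing c ℓ) → IsHom R R (λ a → a)
id-isHom R = record { φ-cong = λ e → e ; φ-+ = λ _ _ → refl ; φ-* = λ _ _ → refl ; φ-1 = refl }
  where open CommutativeRing R using (refl)

module Symmetric {c ℓ} (R : CommutativeRing c ℓ) where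
  open CommutativeRing R
  open RingSolver R
  open Ideals R
  open Relation.Binary.Reasoning.Setoid setoid
  open Algebra.Properties.Semiring.Exp semiring using (_^_)

  -- The elementary symmetric polynomial of degree k with sign (-1)ᵏ, i.e. the
  -- coefficient of t^(length ys - k) in the product of the t - y.
  σ : List Carrier → ℕ → Carrier
  σ ys zero = 1#
  σ [] (suc k) = 0#
  σ (y ∷ ys) (suc k) = σ ys (suc k) - y * σ ys k

  horner : (ℕ → Carrier) → Carrier → ℕ → Carrier
  horner f t zero = f 0
  horner f t (suc m) = t * horner f t m + f (suc m)

  σ-vanish : ∀ ys {k} → length ys ℕ.< k → σ ys k ≈ 0#
  σ-vanish [] (s≤s _) = refl
  σ-vanish (y ∷ ys) {suc k} (s≤s lt) = begin
    σ ys (suc k) - y * σ ys k    ≈⟨ +-cong (σ-vanish ys (ℕₚ.m≤n⇒m≤1+n lt)) (-‿cong (*-congˡ (σ-vanish ys lt))) ⟩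
    0# - y * 0#                  ≈⟨ solve 1 (λ y → :0 :- y :* :0 := :0) refl y ⟩
    0# ∎

  horner-σ-∷ : ∀ y ys t m →
    horner (σ (y ∷ ys)) t (suc m) ≈ horner (σ ys) t (suc m) - y * horner (σ ys) t m
  horner-σ-∷ y ys t zero = solve 3 (λ a b y → a :+ (b :- y :* :1) := (a :+ b) :- y :* :1) refl _ _ y
  horner-σ-∷ y ys t (suc m) = begin
    t * horner (σ (y ∷ ys)) t (suc m) + (σ ys (2 ℕ.+ m) - y * σ ys (suc m))
      ≈⟨ +-congʳ (*-congˡ (horner-σ-∷ y ys t m)) ⟩
    t * (horner (σ ys) t (suc m) - y * horner (σ ys) t m) + (σ ys (2 ℕ.+ m) - y * σ ys (suc m))
      ≈⟨ solve 6 (λ t a y b p q → t :* (a :- y :* b) :+ (p :- y :* q) := (t :* a :+ p) :- y :* (t :* b :+ q))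
           refl t _ y (horner (σ ys) t m) _ _ ⟩
    horner (σ ys) t (2 ℕ.+ m) - y * horner (σ ys) t (suc m) ∎

  horner-σ-factor : ∀ y ys t →
    horner (σ (y ∷ ys)) t (suc (length ys)) ≈ (t - y) * horner (σ ys) t (length ys)
  horner-σ-factor y ys t = begin
    horner (σ (y ∷ ys)) t (suc (length ys))
      ≈⟨ horner-σ-∷ y ys t (length ys) ⟩
    (t * horner (σ ys) t (length ys) + σ ys (suc (length ys))) - y * horner (σ ys) t (length ys)
      ≈⟨ +-congʳ (+-congˡ (σ-vanish ys ℕₚ.≤-refl)) ⟩
    (t * horner (σ ys) t (length ys) + 0#) - y * horner (σ ys) t (length ys)
      ≈⟨ solve 3 (λ t a y → (t :* a :+ :0) :- y :* a := (t :- y) :* a) refl t _ y ⟩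
    (t - y) * horner (σ ys) t (length ys) ∎

  -- For m = length ys the Horner value is the product of all t - y′ with y′ in `ys`; at t = y one
  -- factor is zero.
  horner-σ-root : ∀ {y} ys → y ∈ₗ ys → horner (σ ys) y (length ys) ≈ 0#
  horner-σ-root {y} (x ∷ ys) (here ≡.refl) = trans (horner-σ-factor x ys x)
    (solve 2 (λ x a → (x :- x) :* a := :0) refl x _)
  horner-σ-root {y} (x ∷ ys) (there p) = trans (horner-σ-factor x ys y)
    (trans (*-congˡ (horner-σ-root ys p)) (zeroʳ _))

  select : (ys : List Carrier) → Vec Bool (length ys) → Carrier
  select [] S = 1#
  select (y ∷ ys) (false ∷ S) = select ys S
  select (y ∷ ys) (true ∷ S) = y * select ys S

  select-∅ : ∀ ys → select ys ∅ ≈ 1#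
  select-∅ [] = refl
  select-∅ (y ∷ ys) = select-∅ ys

  module _ {G : Carrier → Set (c ⊔ ℓ)} (I : IsIdeal G) where
    open IsIdeal I

    horner-∈ : ∀ f t m → (∀ k → G (f (suc k))) → G (horner f t m - (t ^ m) * f 0)
    horner-∈ f t zero p = resp (solve 1 (λ a → :0 := a :- :1 :* a) refl _) 0∈
    horner-∈ f t (suc m) p = resp
      (solve 5 (λ t a b q d → t :* (a :- q :* d) :+ b := (t :* a :+ b) :- (t :* q) :* d) refl t (horner f t m) _ (t ^ m) _)
      (+∈ (*∈ t (horner-∈ f t m p)) (p m))

    -- y is a root of a monic polynomial whose lower coefficients, the `σ ys (suc k)`, lie in G;
    -- only the leading power survives modulo G.
    root-power-∈ : ∀ {y} ys → y ∈ₗ ys → (∀ k → G (σ ys (suc k))) → G (y ^ length ys)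
    root-power-∈ {y} ys y∈ p = resp
      (trans (-‿cong (+-congʳ (horner-σ-root ys y∈))) (solve 1 (λ a → :- (:0 :- a :* :1) := a) refl _))
      (-∈ (horner-∈ (σ ys) y (length ys) p))

    σ-∈ : ∀ ys → All G ys → ∀ k → G (σ ys (suc k))
    σ-∈ [] [] k = 0∈
    σ-∈ (y ∷ ys) (p ∷ ps) k = +∈ (σ-∈ ys ps k) (-∈ (*∈ʳ _ p))

    -- Up to sign σ is the sum of the products over the k-element selections. The factor `b`
    -- collects the entries chosen so far, so that the induction can remove the head of the list.
    σ-∈-selections : ∀ ys k b → (∀ S → ∣ S ∣ ≡ k → G (b * select ys S)) → G (b * σ ys k)
    σ-∈-selections ys zero b p = resp (*-congˡ (select-∅ ys)) (p ∅ (Subsetₚ.∣⊥∣≡0 (length ys)))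
    σ-∈-selections [] (suc k) b p = *∈ b 0∈
    σ-∈-selections (y ∷ ys) (suc k) b p = resp
      (solve 4 (λ b u y v → b :* u :- b :* y :* v := b :* (u :- y :* v)) refl b _ y _)
      (+∈ (σ-∈-selections ys (suc k) b (λ S e → p (false ∷ S) e))
          (-∈ (σ-∈-selections ys k (b * y) (λ S e → resp (sym (*-assoc b y _)) (p (true ∷ S) (≡.cong suc e))))))

  module _ {G : Carrier → Set (c ⊔ ℓ)} (I : IsIdeal G) (T : KoszulProperties.Truncation R I) where
    private
      module Q = CommutativeRing (R / I)
      module QS = RingSolver (R / I)
    open KoszulProperties.Truncation T
    open KoszulProperties R
    open Graded I T

    homogeneous-1 : Homogeneous 0 1#
    homogeneous-1 e a = Q.trans (τ-cong e (Q.*-identityˡ a)) (Q.sym (Q.*-identityˡ _))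

    homogeneous-0 : ∀ k → Homogeneous k 0#
    homogeneous-0 k e a = Q.trans (τ-cong e (Q.zeroˡ a)) (Q.trans (τ-0# e) (Q.sym (Q.zeroˡ _)))

    homogeneous-* : ∀ {j k x y} → Homogeneous j x → Homogeneous k y → Homogeneous (j ℕ.+ k) (x * y)
    homogeneous-* {j} {k} {x} {y} hx hy e a =
      Q.trans (τ-cong e (Q.*-assoc x y a)) (Q.trans (hx e (y * a)) (Q.trans (Q.*-congˡ (hy (e ℕ.∸ j) a))
        (Q.trans (Q.sym (Q.*-assoc x y _)) (Q.reflexive (≡.cong (λ i → x * y * τ i a) (ℕₚ.∸-+-assoc e j k))))))

    homogeneous-sub : ∀ {k x y} → Homogeneous k x → Homogeneous k y → Homogeneous k (x - y)
    homogeneous-sub {k} {x} {y} hx hy e a =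
      Q.trans (τ-cong e (QS.solve 3 (λ x y a → (x QS.:- y) QS.:* a QS.:= x QS.:* a QS.:+ QS.:- (y QS.:* a)) Q.refl x y a))
        (Q.trans (τ-+ e _ _) (Q.trans (Q.+-cong (hx e a) (Q.trans (τ-neg e _) (Q.-‿cong (hy e a))))
          (QS.solve 3 (λ x y b → x QS.:* b QS.:+ QS.:- (y QS.:* b) QS.:= (x QS.:- y) QS.:* b) Q.refl x y _)))

    homogeneous-resp : ∀ {k x y} → x Q.≈ y → Homogeneous k x → Homogeneous k y
    homogeneous-resp e hx d a = Q.trans (τ-cong d (Q.*-congʳ (Q.sym e))) (Q.trans (hx d a) (Q.*-congʳ e))

    σ-homogeneous : ∀ ys → All (Homogeneous 1) ys → ∀ k → Homogeneous k (σ ys k)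
    σ-homogeneous ys hs zero = homogeneous-1
    σ-homogeneous [] [] (suc k) = homogeneous-0 (suc k)
    σ-homogeneous (y ∷ ys) (h ∷ hs) (suc k) =
      homogeneous-sub {suc k} (σ-homogeneous ys hs (suc k)) (homogeneous-* {1} {k} h (σ-homogeneous ys hs k))

module KoszulSymmetric {c ℓ} (R : CommutativeRing c ℓ) {G : CommutativeRing.Carrier R → Set (c ⊔ ℓ)} (I : Ideals.IsIdeal R G) where
  open CommutativeRing R using (Carrier)
  open Koszul R
  open KoszulProperties R
  open Symmetric R
  open Cycles I using (Exact)

  comb-applyDownFrom : ∀ (θ : ℕ → Carrier) D → (∀ k → D ℕ.≤ k → G (θ k)) →
    ∀ k → Comb G (L.applyDownFrom θ D) (θ k)
  comb-applyDownFrom θ D vanish k with k ℕ.<? D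
  ... | yes lt = comb-gen I (Anyₚ.applyDownFrom⁺ θ ≡.refl lt)
  ... | no nlt = comb-base I (L.applyDownFrom θ D) (vanish k (ℕₚ.≮⇒≥ nlt))

  exact-drop-roots : ∀ {k} zs ds → (∀ j → Comb G ds (σ zs (suc j))) →
    Exact (length zs ℕ.+ k) (zs ++ ds) → Exact k ds
  exact-drop-roots zs ds σ∈ = exact-drop I zs ds
    (All.tabulate (λ z∈ → length zs , root-power-∈ (comb-ideal I ds) zs z∈ σ∈))

module _ {c ℓ} {R S : CommutativeRing c ℓ} {φ} (hom : IsHom R S φ) where
  open CommutativeRing S
  open IsHom hom
  private
    module RS = Symmetric R
    module SS = Symmetric S

  σ-hom : ∀ {N} {f : Fin N → CommutativeRing.Carrier R} {g : Fin N → Carrier} → (∀ q → φ (f q) ≈ g q) →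
    ∀ k → φ (RS.σ (L.tabulate f) k) ≈ SS.σ (L.tabulate g) k
  σ-hom {zero} e zero = φ-1
  σ-hom {suc N} e zero = φ-1
  σ-hom {zero} e (suc k) = φ-0
  σ-hom {suc N} e (suc k) = trans (φ-sub _ _)
    (+-cong (σ-hom (λ q → e (Fin.suc q)) (suc k))
      (-‿cong (trans (φ-* _ _) (*-cong (e Fin.zero) (σ-hom (λ q → e (Fin.suc q)) k)))))

-- Polynomial rings and monomial ideals

·ₘ-comm : ∀ {m} (u v : Mon m) → u ·ₘ v ≡ v ·ₘ u
·ₘ-comm = Vₚ.zipWith-comm ℕₚ.+-comm

·ₘ-assoc : ∀ {m} (u v w : Mon m) → (u ·ₘ v) ·ₘ w ≡ u ·ₘ (v ·ₘ w)
·ₘ-assoc = Vₚ.zipWith-assoc ℕₚ.+-assoc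

·ₘ-identityˡ : ∀ {m} (u : Mon m) → oneₘ ·ₘ u ≡ u
·ₘ-identityˡ = Vₚ.zipWith-identityˡ ℕₚ.+-identityˡ

·ₘ-identityʳ : ∀ {m} (u : Mon m) → u ·ₘ oneₘ ≡ u
·ₘ-identityʳ = Vₚ.zipWith-identityʳ ℕₚ.+-identityʳ

·ₘ-cancelˡ : ∀ {m} (u {v w} : Mon m) → u ·ₘ v ≡ u ·ₘ w → v ≡ w
·ₘ-cancelˡ [] {[]} {[]} e = ≡.refl
·ₘ-cancelˡ (a ∷ u) {b ∷ v} {c ∷ w} e =
  ≡.cong₂ _∷_ (ℕₚ.+-cancelˡ-≡ a b c (Vₚ.∷-injectiveˡ e)) (·ₘ-cancelˡ u (Vₚ.∷-injectiveʳ e))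

module Polynomials {c ℓ} (F : Field c ℓ) where
  private
    module F = Field F
    open module F′ = PolyRing F hiding (_≃_)

  scalars : CommutativeRing c ℓ
  scalars = F.commutativeRing

  id-hom : IsHom scalars scalars (λ a → a)
  id-hom = id-isHom scalars

  module Linear (m : ℕ) where
    open PolyRing F m using (_≃_)

    without : Mon m → Poly m → Poly m
    without v [] = []
    without v ((a , u) ∷ p) with Vₚ.≡-dec ℕ._≟_ u v
    ... | yes _ = without v p
    ... | no _ = (a , u) ∷ without v p

    coeff-without-≡ : ∀ v p → coeff m (without v p) v F.≈ F.0#
    coeff-without-≡ v [] = F.refl
    coeff-without-≡ v ((a , u) ∷ p) with Vₚ.≡-dec ℕ._≟_ u v
    ... | yes _ = coeff-without-≡ v p
    ... | no u≢v with Vₚ.≡-dec ℕ._≟_ u v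
    ...   | yes u≡v = contradiction u≡v u≢v
    ...   | no _ = coeff-without-≡ v p

    coeff-without-≢ : ∀ v p {w} → v ≢ w → coeff m (without v p) w F.≈ coeff m p w
    coeff-without-≢ v [] v≢w = F.refl
    coeff-without-≢ v ((a , u) ∷ p) {w} v≢w with Vₚ.≡-dec ℕ._≟_ u v
    coeff-without-≢ v ((a , u) ∷ p) {w} v≢w | yes ≡.refl with Vₚ.≡-dec ℕ._≟_ u w
    ... | yes u≡w = contradiction u≡w v≢w
    ... | no _ = coeff-without-≢ v p v≢w
    coeff-without-≢ v ((a , u) ∷ p) {w} v≢w | no _ with Vₚ.≡-dec ℕ._≟_ u w
    ... | yes _ = F.+-congˡ (coeff-without-≢ v p v≢w)
    ... | no _ = coeff-without-≢ v p v≢w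

    length-without : ∀ v p → length (without v p) ℕ.≤ length p
    length-without v [] = z≤n
    length-without v ((a , u) ∷ p) with Vₚ.≡-dec ℕ._≟_ u v
    ... | yes _ = ℕₚ.m≤n⇒m≤1+n (length-without v p)
    ... | no _ = s≤s (length-without v p)

    negate : Poly m → Poly m
    negate = L.map (λ (a , v) → F.- a , v)

    module Eval (A : CommutativeRing c ℓ) {ι} (ι-hom : IsHom scalars A ι) where
      open CommutativeRing A
      open IsHom ι-hom
      open RingSolver A
      open Relation.Binary.Reasoning.Setoid setoid

      -- The linear extension of h from monomials to polynomials. For A = K these are the
      -- functionals that decide `≃`; for multiplicative h they are the ring homomorphisms used
      -- later.
      ev : (Mon m → Carrier) → Poly m → Carrier
      ev h [] = 0#
      ev h ((a , v) ∷ p) = ι a * h v + ev h p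

      ev-ext : ∀ {h h′} → (∀ v → h v ≈ h′ v) → ∀ p → ev h p ≈ ev h′ p
      ev-ext e [] = refl
      ev-ext e ((a , v) ∷ p) = +-cong (*-congˡ (e v)) (ev-ext e p)

      ev-++ : ∀ h p q → ev h (p ++ q) ≈ ev h p + ev h q
      ev-++ h [] q = sym (+-identityˡ _)
      ev-++ h ((a , v) ∷ p) q = trans (+-congˡ (ev-++ h p q)) (sym (+-assoc _ _ _))

      ev-negate : ∀ h p → ev h (negate p) ≈ - ev h p
      ev-negate h [] = solve 0 (:0 := :- :0) refl
      ev-negate h ((a , v) ∷ p) = trans (+-cong (*-congʳ (φ-neg a)) (ev-negate h p))
        (solve 3 (λ a v e → :- a :* v :+ :- e := :- (a :* v :+ e)) refl (ι a) _ _)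

      ev-zero : ∀ {h} → (∀ v → h v ≈ 0#) → ∀ p → ev h p ≈ 0#
      ev-zero e [] = refl
      ev-zero e ((a , v) ∷ p) = trans (+-cong (*-congˡ (e v)) (ev-zero e p)) (solve 1 (λ a → a :* :0 :+ :0 := :0) refl (ι a))

      ev-scale : ∀ h r p → ev (λ v → r * h v) p ≈ r * ev h p
      ev-scale h r [] = sym (zeroʳ r)
      ev-scale h r ((a , v) ∷ p) = trans (+-congˡ (ev-scale h r p))
        (solve 4 (λ a r v e → a :* (r :* v) :+ r :* e := r :* (a :* v :+ e)) refl (ι a) r _ _)

      ev-add : ∀ h h′ p → ev (λ v → h v + h′ v) p ≈ ev h p + ev h′ p
      ev-add h h′ [] = sym (+-identityˡ 0#)
      ev-add h h′ ((a , v) ∷ p) = trans (+-congˡ (ev-add h h′ p))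
        (solve 5 (λ a v w e d → a :* (v :+ w) :+ (e :+ d) := (a :* v :+ e) :+ (a :* w :+ d)) refl (ι a) _ _ _ _)

      ev-swap : ∀ (H : Mon m → Mon m → Carrier) p q →
        ev (λ u → ev (H u) q) p ≈ ev (λ v → ev (λ u → H u v) p) q
      ev-swap H [] q = sym (ev-zero (λ _ → refl) q)
      ev-swap H ((a , u) ∷ p) q = begin
        ι a * ev (H u) q + ev (λ u → ev (H u) q) p
          ≈⟨ +-cong (sym (ev-scale (H u) (ι a) q)) (ev-swap H p q) ⟩
        ev (λ v → ι a * H u v) q + ev (λ v → ev (λ u → H u v) p) q
          ≈⟨ ev-add _ _ q ⟨
        ev (λ v → ι a * H u v + ev (λ u → H u v) p) q ∎

      ev-without : ∀ h v p → ev h p ≈ ι (coeff m p v) * h v + ev h (without v p)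
      ev-without h v [] = sym (trans (+-identityʳ _) (trans (*-congʳ φ-0) (zeroˡ _)))
      ev-without h v ((a , u) ∷ p) with Vₚ.≡-dec ℕ._≟_ u v
      ... | yes ≡.refl = trans (+-congˡ (ev-without h v p)) (trans
              (solve 4 (λ a x b e → a :* x :+ (b :* x :+ e) := (a :+ b) :* x :+ e) refl (ι a) (h v) _ _)
              (+-congʳ (*-congʳ (sym (φ-+ a _)))))
      ... | no _ = trans (+-congˡ (ev-without h v p))
              (solve 3 (λ a b e → a :+ (b :+ e) := b :+ (a :+ e)) refl _ _ _)

      -- All terms with the first monomial are removed at once: together they contribute its
      -- coefficient, which is zero, whether or not the single terms are. What remains is no subterm
      -- of p, so the induction is on a bound n for the length.
      ev-≃0 : ∀ h n p → length p ℕ.≤ n → (∀ w → coeff m p w F.≈ F.0#) → ev h p ≈ 0#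
      ev-≃0 h n [] le e = refl
      ev-≃0 h (suc n) p@((a , v) ∷ p′) (s≤s le) e = begin
        ev h p                                            ≈⟨ ev-without h v p ⟩
        ι (coeff m p v) * h v + ev h (without v p)        ≈⟨ +-cong (*-congʳ (trans (φ-cong (e v)) φ-0)) rest ⟩
        0# * h v + 0#                                     ≈⟨ solve 1 (λ x → :0 :* x :+ :0 := :0) refl (h v) ⟩
        0# ∎
        where
        shorter : length (without v p) ℕ.≤ n
        shorter with Vₚ.≡-dec ℕ._≟_ v v
        ... | yes _ = ℕₚ.≤-trans (length-without v p′) le
        ... | no v≢v = contradiction ≡.refl v≢v
        vanishing : ∀ w → coeff m (without v p) w F.≈ F.0#
        vanishing w with Vₚ.≡-dec ℕ._≟_ v w
        ... | yes ≡.refl = coeff-without-≡ v p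
        ... | no v≢w = F.trans (coeff-without-≢ v p v≢w) (e w)
        rest : ev h (without v p) ≈ 0#
        rest = ev-≃0 h n (without v p) shorter vanishing

      ev-shift : ∀ h a u (f : F.Carrier × Mon m → F.Carrier × Mon m) →
        (∀ b v → f (b , v) ≡ (a F.* b , u ·ₘ v)) → ∀ q r →
        ev h (L.map f q ++ r) ≈ ι a * ev (λ v → h (u ·ₘ v)) q + ev h r
      ev-shift h a u f e [] r = solve 2 (λ a r → r := a :* :0 :+ r) refl (ι a) _
      ev-shift h a u f e ((b , v) ∷ q) r = begin
        ev h (f (b , v) ∷ L.map f q ++ r)
          ≡⟨ ≡.cong (λ x → ev h (x ∷ L.map f q ++ r)) (e b v) ⟩
        ι (a F.* b) * h (u ·ₘ v) + ev h (L.map f q ++ r)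
          ≈⟨ +-cong (*-congʳ (φ-* a b)) (ev-shift h a u f e q r) ⟩
        (ι a * ι b) * h (u ·ₘ v) + (ι a * ev (λ v → h (u ·ₘ v)) q + ev h r)
          ≈⟨ solve 5 (λ a b x e r → a :* b :* x :+ (a :* e :+ r) := a :* (b :* x :+ e) :+ r) refl (ι a) (ι b) _ _ _ ⟩
        ι a * (ι b * h (u ·ₘ v) + ev (λ v → h (u ·ₘ v)) q) + ev h r ∎

      ev-* : ∀ h p q → ev h (_*ₚ_ m p q) ≈ ev (λ u → ev (λ v → h (u ·ₘ v)) q) p
      ev-* h [] q = refl
      ev-* h ((a , u) ∷ p) q = trans (ev-shift h a u _ (λ _ _ → ≡.refl) q (_*ₚ_ m p q))
        (+-congˡ (ev-* h p q))

    open Eval scalars id-hom using () renaming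
      (ev to evK; ev-ext to evK-ext; ev-++ to evK-++; ev-negate to evK-negate; ev-* to evK-*;
       ev-≃0 to evK-≃0; ev-zero to evK-zero; ev-swap to evK-swap; ev-scale to evK-scale) public

    indicator : Mon m → Mon m → F.Carrier
    indicator w v with Vₚ.≡-dec ℕ._≟_ v w
    ... | yes _ = F.1#
    ... | no _ = F.0#

    coeff-evK : ∀ p w → coeff m p w F.≈ evK (indicator w) p
    coeff-evK [] w = F.refl
    coeff-evK ((a , v) ∷ p) w with Vₚ.≡-dec ℕ._≟_ v w
    ... | yes _ = F.+-cong (F.sym (F.*-identityʳ a)) (coeff-evK p w)
    ... | no _ = F.trans (coeff-evK p w) (F.sym (F.trans (F.+-congʳ (F.zeroʳ a)) (F.+-identityˡ _)))

    coeff-monomial : ∀ w → coeff m (monomial m w) w F.≈ F.1#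
    coeff-monomial w with Vₚ.≡-dec ℕ._≟_ w w
    ... | yes _ = F.+-identityʳ F.1#
    ... | no w≢w = contradiction ≡.refl w≢w

    -- Coefficients are functionals themselves. The ring laws below thus reduce to the field laws
    -- and never require collecting like terms.
    ≃-by-evK : ∀ {p q} → (∀ h → evK h p F.≈ evK h q) → p ≃ q
    ≃-by-evK {p} {q} e w = F.trans (coeff-evK p w) (F.trans (e (indicator w)) (F.sym (coeff-evK q w)))

    coeff-negated-difference : ∀ {p q} → p ≃ q → ∀ w → coeff m (p ++ negate q) w F.≈ F.0#
    coeff-negated-difference {p} {q} e w = begin
      coeff m (p ++ negate q) w                              ≈⟨ coeff-evK (p ++ negate q) w ⟩
      evK (indicator w) (p ++ negate q)                      ≈⟨ evK-++ _ p (negate q) ⟩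
      evK (indicator w) p F.+ evK (indicator w) (negate q)   ≈⟨ F.+-cong (F.sym (coeff-evK p w)) (evK-negate _ q) ⟩
      coeff m p w F.+ F.- evK (indicator w) q                ≈⟨ F.+-cong (e w) (F.-‿cong (F.sym (coeff-evK q w))) ⟩
      coeff m q w F.+ F.- coeff m q w                        ≈⟨ F.-‿inverseʳ _ ⟩
      F.0# ∎
      where open Relation.Binary.Reasoning.Setoid F.setoid

    module EvalCong (A : CommutativeRing c ℓ) {ι} (ι-hom : IsHom scalars A ι) where
      open CommutativeRing A
      open Eval A ι-hom
      open RingSolver A
      open Relation.Binary.Reasoning.Setoid setoid

      ev-cong : ∀ h {p q} → p ≃ q → ev h p ≈ ev h q
      ev-cong h {p} {q} e = begin
        ev h p                                ≈⟨ solve 2 (λ a b → a := (a :+ :- b) :+ b) refl _ (ev h q) ⟩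
        (ev h p + - ev h q) + ev h q          ≈⟨ +-congʳ (+-congˡ (ev-negate h q)) ⟨
        (ev h p + ev h (negate q)) + ev h q   ≈⟨ +-congʳ (ev-++ h p (negate q)) ⟨
        ev h (p ++ negate q) + ev h q         ≈⟨ +-congʳ (ev-≃0 h _ (p ++ negate q) ℕₚ.≤-refl (coeff-negated-difference {p} {q} e)) ⟩
        0# + ev h q                           ≈⟨ +-identityˡ _ ⟩
        ev h q ∎

    open EvalCong scalars id-hom using () renaming (ev-cong to evK-cong) public

  polyRing : ℕ → CommutativeRing c ℓ
  polyRing m = record
    { Carrier = Poly m ; _≈_ = _≃_ ; _+_ = _+ₚ_ m ; _*_ = _*ₚ_ m ; -_ = negate
    ; 0# = zeroₚ m ; 1# = oneₚ m
    ; isCommutativeRing = record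
      { isRing = record
        { +-isAbelianGroup = record
          { isGroup = record
            { isMonoid = record
              { isSemigroup = record
                { isMagma = record
                  { isEquivalence = record
                    { refl = λ w → F.refl
                    ; sym = λ e w → F.sym (e w)
                    ; trans = λ e d w → F.trans (e w) (d w)
                    }
                  ; ∙-cong = λ {p} {q} {p′} {q′} e d → ≃-by-evK {p ++ p′} {q ++ q′} λ h →
                      F.trans (evK-++ h p p′) (F.trans (F.+-cong (evK-cong h {p} {q} e) (evK-cong h {p′} {q′} d))
                        (F.sym (evK-++ h q q′)))
                  }
                ; assoc = λ p q r → ≃-by-evK {(p ++ q) ++ r} {p ++ (q ++ r)} λ h →
                    F.trans (evK-++ h (p ++ q) r) (F.trans (F.+-congʳ (evK-++ h p q)) (F.trans (F.+-assoc _ _ _)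
                      (F.sym (F.trans (evK-++ h p (q ++ r)) (F.+-congˡ (evK-++ h q r))))))
                }
              ; identity = (λ p w → F.refl) , +-identityʳ
              }
            ; inverse = (λ p → ≃-by-evK {negate p ++ p} {[]} λ h →
                          F.trans (evK-++ h (negate p) p) (F.trans (F.+-congʳ (evK-negate h p)) (F.-‿inverseˡ _)))
                      , (λ p → ≃-by-evK {p ++ negate p} {[]} λ h →
                          F.trans (evK-++ h p (negate p)) (F.trans (F.+-congˡ (evK-negate h p)) (F.-‿inverseʳ _)))
            ; ⁻¹-cong = λ {p} {q} e → ≃-by-evK {negate p} {negate q} λ h →
                F.trans (evK-negate h p) (F.trans (F.-‿cong (evK-cong h {p} {q} e)) (F.sym (evK-negate h q)))
            }
          ; comm = λ p q → ≃-by-evK {p ++ q} {q ++ p} λ h →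
              F.trans (evK-++ h p q) (F.trans (F.+-comm _ _) (F.sym (evK-++ h q p)))
          }
        ; *-cong = λ {p} {q} {p′} {q′} e d → ≃-by-evK {_*ₚ_ m p p′} {_*ₚ_ m q q′} λ h →
            F.trans (evK-* h p p′) (F.trans (evK-cong _ {p} {q} e)
              (F.trans (evK-ext (λ u → evK-cong _ {p′} {q′} d) q) (F.sym (evK-* h q q′))))
        ; *-assoc = λ p q r → ≃-by-evK {_*ₚ_ m (_*ₚ_ m p q) r} {_*ₚ_ m p (_*ₚ_ m q r)} λ h →
            F.trans (evK-* h (_*ₚ_ m p q) r) (F.trans (evK-* _ p q)
              (F.trans (evK-ext (λ u → F.trans
                  (evK-ext (λ v → evK-ext (λ w → F.reflexive (≡.cong h (·ₘ-assoc u v w))) r) q)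
                  (F.sym (evK-* _ q r))) p)
                (F.sym (evK-* h p (_*ₚ_ m q r)))))
        ; *-identity = *-identityˡ , (λ p w → F.trans (*-comm p (oneₚ m) w) (*-identityˡ p w))
        ; distrib = (λ p q r w → F.trans (*-comm p (q ++ r) w) (F.trans (distribʳ p q r w) (+-cong′ {_*ₚ_ m q p} {_*ₚ_ m p q} {_*ₚ_ m r p} {_*ₚ_ m p r} (*-comm q p) (*-comm r p) w)))
                  , distribʳ
        }
      ; *-comm = *-comm
      }
    }
    where
    open PolyRing F m using (_≃_)
    open Linear m
    +-identityʳ : ∀ p → (p ++ []) ≃ p
    +-identityʳ p = ≃-by-evK {p ++ []} {p} λ h → F.trans (evK-++ h p []) (F.+-identityʳ _)
    *-comm : ∀ p q → _*ₚ_ m p q ≃ _*ₚ_ m q p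
    *-comm p q = ≃-by-evK {_*ₚ_ m p q} {_*ₚ_ m q p} λ h →
      F.trans (evK-* h p q) (F.trans (evK-swap (λ u v → h (u ·ₘ v)) p q)
        (F.trans (evK-ext (λ v → evK-ext (λ u → F.reflexive (≡.cong h (·ₘ-comm u v))) p) q) (F.sym (evK-* h q p))))
    *-identityˡ : ∀ p → _*ₚ_ m (oneₚ m) p ≃ p
    *-identityˡ p = ≃-by-evK {_*ₚ_ m (oneₚ m) p} {p} λ h →
      F.trans (evK-* h (oneₚ m) p) (F.trans (F.+-identityʳ _) (F.trans (F.*-identityˡ _)
        (evK-ext (λ v → F.reflexive (≡.cong h (·ₘ-identityˡ v))) p)))
    +-cong′ : ∀ {p q p′ q′} → p ≃ q → p′ ≃ q′ → (p ++ p′) ≃ (q ++ q′)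
    +-cong′ {p} {q} {p′} {q′} e d = ≃-by-evK {p ++ p′} {q ++ q′} λ h →
      F.trans (evK-++ h p p′) (F.trans (F.+-cong (evK-cong h {p} {q} e) (evK-cong h {p′} {q′} d))
        (F.sym (evK-++ h q q′)))
    distribʳ : ∀ r p q → _*ₚ_ m (p ++ q) r ≃ (_*ₚ_ m p r ++ _*ₚ_ m q r)
    distribʳ r p q = ≃-by-evK {_*ₚ_ m (p ++ q) r} {_*ₚ_ m p r ++ _*ₚ_ m q r} λ h →
      F.trans (evK-* h (p ++ q) r) (F.trans (evK-++ _ p q)
        (F.sym (F.trans (evK-++ h (_*ₚ_ m p r) (_*ₚ_ m q r)) (F.+-cong (evK-* h p r) (evK-* h q r)))))

  const : ∀ {m} → F.Carrier → Poly m
  const a = (a , oneₘ) ∷ []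

  const-hom : ∀ m → IsHom scalars (polyRing m) const
  const-hom m = record
    { φ-cong = λ {a} {b} e → ≃-by-evK {const a} {const b} λ h → F.+-congʳ (F.*-congʳ e)
    ; φ-+ = λ a b → ≃-by-evK {const (a F.+ b)} {const a ++ const b} λ h →
        solve 3 (λ a b x → (a :+ b) :* x :+ :0 := a :* x :+ (b :* x :+ :0)) F.refl a b _
    ; φ-* = λ a b → ≃-by-evK {const (a F.* b)} {_*ₚ_ m (const a) (const b)} λ h →
        F.+-congʳ (F.*-congˡ (F.reflexive (≡.cong h (≡.sym (·ₘ-identityˡ oneₘ)))))
    ; φ-1 = λ w → F.refl
    }
    where
    open Linear m
    open RingSolver scalars

  module _ (m : ℕ) (A : CommutativeRing c ℓ) {ι} (ι-hom : IsHom scalars A ι) where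
    open CommutativeRing A
    open Linear m
    open Eval A ι-hom
    open EvalCong A ι-hom
    open RingSolver A

    ev-hom : ∀ h → h oneₘ ≈ 1# → (∀ u v → h (u ·ₘ v) ≈ h u * h v) → IsHom (polyRing m) A (ev h)
    ev-hom h h1 h· = record
      { φ-cong = λ {p} {q} → ev-cong h {p} {q}
      ; φ-+ = ev-++ h
      ; φ-* = λ p q → trans (ev-* h p q) (trans (ev-ext (λ u → trans (ev-ext (λ v → h· u v) q) (ev-scale h (h u) q)) p)
          (trans (ev-ext (λ u → *-comm (h u) _) p) (trans (ev-scale h (ev h q) p) (*-comm _ _))))
      ; φ-1 = trans (+-identityʳ _) (trans (*-cong (IsHom.φ-1 ι-hom) h1) (*-identityˡ 1#))
      }

    ev-monomial : ∀ h v → ev h (monomial m v) ≈ h v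
    ev-monomial h v = trans (+-identityʳ _) (trans (*-congʳ (IsHom.φ-1 ι-hom)) (*-identityˡ _))

  module MonomialIdeals (m : ℕ) where
    open PolyRing F m using (_≃_)
    open Linear m
    open CommutativeRing (polyRing m) using () renaming
      (_+_ to _+′_; _*_ to _*′_; _-_ to _-′_; -_ to -′_; 0# to 0′; 1# to 1′; refl to ≃-refl; sym to ≃-sym; trans to ≃-trans)
    private module P = CommutativeRing (polyRing m)
    open Ideals (polyRing m) public

    monomial-· : ∀ u v → monomial m (u ·ₘ v) ≃ (monomial m u *′ monomial m v)
    monomial-· u v = ≃-by-evK {monomial m (u ·ₘ v)} {monomial m u *′ monomial m v} λ h →
      F.+-congʳ (F.*-congʳ (F.sym (F.*-identityˡ _)))

    term : ∀ a v → ((a , v) ∷ []) ≃ (const a *′ monomial m v)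
    term a v = ≃-by-evK {(a , v) ∷ []} {const a *′ monomial m v} λ h →
      F.+-congʳ (F.*-cong (F.sym (F.*-identityʳ a)) (F.reflexive (≡.cong h (≡.sym (·ₘ-identityˡ v)))))

    -- The span of the monomials in M.
    MI : (Mon m → Set) → Poly m → Set (c ⊔ ℓ)
    MI M f = ∀ w → ¬ M w → Lift c (coeff m f w F.≈ F.0#)

    All-MI : ∀ {M : Mon m → Set} {p : Poly m} → All (λ t → M (proj₂ t)) p → MI M p
    All-MI [] w ¬Mw = lift F.refl
    All-MI {p = (a , v) ∷ p} (Mv ∷ ps) w ¬Mw with Vₚ.≡-dec ℕ._≟_ v w
    ... | yes ≡.refl = contradiction Mv ¬Mw
    ... | no _ = All-MI ps w ¬Mw

    MI-monomial : ∀ {M : Mon m → Set} {w} → M w → MI M (monomial m w)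
    MI-monomial Mw = All-MI (Mw ∷ [])

    module _ {M : Mon m → Set} (M? : Decidable M) where
      keep : Poly m → Poly m
      keep [] = []
      keep ((a , v) ∷ p) with M? v
      ... | yes _ = (a , v) ∷ keep p
      ... | no _ = keep p

      keep-All : ∀ p → All (λ t → M (proj₂ t)) (keep p)
      keep-All [] = []
      keep-All ((a , v) ∷ p) with M? v
      ... | yes Mv = Mv ∷ keep-All p
      ... | no _ = keep-All p

      coeff-keep : ∀ p {w} → M w → coeff m (keep p) w F.≈ coeff m p w
      coeff-keep [] Mw = F.refl
      coeff-keep ((a , v) ∷ p) {w} Mw with M? v
      coeff-keep ((a , v) ∷ p) {w} Mw | yes _ with Vₚ.≡-dec ℕ._≟_ v w
      ... | yes _ = F.+-congˡ (coeff-keep p Mw)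
      ... | no _ = coeff-keep p Mw
      coeff-keep ((a , v) ∷ p) {w} Mw | no ¬Mv with Vₚ.≡-dec ℕ._≟_ v w
      ... | yes ≡.refl = contradiction Mw ¬Mv
      ... | no _ = coeff-keep p Mw

      MI⇒≃keep : ∀ {f} → MI M f → f ≃ keep f
      MI⇒≃keep {f} p w with M? w
      ... | yes Mw = F.sym (coeff-keep f Mw)
      ... | no ¬Mw = F.trans (lower (p w ¬Mw)) (F.sym (lower (All-MI (keep-All f) w ¬Mw)))

      MI-resp : ∀ {f g} → f ≃ g → MI M f → MI M g
      MI-resp e p w ¬Mw = lift (F.trans (F.sym (e w)) (lower (p w ¬Mw)))

      All-* : (∀ u {v} → M v → M (u ·ₘ v)) → ∀ (r : Poly m) {p : Poly m} → All (λ t → M (proj₂ t)) p →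
        All (λ t → M (proj₂ t)) (r *′ p)
      All-* up [] ps = []
      All-* up ((a , u) ∷ r) ps = Allₚ.++⁺ (Allₚ.map⁺ (All.map (λ {(b , v)} Mv → up u Mv) ps)) (All-* up r ps)

      MI-ideal : (∀ u {v} → M v → M (u ·ₘ v)) → IsIdeal (MI M)
      MI-ideal up = record
        { resp = λ {f} {g} → MI-resp {f} {g}
        ; 0∈ = λ w _ → lift F.refl
        ; +∈ = λ {f} {g} p q → MI-resp {keep f ++ keep g} {f ++ g}
            (P.+-cong {keep f} {f} {keep g} {g} (≃-sym {f} {keep f} (MI⇒≃keep {f} p)) (≃-sym {g} {keep g} (MI⇒≃keep {g} q)))
            (All-MI (Allₚ.++⁺ (keep-All f) (keep-All g)))
        ; *∈ = λ r {f} p → MI-resp {r *′ keep f} {r *′ f}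
            (P.*-congˡ {r} {keep f} {f} (≃-sym {f} {keep f} (MI⇒≃keep {f} p)))
            (All-MI (All-* up r (keep-All f)))
        }

      MI-elim : ∀ {H} → IsIdeal H → (∀ w → M w → H (monomial m w)) → MI M ⊆ᵢ H
      MI-elim {H} J gens {f} p = resp (≃-sym {f} {keep f} (MI⇒≃keep {f} p)) (sum (keep f) (keep-All f))
        where
        open IsIdeal J
        sum : ∀ p → All (λ t → M (proj₂ t)) p → H p
        sum [] [] = 0∈
        sum ((a , v) ∷ p) (Mv ∷ ps) = +∈ {(a , v) ∷ []} {p}
          (resp (≃-sym {(a , v) ∷ []} {const a *′ monomial m v} (term a v)) (*∈ (const a) (gens v Mv))) (sum p ps)

    Zero : Poly m → Set (c ⊔ ℓ)
    Zero f = Lift c (f ≃ [])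

    zero-ideal : IsIdeal Zero
    zero-ideal = record
      { resp = λ {f} {g} e (lift z) → lift (≃-trans {g} {f} {[]} (≃-sym {f} {g} e) z)
      ; 0∈ = lift (≃-refl {[]})
      ; +∈ = λ {f} {g} (lift z) (lift y) → lift (P.+-cong {f} {[]} {g} {[]} z y)
      ; *∈ = λ r {f} (lift z) → lift (≃-trans {r *′ f} {r *′ []} {[]} (P.*-congˡ {r} {f} {[]} z) (P.zeroʳ r))
      }

    -- Trades the list of multipliers and its length proof for the nested form of `Comb`, along
    -- which the Koszul maps recurse.
    ∈⟨⟩⇒comb : ∀ gs {f} → _∈⟨_⟩ m f gs → Comb Zero gs f
    ∈⟨⟩⇒comb [] ([] , _ , e) = lift e
    ∈⟨⟩⇒comb (g ∷ gs) {f} (h ∷ hs , len , e) = h , ∈⟨⟩⇒comb gs (hs , ℕₚ.suc-injective len ,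
      ≃-trans {f -′ (h *′ g)} {(h *′ g +′ r) -′ (h *′ g)} {r} (P.+-congʳ { -′ (h *′ g)} {f} {h *′ g +′ r} e)
        (x+r-x≈r (h *′ g) r))
      where r = combine m hs gs

    comb⇒∈⟨⟩ : ∀ gs {f} → Comb Zero gs f → _∈⟨_⟩ m f gs
    comb⇒∈⟨⟩ [] (lift e) = [] , ≡.refl , e
    comb⇒∈⟨⟩ (g ∷ gs) {f} (h , p) with comb⇒∈⟨⟩ gs p
    ... | hs , len , e = h ∷ hs , ≡.cong suc len ,
      ≃-trans {f} {h *′ g +′ (f -′ (h *′ g))} {h *′ g +′ combine m hs gs}
        (f≈x+[f-x] (h *′ g) f)
        (P.+-congˡ {h *′ g} {f -′ (h *′ g)} {combine m hs gs} e)

    ⟨_⟩ : List (Poly m) → Poly m → Set (c ⊔ ℓ)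
    ⟨ gs ⟩ f = _∈⟨_⟩ m f gs

    ⟨⟩-ideal : ∀ gs → IsIdeal ⟨ gs ⟩
    ⟨⟩-ideal gs = record
      { resp = λ {f} {g} e p → comb⇒∈⟨⟩ gs (resp {f} {g} e (∈⟨⟩⇒comb gs p))
      ; 0∈ = comb⇒∈⟨⟩ gs 0∈
      ; +∈ = λ {f} {g} p q → comb⇒∈⟨⟩ gs (+∈ {f} {g} (∈⟨⟩⇒comb gs p) (∈⟨⟩⇒comb gs q))
      ; *∈ = λ r {f} p → comb⇒∈⟨⟩ gs (*∈ r {f} (∈⟨⟩⇒comb gs p))
      }
      where open IsIdeal (comb-ideal zero-ideal gs)

    ⟨⟩-gen : ∀ {gs g} → g ∈ₗ gs → ⟨ gs ⟩ g
    ⟨⟩-gen {gs} p = comb⇒∈⟨⟩ gs (comb-gen zero-ideal p)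

    ⟨⟩-elim : ∀ {H} → IsIdeal H → ∀ gs → All H gs → ⟨ gs ⟩ ⊆ᵢ H
    ⟨⟩-elim J gs ps {x} p = comb-elim zero-ideal J
      (λ {f} (lift e) → IsIdeal.resp J {[]} {f} (≃-sym {f} {[]} e) (IsIdeal.0∈ J)) gs ps {x} (∈⟨⟩⇒comb gs p)

    ⟨⟩-snoc : ∀ gs x → ⟨ gs ⟩ ⊆ᵢ ⟨ gs ++ x ∷ [] ⟩
    ⟨⟩-snoc gs x {f} = ⟨⟩-elim (⟨⟩-ideal (gs ++ x ∷ [])) gs (All.tabulate (λ g∈ → ⟨⟩-gen (∈-++⁺ˡ g∈))) {f}

    ⟨⟩-snoc-split : ∀ gs x → ⟨ gs ++ x ∷ [] ⟩ ⊆ᵢ Comb ⟨ gs ⟩ (x ∷ [])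
    ⟨⟩-snoc-split gs x {f} = ⟨⟩-elim (comb-ideal I (x ∷ [])) (gs ++ x ∷ [])
      (Allₚ.++⁺ (All.tabulate (λ {g} g∈ → comb-base I (x ∷ []) {g} (⟨⟩-gen g∈))) (comb-gen I {x ∷ []} (here ≡.refl) ∷ [])) {f}
      where I = ⟨⟩-ideal gs

-- Nonzerodivisors modulo monomial ideals

module _ {m : ℕ} where

  lookup-· : ∀ i (u v : Mon m) → V.lookup (u ·ₘ v) i ≡ V.lookup u i ℕ.+ V.lookup v i
  lookup-· i u v = Vₚ.lookup-zipWith ℕ._+_ i u v

  lookup-ext : ∀ {u v : Mon m} → (∀ i → V.lookup u i ≡ V.lookup v i) → u ≡ v
  lookup-ext {u} {v} e = ≡.trans (≡.sym (Vₚ.tabulate∘lookup u)) (≡.trans (Vₚ.tabulate-cong e) (Vₚ.tabulate∘lookup v))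

  ∣ₘ⇒≤ : ∀ {u w : Mon m} → u ∣ₘ w → ∀ i → V.lookup u i ℕ.≤ V.lookup w i
  ∣ₘ⇒≤ {u} (v , ≡.refl) i = ≡.subst (V.lookup u i ℕ.≤_) (≡.sym (lookup-· i u v)) (ℕₚ.m≤m+n _ _)

  ≤⇒∣ₘ : ∀ {u w : Mon m} → (∀ i → V.lookup u i ℕ.≤ V.lookup w i) → u ∣ₘ w
  ≤⇒∣ₘ {u} {w} le = V.zipWith ℕ._∸_ w u , lookup-ext λ i → ≡.trans (lookup-· i u _)
    (≡.trans (≡.cong (V.lookup u i ℕ.+_) (Vₚ.lookup-zipWith ℕ._∸_ i w u)) (ℕₚ.m+[n∸m]≡n (le i)))

  _∣ₘ?_ : ∀ (u w : Mon m) → Dec (u ∣ₘ w)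
  u ∣ₘ? w = map-dec ≤⇒∣ₘ ∣ₘ⇒≤ (Finₚ.all? (λ i → V.lookup u i ℕ.≤? V.lookup w i))

  ε : Fin m → Mon m
  ε j = V.tabulate (λ i → if ⌊ i Fin.≟ j ⌋ then 1 else 0)

  lookup-ε : ∀ j i → V.lookup (ε j) i ≡ (if ⌊ i Fin.≟ j ⌋ then 1 else 0)
  lookup-ε j i = Vₚ.lookup∘tabulate _ i

  lookup-ε-≡ : ∀ j → V.lookup (ε j) j ≡ 1
  lookup-ε-≡ j with j Fin.≟ j | lookup-ε j j
  ... | yes _ | e = e
  ... | no ne | _ = contradiction ≡.refl ne

  lookup-ε-≢ : ∀ {j i} → i ≢ j → V.lookup (ε j) i ≡ 0
  lookup-ε-≢ {j} {i} ne with i Fin.≟ j | lookup-ε j i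
  ... | yes e | _ = contradiction e ne
  ... | no _ | e = e

  lookup-ε·-≡ : ∀ j (v : Mon m) → V.lookup (ε j ·ₘ v) j ≡ suc (V.lookup v j)
  lookup-ε·-≡ j v = ≡.trans (lookup-· j (ε j) v) (≡.cong (ℕ._+ V.lookup v j) (lookup-ε-≡ j))

  lookup-ε·-≢ : ∀ {j i} (v : Mon m) → i ≢ j → V.lookup (ε j ·ₘ v) i ≡ V.lookup v i
  lookup-ε·-≢ {j} {i} v ne = ≡.trans (lookup-· i (ε j) v) (≡.cong (ℕ._+ V.lookup v i) (lookup-ε-≢ ne))

  ε-∣ : ∀ {j} {w : Mon m} → 1 ℕ.≤ V.lookup w j → ε j ∣ₘ w
  ε-∣ {j} {w} le = ≤⇒∣ₘ at
    where
    at : ∀ i → V.lookup (ε j) i ℕ.≤ V.lookup w i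
    at i with i Fin.≟ j
    ... | yes ≡.refl = ≡.subst (ℕ._≤ V.lookup w j) (≡.sym (lookup-ε-≡ j)) le
    ... | no ne = ≡.subst (ℕ._≤ V.lookup w i) (≡.sym (lookup-ε-≢ ne)) z≤n

  ·ₘ-swap : ∀ (a b w : Mon m) → a ·ₘ (b ·ₘ w) ≡ b ·ₘ (a ·ₘ w)
  ·ₘ-swap a b w = ≡.trans (≡.sym (·ₘ-assoc a b w)) (≡.trans (≡.cong (_·ₘ w) (·ₘ-comm a b)) (·ₘ-assoc b a w))

  mul^ : Mon m → ℕ → Mon m → Mon m
  mul^ a zero w = w
  mul^ a (suc b) w = mul^ a b (a ·ₘ w)

  lookup-mul^-≢ : ∀ {j i} b (w : Mon m) → i ≢ j → V.lookup (mul^ (ε j) b w) i ≡ V.lookup w i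
  lookup-mul^-≢ zero w ne = ≡.refl
  lookup-mul^-≢ {j} (suc b) w ne = ≡.trans (lookup-mul^-≢ b (ε j ·ₘ w) ne) (lookup-ε·-≢ w ne)

  mul^-· : ∀ a b (c w : Mon m) → c ·ₘ mul^ a b w ≡ mul^ a b (c ·ₘ w)
  mul^-· a zero c w = ≡.refl
  mul^-· a (suc b) c w = ≡.trans (mul^-· a b c (a ·ₘ w)) (≡.cong (mul^ a b) (·ₘ-swap c a w))

  Multiple : ∀ {s} → (Fin s → Mon m) → Mon m → Set
  Multiple g w = ∃[ k ] (g k ∣ₘ w)

  multiple? : ∀ {s} (g : Fin s → Mon m) → Decidable (Multiple g)
  multiple? g w = Finₚ.any? (λ k → g k ∣ₘ? w)

  ∣ₘ-· : ∀ u {v w : Mon m} → w ∣ₘ v → w ∣ₘ (u ·ₘ v)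
  ∣ₘ-· u {_} {w} (v , ≡.refl) = u ·ₘ v , ·ₘ-swap w u v

  multiple-· : ∀ {s} (g : Fin s → Mon m) u {v} → Multiple g v → Multiple g (u ·ₘ v)
  multiple-· g u (k , d) = k , ∣ₘ-· u d

module ExactTransfer {c ℓ} (R : CommutativeRing c ℓ) where
  open CommutativeRing R using (Carrier; _+_; _*_; -_; _-_; 0#; 1#)
  open Koszul R
  open ChangeOfIdeal R

  exact-resp : ∀ {G H : Carrier → Set (c ⊔ ℓ)} (I : IsIdeal G) (J : IsIdeal H) → G ⊆ᵢ H → H ⊆ᵢ G →
    ∀ {k} xs → Cycles.Exact I k xs → Cycles.Exact J k xs
  exact-resp I J G⊆H H⊆G xs ex z zF zc with ex z (λ S lt → H⊆G (zF S lt)) (λ S → H⊆G (zc S))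
  ... | w , wF , ∂w = w , (λ S lt → G⊆H (wF S lt)) , λ S → G⊆H (∂w S)

  -- `Exact k` yields `Exact (suc k)` only after a bounding chain is split by degree. Carrying all k
  -- from b on keeps at hand the two consecutive instances that `exact-ascend` asks for.
  ExactFrom : ∀ {G : Carrier → Set (c ⊔ ℓ)} → IsIdeal G → ℕ → List Carrier → Set (c ⊔ ℓ)
  ExactFrom I b xs = ∀ k → b ℕ.≤ k → Cycles.Exact I k xs

  module _ {G : Carrier → Set (c ⊔ ℓ)} (I : IsIdeal G) (f : Carrier) where
    private
      module R = CommutativeRing R
      J = comb-ideal I (f ∷ [])
      split : ∀ {a} → Comb G (f ∷ []) a → ∃[ b ] G (a - f * b)
      split (r , p) = r , IsIdeal.resp I (R.+-congˡ (R.-‿cong (R.*-comm r f))) p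

    exactFrom-descend : NZD G f → ∀ {b} xs → Comb G xs f → ExactFrom J (suc b) xs → ExactFrom I b xs
    exactFrom-descend nzd xs p ex k le =
      exact-descend I J (comb-base I (f ∷ [])) (comb-gen I {f ∷ []} (here ≡.refl)) split nzd xs p (ex (suc k) (s≤s le))

    exactFrom-ascend : NZD G f → ∀ {b} xs → ExactFrom I b xs → ExactFrom J (suc b) xs
    exactFrom-ascend nzd xs ex (suc k) (s≤s le) =
      exact-ascend I J (comb-base I (f ∷ [])) (comb-gen I {f ∷ []} (here ≡.refl)) split nzd xs
        (ex k le) (ex (suc k) (ℕₚ.m≤n⇒m≤1+n le))

  exactFrom-resp : ∀ {G H : Carrier → Set (c ⊔ ℓ)} (I : IsIdeal G) (J : IsIdeal H) → G ⊆ᵢ H → H ⊆ᵢ G →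
    ∀ {b} xs → ExactFrom I b xs → ExactFrom J b xs
  exactFrom-resp I J G⊆H H⊆G xs ex k le = exact-resp I J G⊆H H⊆G xs (ex k le)

module MonomialNZD {c ℓ} (F : Field c ℓ) (m : ℕ) where
  open Polynomials F
  open MonomialIdeals m
  open Linear m
  open ExactTransfer (polyRing m)
  private
    module F = Field F
    module P = CommutativeRing (polyRing m)
    open PolyRing F m using (_≃_; Poly; coeff; monomial; var)
  open P using () renaming (_*_ to _*′_; _-_ to _-′_; -_ to -′_; _+_ to _+′_)

  coeff-monomial* : ∀ u f w → coeff (monomial u *′ f) w F.≈ evK (λ v → indicator w (u ·ₘ v)) f
  coeff-monomial* u f w = F.trans (coeff-evK (monomial u *′ f) w)
    (F.trans (evK-* (indicator w) (monomial u) f) (F.trans (F.+-identityʳ _) (F.*-identityˡ _)))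

  coeff-shift : ∀ u f v → coeff (monomial u *′ f) (u ·ₘ v) F.≈ coeff f v
  coeff-shift u f v = F.trans (coeff-monomial* u f (u ·ₘ v)) (F.trans (evK-ext at f) (F.sym (coeff-evK f v)))
    where
    at : ∀ x → indicator (u ·ₘ v) (u ·ₘ x) F.≈ indicator v x
    at x with Vₚ.≡-dec ℕ._≟_ (u ·ₘ x) (u ·ₘ v) | Vₚ.≡-dec ℕ._≟_ x v
    ... | yes _ | yes _ = F.refl
    ... | yes e | no ne = contradiction (·ₘ-cancelˡ u e) ne
    ... | no ne | yes e = contradiction (≡.cong (u ·ₘ_) e) ne
    ... | no _ | no _ = F.refl

  coeff-∤ : ∀ u f {w} → ¬ (u ∣ₘ w) → coeff (monomial u *′ f) w F.≈ F.0#
  coeff-∤ u f {w} nd = F.trans (coeff-monomial* u f w) (evK-zero at f)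
    where
    at : ∀ x → indicator w (u ·ₘ x) F.≈ F.0#
    at x with Vₚ.≡-dec ℕ._≟_ (u ·ₘ x) w
    ... | yes e = contradiction (x , e) nd
    ... | no _ = F.refl

  coeff-sub : ∀ p q w → coeff (p -′ q) w F.≈ coeff p w F.+ F.- coeff q w
  coeff-sub p q w = F.trans (coeff-evK (p -′ q) w) (F.trans (evK-++ _ p (negate q))
    (F.+-cong (F.sym (coeff-evK p w)) (F.trans (evK-negate _ q) (F.-‿cong (F.sym (coeff-evK q w))))))

  var-NZD : ∀ {M} z → (∀ w → M (ε z ·ₘ w) → M w) → NZD (MI M) (var z)
  var-NZD z down f p w ¬Mw = lift (F.trans (F.sym (coeff-shift (ε z) f w))
    (lower (p (ε z ·ₘ w) (λ Mzw → ¬Mw (down w Mzw)))))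

  module _ {M : Mon m → Set} (M? : Decidable M) (up : ∀ u {v} → M v → M (u ·ₘ v)) {z x : Fin m} (z≢x : z ≢ x)
    (z-squarefree : ∀ w → M (ε z ·ₘ (ε z ·ₘ w)) → M (ε z ·ₘ w))
    (z-or-x : ∀ w b → M (ε z ·ₘ w) → M (mul^ (ε x) b w) → M w) where

    -- If (z - x) f lies in the ideal, then the coefficients of f agree along the line of the
    -- monomials v (z/x)^a as long as the products compared stay outside M. Such a line ends in both
    -- directions, where an exponent runs out, and beyond the end the coefficient is 0.
    -- `z-squarefree` keeps the walk towards z outside M, `z-or-x` the walk towards x.
    var-difference-NZD : NZD (MI M) (var z -′ var x)
    var-difference-NZD f p v ¬Mv = lift (by-cases (M? (ε z ·ₘ v)))
      where
      balance : ∀ w → ¬ M w → coeff (var z *′ f) w F.≈ coeff (var x *′ f) w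
      balance w ¬Mw = begin
        coeff (var z *′ f) w                                      ≈⟨ F.+-identityʳ _ ⟨
        coeff (var z *′ f) w F.+ F.0#                             ≈⟨ F.+-congˡ (F.-‿inverseˡ _) ⟨
        coeff (var z *′ f) w F.+ (F.- coeff (var x *′ f) w F.+ coeff (var x *′ f) w)
                                                                  ≈⟨ F.+-assoc _ _ _ ⟨
        (coeff (var z *′ f) w F.+ F.- coeff (var x *′ f) w) F.+ coeff (var x *′ f) w
          ≈⟨ F.+-congʳ (F.trans (F.sym (coeff-sub (var z *′ f) (var x *′ f) w)) (F.sym (distrib w))) ⟩
        coeff ((var z -′ var x) *′ f) w F.+ coeff (var x *′ f) w  ≈⟨ F.+-congʳ (lower (p w ¬Mw)) ⟩
        F.0# F.+ coeff (var x *′ f) w                             ≈⟨ F.+-identityˡ _ ⟩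
        coeff (var x *′ f) w ∎
        where
        open Relation.Binary.Reasoning.Setoid F.setoid
        distrib : ((var z -′ var x) *′ f) ≃ ((var z *′ f) -′ (var x *′ f))
        distrib = *-distrib-sub (var z) (var x) f

      -- Along v, zv/x, z²v/x², … all coefficients agree until x runs out.
      climb : ∀ k v → V.lookup v x ≡ k → ¬ M (ε z ·ₘ v) → coeff f v F.≈ F.0#
      climb k v ek ¬Mzv = F.trans (F.sym (coeff-shift (ε z) f v)) (F.trans (balance _ ¬Mzv) (rest k ek))
        where
        rest : ∀ k → V.lookup v x ≡ k → coeff (var x *′ f) (ε z ·ₘ v) F.≈ F.0#
        rest zero ek = coeff-∤ (ε x) f λ d → ℕₚ.1+n≢0 (ℕₚ.n≤0⇒n≡0 (≡.subst₂ ℕ._≤_ (lookup-ε-≡ x)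
          (≡.trans (lookup-ε·-≢ v (λ e → z≢x (≡.sym e))) ek) (∣ₘ⇒≤ d x)))
        rest (suc k) ek with ε-∣ {w = v} (≡.subst (1 ℕ.≤_) (≡.sym ek) (s≤s z≤n))
        ... | v′ , ≡.refl = F.trans (F.reflexive (≡.cong (coeff (var x *′ f)) (·ₘ-swap (ε z) (ε x) v′)))
              (F.trans (coeff-shift (ε x) f (ε z ·ₘ v′))
                (climb k (ε z ·ₘ v′)
                  (≡.trans (lookup-ε·-≢ v′ (λ e → z≢x (≡.sym e)))
                    (ℕₚ.suc-injective (≡.trans (≡.sym (lookup-ε·-≡ x v′)) ek)))
                  (λ Mzzv′ → ¬Mzv (≡.subst M (·ₘ-swap (ε x) (ε z) v′) (up (ε x) (z-squarefree v′ Mzzv′))))))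

      -- Along v, xv/z, x²v/z², … all coefficients agree until z runs out.
      descend : ∀ k v → V.lookup v z ≡ k → (∀ b → ¬ M (mul^ (ε x) b v)) → coeff f v F.≈ F.0#
      descend k v ek ¬M^ = F.trans (F.sym (coeff-shift (ε x) f v))
        (F.trans (F.sym (balance _ (¬M^ 1))) (rest k ek))
        where
        rest : ∀ k → V.lookup v z ≡ k → coeff (var z *′ f) (ε x ·ₘ v) F.≈ F.0#
        rest zero ek = coeff-∤ (ε z) f λ d → ℕₚ.1+n≢0 (ℕₚ.n≤0⇒n≡0 (≡.subst₂ ℕ._≤_ (lookup-ε-≡ z)
          (≡.trans (lookup-ε·-≢ v z≢x) ek) (∣ₘ⇒≤ d z)))
        rest (suc k) ek with ε-∣ {w = v} (≡.subst (1 ℕ.≤_) (≡.sym ek) (s≤s z≤n))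
        ... | v′ , ≡.refl = F.trans (F.reflexive (≡.cong (coeff (var z *′ f)) (·ₘ-swap (ε x) (ε z) v′)))
              (F.trans (coeff-shift (ε z) f (ε x ·ₘ v′))
                (descend k (ε x ·ₘ v′)
                  (≡.trans (lookup-ε·-≢ v′ z≢x)
                    (ℕₚ.suc-injective (≡.trans (≡.sym (lookup-ε·-≡ z v′)) ek)))
                  (λ b M^ → ¬M^ (suc b) (≡.subst M
                    (≡.trans (mul^-· (ε x) b (ε z) (ε x ·ₘ v′)) (≡.cong (mul^ (ε x) b) (·ₘ-swap (ε z) (ε x) v′)))
                    (up (ε z) M^)))))

      by-cases : Dec (M (ε z ·ₘ v)) → coeff f v F.≈ F.0#
      by-cases (no ¬Mzv) = climb _ v ≡.refl ¬Mzv
      by-cases (yes Mzv) = descend _ v ≡.refl (λ b M^ → ¬Mv (z-or-x v b Mzv M^))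

  multiple-ideal : ∀ {s} (g : Fin s → Mon m) → IsIdeal (MI (Multiple g))
  multiple-ideal g = MI-ideal (multiple? g) (multiple-· g)

  -- One polarization step: z replaces one factor x in some of the generators.
  module _ {s} (g g′ : Fin s → Mon m) {z x : Fin m} (z≢x : z ≢ x) (top : ℕ)
    (x≤top : ∀ k → V.lookup (g k) x ℕ.≤ top)
    (related : ∀ k → (V.lookup (g k) z ≡ 0 × g′ k ≡ g k) ⊎
      (∃[ h ] (g k ≡ ε z ·ₘ h × g′ k ≡ ε x ·ₘ h × V.lookup h z ≡ 0 × V.lookup h x ≡ top))) where

    private
      δ : Poly
      δ = var z -′ var x

      z-exponent : ∀ k → V.lookup (g k) z ≡ 0 ⊎ (V.lookup (g k) z ≡ 1 × V.lookup (g k) x ≡ top)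
      z-exponent k with related k
      ... | inj₁ (e , _) = inj₁ e
      ... | inj₂ (h , e , _ , hz , hx) = inj₂
              ( ≡.trans (≡.cong (λ w → V.lookup w z) e) (≡.trans (lookup-ε·-≡ z h) (≡.cong suc hz))
              , ≡.trans (≡.cong (λ w → V.lookup w x) e) (≡.trans (lookup-ε·-≢ h (λ x≡z → z≢x (≡.sym x≡z))) hx))

      z-exponent′ : ∀ k → V.lookup (g′ k) z ≡ 0
      z-exponent′ k with related k
      ... | inj₁ (e , e′) = ≡.trans (≡.cong (λ w → V.lookup w z) e′) e
      ... | inj₂ (h , _ , e′ , hz , _) = ≡.trans (≡.cong (λ w → V.lookup w z) e′) (≡.trans (lookup-ε·-≢ h z≢x) hz)

      strip-z : ∀ u w → V.lookup u z ≡ 0 → u ∣ₘ (ε z ·ₘ w) → u ∣ₘ w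
      strip-z u w e d = ≤⇒∣ₘ at
        where
        at : ∀ i → V.lookup u i ℕ.≤ V.lookup w i
        at i with i Fin.≟ z
        ... | yes ≡.refl = ≡.subst (ℕ._≤ V.lookup w z) (≡.sym e) z≤n
        ... | no ne = ≡.subst (V.lookup u i ℕ.≤_) (lookup-ε·-≢ w ne) (∣ₘ⇒≤ d i)

      squarefree : ∀ w → Multiple g (ε z ·ₘ (ε z ·ₘ w)) → Multiple g (ε z ·ₘ w)
      squarefree w (k , d) = k , ≤⇒∣ₘ at
        where
        z≤1 : V.lookup (g k) z ℕ.≤ 1
        z≤1 with z-exponent k
        ... | inj₁ e = ℕₚ.≤-trans (ℕₚ.≤-reflexive e) z≤n
        ... | inj₂ (e , _) = ℕₚ.≤-reflexive e
        at : ∀ i → V.lookup (g k) i ℕ.≤ V.lookup (ε z ·ₘ w) i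
        at i with i Fin.≟ z
        ... | yes ≡.refl = ℕₚ.≤-trans z≤1 (≡.subst (1 ℕ.≤_) (≡.sym (lookup-ε·-≡ z w)) (s≤s z≤n))
        ... | no ne = ≡.subst (V.lookup (g k) i ℕ.≤_) (lookup-ε·-≢ (ε z ·ₘ w) ne) (∣ₘ⇒≤ d i)

      -- A generator that needs z to divide z w has x-exponent `top`, so x divides w at least `top`
      -- times. No generator has a larger x-exponent, so the extra factors x in the second
      -- hypothesis do not help any generator to divide.
      z-or-x : ∀ w b → Multiple g (ε z ·ₘ w) → Multiple g (mul^ (ε x) b w) → Multiple g w
      z-or-x w b (k , d) (l , d′) with z-exponent k
      ... | inj₁ e = k , strip-z (g k) w e d
      ... | inj₂ (_ , e) = l , ≤⇒∣ₘ at
        where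
        at : ∀ i → V.lookup (g l) i ℕ.≤ V.lookup w i
        at i with i Fin.≟ x
        ... | yes ≡.refl = ℕₚ.≤-trans (x≤top l) (≡.subst₂ ℕ._≤_ e (lookup-ε·-≢ w (λ x≡z → z≢x (≡.sym x≡z))) (∣ₘ⇒≤ d x))
        ... | no ne = ≡.subst (V.lookup (g l) i ℕ.≤_) (lookup-mul^-≢ b w ne) (∣ₘ⇒≤ d′ i)

      nzd : NZD (MI (Multiple g)) δ
      nzd = var-difference-NZD (multiple? g) (multiple-· g) z≢x squarefree z-or-x

      nzd′ : NZD (MI (Multiple g′)) δ
      nzd′ = var-difference-NZD (multiple? g′) (multiple-· g′) z≢x
        (λ w (k , d) → k , strip-z (g′ k) (ε z ·ₘ w) (z-exponent′ k) d)
        (λ w b (k , d) _ → k , strip-z (g′ k) w (z-exponent′ k) d)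

      I = multiple-ideal g
      I′ = multiple-ideal g′

      module _ {H} (J : IsIdeal H) (δ∈ : H δ) where
        open IsIdeal J
        exchange : ∀ y → H (monomial (ε z ·ₘ y)) → H (monomial (ε x ·ₘ y))
        exchange y p = resp {monomial (ε z ·ₘ y) -′ (δ *′ monomial y)} {monomial (ε x ·ₘ y)}
          (P.trans {monomial (ε z ·ₘ y) -′ (δ *′ monomial y)} {var x *′ monomial y} {monomial (ε x ·ₘ y)}
            (sub-*-cancel (var z) (var x) (monomial y) (monomial (ε z ·ₘ y)) (monomial-· (ε z) y))
            (P.sym {monomial (ε x ·ₘ y)} {var x *′ monomial y} (monomial-· (ε x) y)))
          (+∈ {monomial (ε z ·ₘ y)} { -′ (δ *′ monomial y)} p (-∈ {δ *′ monomial y} (*∈ʳ (monomial y) {δ} δ∈)))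
        exchange′ : ∀ y → H (monomial (ε x ·ₘ y)) → H (monomial (ε z ·ₘ y))
        exchange′ y p = resp {monomial (ε x ·ₘ y) +′ (δ *′ monomial y)} {monomial (ε z ·ₘ y)}
          (P.trans {monomial (ε x ·ₘ y) +′ (δ *′ monomial y)} {var z *′ monomial y} {monomial (ε z ·ₘ y)}
            (sub-*-cancel′ (var z) (var x) (monomial y) (monomial (ε x ·ₘ y)) (monomial-· (ε x) y))
            (P.sym {monomial (ε z ·ₘ y)} {var z *′ monomial y} (monomial-· (ε z) y)))
          (+∈ {monomial (ε x ·ₘ y)} {δ *′ monomial y} p (*∈ʳ (monomial y) {δ} δ∈))

      J = comb-ideal I (δ ∷ [])
      J′ = comb-ideal I′ (δ ∷ [])

      J⊆J′ : Comb (MI (Multiple g)) (δ ∷ []) ⊆ᵢ Comb (MI (Multiple g′)) (δ ∷ [])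
      J⊆J′ {f} = comb-elim I J′ (λ {f} → MI-elim (multiple? g) J′ gen {f}) (δ ∷ []) (comb-gen I′ {δ ∷ []} (here ≡.refl) ∷ []) {f}
        where
        gen : ∀ w → Multiple g w → Comb (MI (Multiple g′)) (δ ∷ []) (monomial w)
        gen w (k , v , ≡.refl) with related k
        ... | inj₁ (_ , e′) = comb-base I′ (δ ∷ []) {monomial (g k ·ₘ v)}
                (MI-monomial (k , v , ≡.cong (_·ₘ v) e′))
        ... | inj₂ (h , e , e′ , _ , _) = ≡.subst (λ w → Comb (MI (Multiple g′)) (δ ∷ []) (monomial w))
                (≡.trans (≡.sym (·ₘ-assoc (ε z) h v)) (≡.cong (_·ₘ v) (≡.sym e)))
                (exchange′ J′ (comb-gen I′ {δ ∷ []} (here ≡.refl)) (h ·ₘ v)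
                  (comb-base I′ (δ ∷ []) {monomial (ε x ·ₘ (h ·ₘ v))}
                    (MI-monomial (k , v , ≡.trans (≡.cong (_·ₘ v) e′) (·ₘ-assoc (ε x) h v)))))

      J′⊆J : Comb (MI (Multiple g′)) (δ ∷ []) ⊆ᵢ Comb (MI (Multiple g)) (δ ∷ [])
      J′⊆J {f} = comb-elim I′ J (λ {f} → MI-elim (multiple? g′) J gen {f}) (δ ∷ []) (comb-gen I {δ ∷ []} (here ≡.refl) ∷ []) {f}
        where
        gen : ∀ w → Multiple g′ w → Comb (MI (Multiple g)) (δ ∷ []) (monomial w)
        gen w (k , v , ≡.refl) with related k
        ... | inj₁ (_ , e′) = comb-base I (δ ∷ []) {monomial (g′ k ·ₘ v)}
                (MI-monomial (k , v , ≡.cong (_·ₘ v) (≡.sym e′)))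
        ... | inj₂ (h , e , e′ , _ , _) = ≡.subst (λ w → Comb (MI (Multiple g)) (δ ∷ []) (monomial w))
                (≡.trans (≡.sym (·ₘ-assoc (ε x) h v)) (≡.cong (_·ₘ v) (≡.sym e′)))
                (exchange J (comb-gen I {δ ∷ []} (here ≡.refl)) (h ·ₘ v)
                  (comb-base I (δ ∷ []) {monomial (ε z ·ₘ (h ·ₘ v))}
                    (MI-monomial (k , v , ≡.trans (≡.cong (_·ₘ v) e) (·ₘ-assoc (ε z) h v)))))

    -- Modulo z - x the generators before and after the step agree, so both ideals become equal once
    -- δ is added. Adding δ to the ideal of `g′` raises the bound by one, removing it from the ideal
    -- of `g` lowers it again.
    polarization-step : ∀ {b} xs → var z ∈ₗ xs → var x ∈ₗ xs →
      ExactFrom I′ b xs → ExactFrom I b xs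
    polarization-step xs z∈ x∈ ex = exactFrom-descend I δ nzd xs
      (+∈ {var z} { -′ var x} (comb-gen I z∈) (-∈ {var x} (comb-gen I x∈)))
      (exactFrom-resp J′ J (λ {f} → J′⊆J {f}) (λ {f} → J⊆J′ {f}) xs (exactFrom-ascend I′ δ nzd′ xs ex))
      where open IsIdeal (comb-ideal I xs)

-- Polynomials in two sets of variables

sumF : ∀ {N} → (Fin N → ℕ) → ℕ
sumF {zero} f = 0
sumF {suc N} f = f Fin.zero ℕ.+ sumF (λ q → f (Fin.suc q))

sumF-cong : ∀ {N} {f g : Fin N → ℕ} → (∀ q → f q ≡ g q) → sumF f ≡ sumF g
sumF-cong {zero} e = ≡.refl
sumF-cong {suc N} e = ≡.cong₂ ℕ._+_ (e Fin.zero) (sumF-cong (λ q → e (Fin.suc q)))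

sumF-mono : ∀ {N} {f g : Fin N → ℕ} → (∀ q → f q ℕ.≤ g q) → sumF f ℕ.≤ sumF g
sumF-mono {zero} le = z≤n
sumF-mono {suc N} le = ℕₚ.+-mono-≤ (le Fin.zero) (sumF-mono (λ q → le (Fin.suc q)))

sumF-zero : ∀ {N} {f : Fin N → ℕ} → (∀ q → f q ≡ 0) → sumF f ≡ 0
sumF-zero {zero} e = ≡.refl
sumF-zero {suc N} e = ≡.cong₂ ℕ._+_ (e Fin.zero) (sumF-zero (λ q → e (Fin.suc q)))

sumF-update : ∀ {N} {f g : Fin N → ℕ} q₀ {d} → (∀ q → q ≢ q₀ → f q ≡ g q) → f q₀ ≡ d ℕ.+ g q₀ →
  sumF f ≡ d ℕ.+ sumF g
sumF-update {suc N} {f} {g} Fin.zero {d} e e₀ = ≡.trans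
  (≡.cong₂ ℕ._+_ e₀ (sumF-cong (λ q → e (Fin.suc q) (λ ())))) (ℕₚ.+-assoc d _ _)
sumF-update {suc N} {f} {g} (Fin.suc q₀) {d} e e₀ = ≡.trans
  (≡.cong₂ ℕ._+_ (e Fin.zero (λ ())) (sumF-update q₀ (λ q ne → e (Fin.suc q) (λ eq → ne (Finₚ.suc-injective eq))) e₀))
  (≡.trans (≡.sym (ℕₚ.+-assoc (g Fin.zero) d rest)) (≡.trans (≡.cong (ℕ._+ rest) (ℕₚ.+-comm (g Fin.zero) d)) (ℕₚ.+-assoc d (g Fin.zero) rest)))
  where rest = sumF (λ q → g (Fin.suc q))

below : ∀ {N} → ℕ → (Fin N → ℕ) → Fin N → ℕ
below t f q with toℕ q ℕ.<? t
... | yes _ = f q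
... | no _ = 0

from : ∀ {N} → ℕ → (Fin N → ℕ) → Fin N → ℕ
from t f q with toℕ q ℕ.<? t
... | yes _ = 0
... | no _ = f q

module _ {N} (f : Fin N → ℕ) where
  below-< : ∀ {t q} → toℕ q ℕ.< t → below t f q ≡ f q
  below-< {t} {q} lt with toℕ q ℕ.<? t
  ... | yes _ = ≡.refl
  ... | no nlt = contradiction lt nlt

  below-≥ : ∀ {t q} → ¬ toℕ q ℕ.< t → below t f q ≡ 0
  below-≥ {t} {q} nlt with toℕ q ℕ.<? t
  ... | yes lt = contradiction lt nlt
  ... | no _ = ≡.refl

  from-< : ∀ {t q} → toℕ q ℕ.< t → from t f q ≡ 0
  from-< {t} {q} lt with toℕ q ℕ.<? t
  ... | yes _ = ≡.refl
  ... | no nlt = contradiction lt nlt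

  from-≥ : ∀ {t q} → ¬ toℕ q ℕ.< t → from t f q ≡ f q
  from-≥ {t} {q} nlt with toℕ q ℕ.<? t
  ... | yes lt = contradiction lt nlt
  ... | no _ = ≡.refl

  private
    <suc-≢ : ∀ {t} {q q₀ : Fin N} → toℕ q₀ ≡ t → q ≢ q₀ → toℕ q ℕ.< suc t → toℕ q ℕ.< t
    <suc-≢ e ne (s≤s le) = ℕₚ.≤∧≢⇒< le (λ eq → ne (Finₚ.toℕ-injective (≡.trans eq (≡.sym e))))

  below-suc-≢ : ∀ {t q q₀} → toℕ q₀ ≡ t → q ≢ q₀ → below (suc t) f q ≡ below t f q
  below-suc-≢ {t} {q} e ne = by (toℕ q ℕ.<? t)
    where
    by : Dec (toℕ q ℕ.< t) → below (suc t) f q ≡ below t f q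
    by (yes lt) = ≡.trans (below-< (ℕₚ.m≤n⇒m≤1+n lt)) (≡.sym (below-< lt))
    by (no nlt) = ≡.trans (below-≥ (λ lt → nlt (<suc-≢ e ne lt))) (≡.sym (below-≥ nlt))

  from-suc-≢ : ∀ {t q q₀} → toℕ q₀ ≡ t → q ≢ q₀ → from (suc t) f q ≡ from t f q
  from-suc-≢ {t} {q} e ne = by (toℕ q ℕ.<? t)
    where
    by : Dec (toℕ q ℕ.< t) → from (suc t) f q ≡ from t f q
    by (yes lt) = ≡.trans (from-< (ℕₚ.m≤n⇒m≤1+n lt)) (≡.sym (from-< lt))
    by (no nlt) = ≡.trans (from-≥ (λ lt → nlt (<suc-≢ e ne lt))) (≡.sym (from-≥ nlt))

  sum-below-suc : ∀ {t q₀} → toℕ q₀ ≡ t → sumF (below (suc t) f) ≡ f q₀ ℕ.+ sumF (below t f)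
  sum-below-suc {t} {q₀} ≡.refl = sumF-update {f = below (suc t) f} {below t f} q₀ (λ q ne → below-suc-≢ ≡.refl ne)
    (≡.trans (below-< ℕₚ.≤-refl) (≡.sym (≡.trans (≡.cong (f q₀ ℕ.+_) (below-≥ (ℕₚ.n≮n t))) (ℕₚ.+-identityʳ _))))

module _ {n N : ℕ} where
  mk : (Fin n → ℕ) → (Fin N → ℕ) → Mon (n ℕ.+ N)
  mk f h = V.tabulate f V.++ V.tabulate h

  lookup-mkˡ : ∀ f h i → V.lookup (mk f h) (i ↑ˡ N) ≡ f i
  lookup-mkˡ f h i = ≡.trans (Vₚ.lookup-++ˡ (V.tabulate f) (V.tabulate h) i) (Vₚ.lookup∘tabulate f i)

  lookup-mkʳ : ∀ f h q → V.lookup (mk f h) (n ↑ʳ q) ≡ h q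
  lookup-mkʳ f h q = ≡.trans (Vₚ.lookup-++ʳ (V.tabulate f) (V.tabulate h) q) (Vₚ.lookup∘tabulate h q)

  split-index : ∀ {a} (P : Fin (n ℕ.+ N) → Set a) → (∀ i → P (i ↑ˡ N)) → (∀ q → P (n ↑ʳ q)) → ∀ j → P j
  split-index P l r j = ≡.subst P (Finₚ.join-splitAt n N j) (by (Fin.splitAt n j))
    where
    by : ∀ x → P (Fin.join n N x)
    by (inj₁ i) = l i
    by (inj₂ q) = r q

  ↑ˡ≢↑ʳ : ∀ (i : Fin n) (q : Fin N) → n ↑ʳ q ≢ i ↑ˡ N
  ↑ˡ≢↑ʳ i q e with ≡.trans (≡.sym (Finₚ.splitAt-↑ʳ n N q)) (≡.trans (≡.cong (Fin.splitAt n) e) (Finₚ.splitAt-↑ˡ n i N))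
  ... | ()

-- The monomial data behind setting some variables to zero: `retract` answers `nothing` on the
-- monomials that are killed, and `embed` includes the monomials in the remaining variables. It
-- serves both B → S and B → T.
record Retract (m m′ : ℕ) : Set where
  field
    retract : Mon m → Maybe (Mon m′)
    embed : Mon m′ → Mon m
    retract-1 : retract oneₘ ≡ just oneₘ
    retract-· : ∀ u v {u′ v′} → retract u ≡ just u′ → retract v ≡ just v′ → retract (u ·ₘ v) ≡ just (u′ ·ₘ v′)
    retract-nothing : ∀ u v → retract u ≡ nothing → retract (u ·ₘ v) ≡ nothing
    embed-1 : embed oneₘ ≡ oneₘ
    embed-· : ∀ u v → embed (u ·ₘ v) ≡ embed u ·ₘ embed v
    retract-embed : ∀ v → retract (embed v) ≡ just v
    retract-image : ∀ w {v} → retract w ≡ just v → w ≡ embed v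

module RetractHoms {c ℓ} (F : Field c ℓ) {m m′ : ℕ} (rt : Retract m m′) where
  open Polynomials F
  open Retract rt
  private
    module F = Field F
    module P = CommutativeRing (polyRing m)
    module P′ = CommutativeRing (polyRing m′)
    module M = MonomialIdeals m
    module M′ = MonomialIdeals m′
    open module PR = PolyRing F using (Poly; monomial; coeff)

  private
    h : Mon m → Poly m′
    h v = maybe′ (monomial m′) [] (retract v)

  kill : Poly m → Poly m′
  kill = Linear.Eval.ev m (polyRing m′) (const-hom m′) h

  lift-poly : Poly m′ → Poly m
  lift-poly = Linear.Eval.ev m′ (polyRing m) (const-hom m) (λ v → monomial m (embed v))

  lift-isHom : IsHom (polyRing m′) (polyRing m) lift-poly
  lift-isHom = ev-hom m′ (polyRing m) (const-hom m) (λ v → monomial m (embed v))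
    (P.reflexive {monomial m (embed oneₘ)} (≡.cong (monomial m) embed-1))
    (λ u v → P.trans {monomial m (embed (u ·ₘ v))} {monomial m (embed u ·ₘ embed v)} {monomial m (embed u) P.* monomial m (embed v)}
      (P.reflexive {monomial m (embed (u ·ₘ v))} (≡.cong (monomial m) (embed-· u v))) (M.monomial-· (embed u) (embed v)))

  kill-isHom : IsHom (polyRing m) (polyRing m′) kill
  kill-isHom = ev-hom m (polyRing m′) (const-hom m′) h
    (P′.reflexive {h oneₘ} (≡.cong (maybe′ (monomial m′) []) retract-1)) mult
    where
    mult : ∀ u v → h (u ·ₘ v) P′.≈ (h u P′.* h v)
    mult u v with retract u in eu | retract v in ev
    ... | nothing | _ rewrite retract-nothing u v eu = P′.refl {[]}
    ... | just u′ | just v′ rewrite retract-· u v eu ev = M′.monomial-· u′ v′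
    ... | just u′ | nothing rewrite ·ₘ-comm u v | retract-nothing v u ev =
            P′.sym {monomial m′ u′ P′.* []} {[]} (P′.zeroʳ (monomial m′ u′))

  lift-monomial : ∀ v → lift-poly (monomial m′ v) P.≈ monomial m (embed v)
  lift-monomial = ev-monomial m′ (polyRing m) (const-hom m) (λ v → monomial m (embed v))

  kill-monomial : ∀ w {v} → retract w ≡ just v → kill (monomial m w) P′.≈ monomial m′ v
  kill-monomial w {v} e = P′.trans {kill (monomial m w)} {h w} {monomial m′ v}
    (ev-monomial m (polyRing m′) (const-hom m′) h w) (P′.reflexive {h w} (≡.cong (maybe′ (monomial m′) []) e))

  kill-monomial-0 : ∀ w → retract w ≡ nothing → kill (monomial m w) P′.≈ []
  kill-monomial-0 w e = P′.trans {kill (monomial m w)} {h w} {[]}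
    (ev-monomial m (polyRing m′) (const-hom m′) h w) (P′.reflexive {h w} (≡.cong (maybe′ (monomial m′) []) e))

  kill-outside : ∀ w → (∀ v → w ≢ embed v) → kill (monomial m w) P′.≈ []
  kill-outside w w∉ = by-retract (retract w) ≡.refl
    where
    by-retract : ∀ r → retract w ≡ r → kill (monomial m w) P′.≈ []
    by-retract nothing e = kill-monomial-0 w e
    by-retract (just v) e = contradiction (retract-image w e) (w∉ v)

  private
    module KH = IsHom kill-isHom

  kill-const : ∀ a → kill (const a) P′.≈ const a
  kill-const a = P′.trans {kill (const a)} {const a P′.* h oneₘ} {const a} (P′.+-identityʳ (const a P′.* h oneₘ))
    (P′.trans {const a P′.* h oneₘ} {const a P′.* P′.1#} {const a}
      (P′.*-congˡ {const a} {h oneₘ} {P′.1#} (P′.reflexive {h oneₘ} (≡.cong (maybe′ (monomial m′) []) retract-1)))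
      (P′.*-identityʳ (const a)))

  kill-lift : ∀ f → kill (lift-poly f) P′.≈ f
  kill-lift [] = P′.refl {[]}
  kill-lift ((a , v) ∷ f) = begin
    kill ((const a P.* x) P.+ lift-poly f)            ≈⟨ KH.φ-+ (const a P.* x) (lift-poly f) ⟩
    kill (const a P.* x) P′.+ kill (lift-poly f)      ≈⟨ P′.+-cong {kill (const a P.* x)} {kill (const a) P′.* kill x} {kill (lift-poly f)} {f} (KH.φ-* (const a) x) (kill-lift f) ⟩
    (kill (const a) P′.* kill x) P′.+ f
      ≈⟨ P′.+-congʳ {f} {kill (const a) P′.* kill x} {const a P′.* monomial m′ v}
           (P′.*-cong {kill (const a)} {const a} {kill x} {monomial m′ v} (kill-const a) (kill-monomial (embed v) (retract-embed v))) ⟩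
    (const a P′.* monomial m′ v) P′.+ f
      ≈⟨ P′.+-congʳ {f} {(a , v) ∷ []} {const a P′.* monomial m′ v} (M′.term a v) ⟨
    ((a , v) ∷ f) ∎
    where
    x = monomial m (embed v)
    open Relation.Binary.Reasoning.Setoid P′.setoid

  private
    coeff-++ : ∀ p q v → coeff m′ (p ++ q) v F.≈ coeff m′ p v F.+ coeff m′ q v
    coeff-++ p q v = F.trans (coeff-evK (p ++ q) v) (F.trans (evK-++ _ p q)
      (F.+-cong (F.sym (coeff-evK p v)) (F.sym (coeff-evK q v))))
      where open Linear m′

  coeff-kill : ∀ f v → coeff m′ (kill f) v F.≈ coeff m f (embed v)
  coeff-kill [] v = F.refl
  coeff-kill ((a , w) ∷ f) v = F.trans (coeff-++ (const a P′.* h w) (kill f) v)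
    (F.trans (F.+-congˡ (coeff-kill f v)) (by (retract w) ≡.refl))
    where
    by : ∀ r → retract w ≡ r →
      coeff m′ (const a P′.* h w) v F.+ coeff m f (embed v) F.≈ coeff m ((a , w) ∷ f) (embed v)
    by nothing e with Vₚ.≡-dec ℕ._≟_ w (embed v)
    ... | yes ≡.refl with ≡.trans (≡.sym e) (retract-embed v)
    ...   | ()
    by nothing e | no _ rewrite e = F.trans (F.+-congʳ (P′.zeroʳ (const a) v)) (F.+-identityˡ _)
    by (just w′) e with Vₚ.≡-dec ℕ._≟_ w (embed v)
    ... | yes ≡.refl rewrite retract-embed v = F.+-congʳ (F.trans (F.sym (M′.term a v v)) at)
      where
      at : coeff m′ ((a , v) ∷ []) v F.≈ a
      at with Vₚ.≡-dec ℕ._≟_ v v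
      ... | yes _ = F.+-identityʳ a
      ... | no ne = contradiction ≡.refl ne
    ... | no ne rewrite e = F.trans (F.+-congʳ (F.trans (F.sym (M′.term a w′ v)) at)) (F.+-identityˡ _)
      where
      at : coeff m′ ((a , w′) ∷ []) v F.≈ F.0#
      at with Vₚ.≡-dec ℕ._≟_ w′ v
      ... | yes ≡.refl = contradiction (retract-image w e) ne
      ... | no _ = F.refl

module _ (n N : ℕ) where
  private
    one-· : ∀ {k} (u v : Mon k) → u ·ₘ v ≡ oneₘ → u ≡ oneₘ
    one-· [] [] e = ≡.refl
    one-· (zero ∷ u) (b ∷ v) e = ≡.cong (0 ∷_) (one-· u v (Vₚ.∷-injectiveʳ e))
    one-· (suc _ ∷ u) (b ∷ v) ()

    ++-· : ∀ {k l} (u u′ : Mon k) (v v′ : Mon l) → (u V.++ v) ·ₘ (u′ V.++ v′) ≡ (u ·ₘ u′) V.++ (v ·ₘ v′)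
    ++-· [] [] v v′ = ≡.refl
    ++-· (a ∷ u) (b ∷ u′) v v′ = ≡.cong (_ ∷_) (++-· u u′ v v′)

    one-++ : ∀ k {l} → oneₘ {k} V.++ oneₘ {l} ≡ oneₘ
    one-++ zero = ≡.refl
    one-++ (suc k) = ≡.cong (0 ∷_) (one-++ k)

    take-++ : ∀ {k l} (u : Mon k) (v : Mon l) → V.take k (u V.++ v) ≡ u
    take-++ [] v = ≡.refl
    take-++ (a ∷ u) v = ≡.cong (a ∷_) (take-++ u v)

    drop-++ : ∀ {k l} (u : Mon k) (v : Mon l) → V.drop k (u V.++ v) ≡ v
    drop-++ [] v = ≡.refl
    drop-++ (a ∷ u) v = drop-++ u v

    when : ∀ {A : Set} {k} → Mon k → A → Maybe A
    when u x with Vₚ.≡-dec ℕ._≟_ u oneₘ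
    ... | yes _ = just x
    ... | no _ = nothing

    when-intro : ∀ {A : Set} {k} {u : Mon k} {x y : A} → u ≡ oneₘ → x ≡ y → when u x ≡ just y
    when-intro {u = u} e ≡.refl with Vₚ.≡-dec ℕ._≟_ u oneₘ
    ... | yes _ = ≡.refl
    ... | no ne = contradiction e ne

    when-just : ∀ {A : Set} {k} (u : Mon k) {x y : A} → when u x ≡ just y → u ≡ oneₘ × x ≡ y
    when-just u e with Vₚ.≡-dec ℕ._≟_ u oneₘ
    when-just u ≡.refl | yes p = p , ≡.refl

    when-nothing : ∀ {A : Set} {k} (u v : Mon k) {x y : A} → when u x ≡ nothing → when (u ·ₘ v) y ≡ nothing
    when-nothing u v {y = y} e with Vₚ.≡-dec ℕ._≟_ u oneₘ
    when-nothing u v {y = y} e | no ne with Vₚ.≡-dec ℕ._≟_ (u ·ₘ v) oneₘ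
    ... | yes p = contradiction (one-· u v p) ne
    ... | no _ = ≡.refl

    take-· : ∀ (u v : Mon (n ℕ.+ N)) → V.take n (u ·ₘ v) ≡ V.take n u ·ₘ V.take n v
    take-· = Vₚ.take-zipWith ℕ._+_

    drop-· : ∀ (u v : Mon (n ℕ.+ N)) → V.drop n (u ·ₘ v) ≡ V.drop n u ·ₘ V.drop n v
    drop-· = Vₚ.drop-zipWith ℕ._+_

  retractˡ : Retract (n ℕ.+ N) n
  retractˡ = record
    { retract = λ w → when (V.drop n w) (V.take n w)
    ; embed = λ v → v V.++ oneₘ
    ; retract-1 = when-intro (≡.trans (≡.cong (V.drop n) (≡.sym (one-++ n))) (drop-++ (oneₘ {n}) oneₘ))
                             (≡.trans (≡.cong (V.take n) (≡.sym (one-++ n))) (take-++ (oneₘ {n}) oneₘ))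
    ; retract-· = λ u v eu ev → let (du , tu) = when-just (V.drop n u) eu
                                    (dv , tv) = when-just (V.drop n v) ev in
        when-intro (≡.trans (drop-· u v) (≡.trans (≡.cong₂ _·ₘ_ du dv) (·ₘ-identityˡ oneₘ)))
                   (≡.trans (take-· u v) (≡.cong₂ _·ₘ_ tu tv))
    ; retract-nothing = λ u v e → ≡.trans (≡.cong (λ z → when z (V.take n (u ·ₘ v))) (drop-· u v))
        (when-nothing (V.drop n u) (V.drop n v) e)
    ; embed-1 = one-++ n
    ; embed-· = λ u v → ≡.trans (≡.cong ((u ·ₘ v) V.++_) (≡.sym (·ₘ-identityˡ oneₘ))) (≡.sym (++-· u v oneₘ oneₘ))
    ; retract-embed = λ v → when-intro (drop-++ v oneₘ) (take-++ v oneₘ)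
    ; retract-image = λ w e → let (dw , tw) = when-just (V.drop n w) e in
        ≡.trans (≡.sym (Vₚ.take++drop≡id n w)) (≡.cong₂ V._++_ tw dw)
    }

  retractʳ : Retract (n ℕ.+ N) N
  retractʳ = record
    { retract = λ w → when (V.take n w) (V.drop n w)
    ; embed = λ v → oneₘ V.++ v
    ; retract-1 = when-intro (≡.trans (≡.cong (V.take n) (≡.sym (one-++ n))) (take-++ (oneₘ {n}) oneₘ))
                             (≡.trans (≡.cong (V.drop n) (≡.sym (one-++ n))) (drop-++ (oneₘ {n}) oneₘ))
    ; retract-· = λ u v eu ev → let (tu , du) = when-just (V.take n u) eu
                                    (tv , dv) = when-just (V.take n v) ev in
        when-intro (≡.trans (take-· u v) (≡.trans (≡.cong₂ _·ₘ_ tu tv) (·ₘ-identityˡ oneₘ)))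
                   (≡.trans (drop-· u v) (≡.cong₂ _·ₘ_ du dv))
    ; retract-nothing = λ u v e → ≡.trans (≡.cong (λ z → when z (V.drop n (u ·ₘ v))) (take-· u v))
        (when-nothing (V.take n u) (V.take n v) e)
    ; embed-1 = one-++ n
    ; embed-· = λ u v → ≡.trans (≡.cong (V._++ (u ·ₘ v)) (≡.sym (·ₘ-identityˡ oneₘ))) (≡.sym (++-· oneₘ oneₘ u v))
    ; retract-embed = λ v → when-intro (take-++ (oneₘ {n}) v) (drop-++ (oneₘ {n}) v)
    ; retract-image = λ w e → let (tw , dw) = when-just (V.take n w) e in
        ≡.trans (≡.sym (Vₚ.take++drop≡id n w)) (≡.cong₂ V._++_ tw dw)
    }

-- Regular sequences and exactness

module RegularExact {c ℓ} (F : Field c ℓ) {m m′ : ℕ}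
  {φ : PolyRing.Poly F m → PolyRing.Poly F m′} {ψ : PolyRing.Poly F m′ → PolyRing.Poly F m}
  (φ-hom : IsHom (Polynomials.polyRing F m) (Polynomials.polyRing F m′) φ)
  (ψ-hom : IsHom (Polynomials.polyRing F m′) (Polynomials.polyRing F m) ψ)
  (φψ : ∀ f → CommutativeRing._≈_ (Polynomials.polyRing F m′) (φ (ψ f)) f) where

  open Polynomials F
  open MonomialIdeals m
  open ExactTransfer (polyRing m)
  private
    module M′ = MonomialIdeals m′
    module P = CommutativeRing (polyRing m)
    module P′ = CommutativeRing (polyRing m′)
    module φ = IsHom φ-hom
    module ψ = IsHom ψ-hom
    open PolyRing F

  preimage : ∀ gs → IsIdeal (λ a → M′.⟨ gs ⟩ (φ a))
  preimage gs = φ.preimage-ideal (M′.⟨⟩-ideal gs)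

  private
    φ-split : ∀ a r f → φ (a P.- ψ r P.* ψ f) P′.≈ φ a P′.- r P′.* f
    φ-split a r f = begin
      φ (a P.- ψ r P.* ψ f)             ≈⟨ φ.φ-sub a (ψ r P.* ψ f) ⟩
      φ a P′.- φ (ψ r P.* ψ f)          ≈⟨ P′.+-congˡ {φ a} { P′.- φ (ψ r P.* ψ f)} { P′.- (r P′.* f)}
                                            (P′.-‿cong {φ (ψ r P.* ψ f)} {r P′.* f} step) ⟩
      φ a P′.- r P′.* f ∎
      where
      open Relation.Binary.Reasoning.Setoid P′.setoid
      step : φ (ψ r P.* ψ f) P′.≈ (r P′.* f)
      step = P′.trans {φ (ψ r P.* ψ f)} {φ (ψ r) P′.* φ (ψ f)} {r P′.* f} (φ.φ-* (ψ r) (ψ f))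
        (P′.*-cong {φ (ψ r)} {r} {φ (ψ f)} {f} (φψ r) (φψ f))

  -- Hᵢ vanishes above the length of `xs`, and each regular element lowers this bound by one. The
  -- ideal is pulled back along φ, so that S/I is treated as a quotient of the larger ring, where
  -- the elements of `xs` live.
  regular-exact : ∀ xs → (∀ {G} (I : IsIdeal G) i → Comb G xs (ψ (var m′ i))) →
    ∀ gs fs → RegularSeq m′ gs fs → ∀ b → length xs ℕ.< b ℕ.+ length fs → ExactFrom (preimage gs) b xs
  regular-exact xs vars∈ gs [] reg b lt k le =
    Koszul.Cycles.exact-above-length (polyRing m) (preimage gs) xs
      (ℕₚ.<-≤-trans (≡.subst (length xs ℕ.<_) (ℕₚ.+-identityʳ b) lt) le)
  regular-exact xs vars∈ gs (f ∷ fs) (f∈max , f-nzd , reg) b lt =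
    exactFrom-descend I (ψ f) nzd xs ψf∈
      (exactFrom-resp (preimage (gs ++ f ∷ [])) (comb-ideal I (ψ f ∷ [])) (λ {a} → to {a}) (λ {a} → back {a}) xs
        (regular-exact xs vars∈ (gs ++ f ∷ []) fs reg (suc b)
          (≡.subst (length xs ℕ.<_) (ℕₚ.+-suc b (length fs)) lt)))
    where
    I = preimage gs
    open M′.IsIdeal (M′.⟨⟩-ideal gs)
    nzd : NZD (λ a → M′.⟨ gs ⟩ (φ a)) (ψ f)
    nzd a p = f-nzd (φ a) (resp {φ (ψ f P.* a)} {φ a P′.* f}
      (P′.trans {φ (ψ f P.* a)} {φ (ψ f) P′.* φ a} {φ a P′.* f} (φ.φ-* (ψ f) a)
        (P′.trans {φ (ψ f) P′.* φ a} {f P′.* φ a} {φ a P′.* f} (P′.*-congʳ {φ a} {φ (ψ f)} {f} (φψ f)) (P′.*-comm f (φ a)))) p)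
    ψf∈ : Comb (λ a → M′.⟨ gs ⟩ (φ a)) xs (ψ f)
    ψf∈ = M′.⟨⟩-elim (ψ.preimage-ideal (comb-ideal I xs)) _
      (Allₚ.map⁺ (All.tabulate (λ {i} _ → vars∈ I i))) {f} f∈max
    to : ∀ {a} → M′.⟨ gs ++ f ∷ [] ⟩ (φ a) → Comb (λ a → M′.⟨ gs ⟩ (φ a)) (ψ f ∷ []) a
    to {a} p = ψ r , resp {φ a P′.- r P′.* f} {φ (a P.- ψ r P.* ψ f)}
      (P′.sym {φ (a P.- ψ r P.* ψ f)} {φ a P′.- r P′.* f} (φ-split a r f)) (proj₂ split)
      where
      split = M′.⟨⟩-snoc-split gs f {φ a} p
      r = proj₁ split
    back : ∀ {a} → Comb (λ a → M′.⟨ gs ⟩ (φ a)) (ψ f ∷ []) a → M′.⟨ gs ++ f ∷ [] ⟩ (φ a)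
    back {a} = comb-elim I (preimage (gs ++ f ∷ [])) (λ {a} → M′.⟨⟩-snoc gs f {φ a}) (ψ f ∷ [])
      (M′.IsIdeal.resp (M′.⟨⟩-ideal (gs ++ f ∷ [])) {f} {φ (ψ f)} (P′.sym {φ (ψ f)} {f} (φψ f))
        (M′.⟨⟩-gen (∈-++⁺ʳ gs (here ≡.refl))) ∷ []) {a}

module _ {c ℓ} (F : Field c ℓ) (m : ℕ) where
  open Polynomials F
  open MonomialIdeals m
  open ExactTransfer (polyRing m)
  open PolyRing F
  private
    module P = CommutativeRing (polyRing m)
    module E = RegularExact F (id-isHom (polyRing m)) (id-isHom (polyRing m)) (λ f → P.refl {f})

  regular-exact : ∀ xs → (∀ {G} (I : IsIdeal G) i → Comb G xs (var m i)) →
    ∀ gs fs → RegularSeq m gs fs → ∀ b → length xs ℕ.< b ℕ.+ length fs → ExactFrom (⟨⟩-ideal gs) b xs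
  regular-exact xs vars∈ gs fs reg b lt =
    exactFrom-resp (E.preimage gs) (⟨⟩-ideal gs) (λ p → p) (λ p → p) xs (E.regular-exact xs vars∈ gs fs reg b lt)

-- By graded Nakayama, exactness for a homogeneous sequence passes to its initial segments.
module ExactRegular {c ℓ} (F : Field c ℓ) {m m′ : ℕ}
  {φ : PolyRing.Poly F m → PolyRing.Poly F m′} {ψ : PolyRing.Poly F m′ → PolyRing.Poly F m}
  (φ-hom : IsHom (Polynomials.polyRing F m) (Polynomials.polyRing F m′) φ)
  (ψ-hom : IsHom (Polynomials.polyRing F m′) (Polynomials.polyRing F m) ψ)
  (φψ : ∀ f → CommutativeRing._≈_ (Polynomials.polyRing F m′) (φ (ψ f)) f)
  {G : PolyRing.Poly F m → Set (c ⊔ ℓ)} (I : Ideals.IsIdeal (Polynomials.polyRing F m) G)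
  (T : KoszulProperties.Truncation (Polynomials.polyRing F m) I)
  {H : PolyRing.Poly F m′ → Set (c ⊔ ℓ)} (J : Ideals.IsIdeal (Polynomials.polyRing F m′) H)
  (1∉H : ¬ H (PolyRing.oneₚ F m′)) where

  open Polynomials F
  open Koszul (polyRing m)
  open KoszulProperties (polyRing m)
  open Graded I T
  open Truncation T
  open Cycles I using (Exact; exact-1⇒NZD)
  private
    module M′ = MonomialIdeals m′
    module P = CommutativeRing (polyRing m)
    module P′ = CommutativeRing (polyRing m′)
    module φ = IsHom φ-hom
    module ψ = IsHom ψ-hom
    open PolyRing F

  -- `gs` grows at its end while `ds` grows at its front, and `up` and `down` keep the two ideals
  -- matched across φ and ψ. Properness at the end comes from the proper ideal H, which contains
  -- everything that is ever adjoined.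
  exact-regular : ∀ gs fs ds → (∀ {f} → M′.⟨ gs ⟩ f → Comb G ds (ψ f)) → (∀ {a} → Comb G ds a → M′.⟨ gs ⟩ (φ a)) →
    All (InMax m′) fs → All (λ f → ∃[ k ] Homogeneous (suc k) (ψ f)) fs → HomogeneousList ds →
    All H gs → All H fs → Exact 1 (L.map ψ fs L.ʳ++ ds) → RegularSeq m′ gs fs
  exact-regular gs [] ds up down _ _ _ Hgs _ ex 1∈ = 1∉H (M′.⟨⟩-elim J gs Hgs {oneₚ m′} 1∈)
  exact-regular gs (f ∷ fs) ds up down (max ∷ maxs) ((k , hf) ∷ hfs) hds Hgs (Hf ∷ Hfs) ex =
    max , nzd , exact-regular (gs ++ f ∷ []) fs (ψ f ∷ ds) (λ {g} → up′ {g}) (λ {a} → down′ {a}) maxs hfs ((suc k , hf) ∷ hds)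
      (Allₚ.++⁺ Hgs (Hf ∷ [])) Hfs ex
    where
    nzd : NonZeroDivisor m′ gs f
    nzd g p = M′.IsIdeal.resp (M′.⟨⟩-ideal gs) {φ (ψ g)} {g} (φψ g) (down {ψ g} (exact-1⇒NZD (ψ f) ds peeled (ψ g)
      (IsIdeal.resp (comb-ideal I ds) {ψ (g P′.* f)} {ψ f P.* ψ g}
        (P.trans {ψ (g P′.* f)} {ψ g P.* ψ f} {ψ f P.* ψ g} (ψ.φ-* g f) (P.*-comm (ψ g) (ψ f))) (up p))))
      where
      peeled : Exact 1 (ψ f ∷ ds)
      peeled = exact-1-peel (L.map ψ fs) (ψ f ∷ ds) (Allₚ.map⁺ hfs) ((suc k , hf) ∷ hds) ex
    up′ : ∀ {g} → M′.⟨ gs ++ f ∷ [] ⟩ g → Comb G (ψ f ∷ ds) (ψ g)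
    up′ {g} = M′.⟨⟩-elim (ψ.preimage-ideal (comb-ideal I (ψ f ∷ ds))) (gs ++ f ∷ [])
      (Allₚ.++⁺ (All.tabulate (λ {g} g∈ → comb-cons I (ψ f) ds {ψ g} (up {g} (M′.⟨⟩-gen g∈)))) (comb-gen I {ψ f ∷ ds} (here ≡.refl) ∷ [])) {g}
    down′ : ∀ {a} → Comb G (ψ f ∷ ds) a → M′.⟨ gs ++ f ∷ [] ⟩ (φ a)
    down′ {a} (r , q) = resp {φ (a P.- r P.* ψ f) P′.+ φ r P′.* f} {φ a} φ-a
      (+∈ {φ (a P.- r P.* ψ f)} {φ r P′.* f} (M′.⟨⟩-snoc gs f {φ (a P.- r P.* ψ f)} (down {a P.- r P.* ψ f} q))
        (*∈ (φ r) {f} (M′.⟨⟩-gen (∈-++⁺ʳ gs (here ≡.refl)))))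
      where
      open M′.IsIdeal (M′.⟨⟩-ideal (gs ++ f ∷ []))
      φ-a : φ (a P.- r P.* ψ f) P′.+ φ r P′.* f P′.≈ φ a
      φ-a = begin
        φ (a P.- r P.* ψ f) P′.+ φ r P′.* f
          ≈⟨ P′.+-congˡ {φ (a P.- r P.* ψ f)} {φ r P′.* f} {φ (r P.* ψ f)}
               (P′.sym {φ (r P.* ψ f)} {φ r P′.* f} (P′.trans {φ (r P.* ψ f)} {φ r P′.* φ (ψ f)} {φ r P′.* f} (φ.φ-* r (ψ f)) (P′.*-congˡ {φ r} {φ (ψ f)} {f} (φψ f)))) ⟩
        φ (a P.- r P.* ψ f) P′.+ φ (r P.* ψ f)
          ≈⟨ φ.φ-+ (a P.- r P.* ψ f) (r P.* ψ f) ⟨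
        φ ((a P.- r P.* ψ f) P.+ r P.* ψ f)
          ≈⟨ φ.φ-cong {(a P.- r P.* ψ f) P.+ r P.* ψ f} {a} (MonomialIdeals.sub-add-cancel m a (r P.* ψ f)) ⟩
        φ a ∎
        where open Relation.Binary.Reasoning.Setoid P′.setoid

-- From the monomial ideal to its polarization, one variable at a time

module Polarize {c ℓ} (F : Field c ℓ) {n N s : ℕ} (u : Fin s → Mon n) (row : Fin N → Fin n) (b : Fin s → Fin N → ℕ)
  (b-01 : ∀ k q → b k q ≡ 0 ⊎ b k q ≡ 1)
  (b-down : ∀ k {q q′} → toℕ q ℕ.< toℕ q′ → row q ≡ row q′ → b k q′ ≡ 1 → b k q ≡ 1)
  where

  open Polynomials F
  open MonomialIdeals (n ℕ.+ N)
  open MonomialNZD F (n ℕ.+ N)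
  open ExactTransfer (polyRing (n ℕ.+ N))
  private
    module P = CommutativeRing (polyRing (n ℕ.+ N))
    open PolyRing F (n ℕ.+ N)

  contribution : Fin s → Fin n → Fin N → ℕ
  contribution k i q = if ⌊ row q Fin.≟ i ⌋ then b k q else 0

  module _ (total : ∀ k i → sumF (contribution k i) ≡ V.lookup (u k) i) where

    -- The generators of I with only the variables z_q, q ≥ t, split off.
    partial : ℕ → Fin s → Mon (n ℕ.+ N)
    partial t k = mk (λ i → sumF (below t (contribution k i))) (from t (b k))

    partial-x : ∀ t k i → V.lookup (partial t k) (i ↑ˡ N) ≡ sumF (below t (contribution k i))
    partial-x t k = lookup-mkˡ (λ i → sumF (below t (contribution k i))) (from t (b k))

    partial-z : ∀ t k q → V.lookup (partial t k) (n ↑ʳ q) ≡ from t (b k) q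
    partial-z t k = lookup-mkʳ (λ i → sumF (below t (contribution k i))) (from t (b k))

    mk-ext : ∀ (w : Mon (n ℕ.+ N)) {f h} → (∀ i → V.lookup w (i ↑ˡ N) ≡ f i) → (∀ q → V.lookup w (n ↑ʳ q) ≡ h q) → w ≡ mk f h
    mk-ext w {f} {h} e e′ = lookup-ext (split-index _
      (λ i → ≡.trans (e i) (≡.sym (lookup-mkˡ f h i))) (λ q → ≡.trans (e′ q) (≡.sym (lookup-mkʳ f h q))))

    module Step (q₀ : Fin N) where
      private
        t = toℕ q₀
        z = n ↑ʳ q₀
        x = row q₀ ↑ˡ N

        indicator₀ : Fin N → ℕ
        indicator₀ q = if ⌊ row q Fin.≟ row q₀ ⌋ then 1 else 0

        b≤1 : ∀ k q → b k q ℕ.≤ 1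
        b≤1 k q with b-01 k q
        ... | inj₁ e = ℕₚ.≤-trans (ℕₚ.≤-reflexive e) z≤n
        ... | inj₂ e = ℕₚ.≤-reflexive e

        contribution≤ : ∀ k q → contribution k (row q₀) q ℕ.≤ indicator₀ q
        contribution≤ k q with row q Fin.≟ row q₀
        ... | yes _ = b≤1 k q
        ... | no _ = z≤n

        below-≤ : ∀ k q → below t (contribution k (row q₀)) q ℕ.≤ below t indicator₀ q
        below-≤ k q with toℕ q ℕ.<? t
        ... | yes _ = contribution≤ k q
        ... | no _ = z≤n

        -- The number of variables before z_{q₀} in its row, hence the largest x-exponent that can
        -- occur after they have been merged into x.
        top : ℕ
        top = sumF (below t indicator₀)

        -- By `b-down` a generator containing z_{q₀} contains all earlier variables of the row, so
        -- its x-exponent attains `top`. This is the property of polarizations that makes z - x a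
        -- nonzerodivisor.
        below-full : ∀ k → b k q₀ ≡ 1 → ∀ q → below t (contribution k (row q₀)) q ≡ below t indicator₀ q
        below-full k e q with toℕ q ℕ.<? t
        ... | no _ = ≡.refl
        ... | yes lt with row q Fin.≟ row q₀
        ...   | no _ = ≡.refl
        ...   | yes r = b-down k lt r e

        sum-step : ∀ k i → sumF (below (suc t) (contribution k i)) ≡ contribution k i q₀ ℕ.+ sumF (below t (contribution k i))
        sum-step k i = sum-below-suc (contribution k i) ≡.refl

        contribution-0 : ∀ k i → b k q₀ ≡ 0 → contribution k i q₀ ≡ 0
        contribution-0 k i e with row q₀ Fin.≟ i
        ... | yes _ = e
        ... | no _ = ≡.refl

        lookup-x : ∀ k i → b k q₀ ≡ 1 → contribution k i q₀ ≡ V.lookup (ε x) (i ↑ˡ N)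
        lookup-x k i e with row q₀ Fin.≟ i
        ... | yes ≡.refl = ≡.trans e (≡.sym (lookup-ε-≡ x))
        ... | no ne = ≡.sym (lookup-ε-≢ (λ eq → ne (≡.sym (Finₚ.↑ˡ-injective N i (row q₀) eq))))

        x-z : ∀ q → V.lookup (ε x) (n ↑ʳ q) ≡ 0
        x-z q = lookup-ε-≢ (↑ˡ≢↑ʳ (row q₀) q)

        z-x : ∀ i → V.lookup (ε z) (i ↑ˡ N) ≡ 0
        z-x i = lookup-ε-≢ (λ e → ↑ˡ≢↑ʳ i q₀ (≡.sym e))

        from-step : ∀ k q → b k q₀ ≡ 1 → from t (b k) q ≡ V.lookup (ε z) (n ↑ʳ q) ℕ.+ from (suc t) (b k) q
        from-step k q e with q Fin.≟ q₀
        ... | yes ≡.refl = ≡.trans (≡.trans (from-≥ (b k) {t} {q₀} (ℕₚ.n≮n t)) e)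
                (≡.sym (≡.cong₂ ℕ._+_ (lookup-ε-≡ z) (from-< (b k) {suc t} {q₀} ℕₚ.≤-refl)))
        ... | no ne = ≡.trans (≡.sym (from-suc-≢ (b k) ≡.refl ne))
                (≡.cong (ℕ._+ from (suc t) (b k) q) (≡.sym (lookup-ε-≢ (λ eq → ne (Finₚ.↑ʳ-injective n q q₀ eq)))))

        from-step-0 : ∀ k q → b k q₀ ≡ 0 → from (suc t) (b k) q ≡ from t (b k) q
        from-step-0 k q e with q Fin.≟ q₀
        ... | yes ≡.refl = ≡.trans (from-< (b k) {suc t} {q₀} ℕₚ.≤-refl) (≡.sym (≡.trans (from-≥ (b k) {t} {q₀} (ℕₚ.n≮n t)) e))
        ... | no ne = from-suc-≢ (b k) ≡.refl ne

        related : ∀ k → (V.lookup (partial t k) z ≡ 0 × partial (suc t) k ≡ partial t k) ⊎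
          (∃[ h ] (partial t k ≡ ε z ·ₘ h × partial (suc t) k ≡ ε x ·ₘ h × V.lookup h z ≡ 0 × V.lookup h x ≡ top))
        related k with b-01 k q₀
        ... | inj₁ e = inj₁
                ( ≡.trans (partial-z t k q₀) (≡.trans (from-≥ (b k) {t} {q₀} (ℕₚ.n≮n t)) e)
                , mk-ext (partial (suc t) k) {λ i → sumF (below t (contribution k i))} {from t (b k)}
                    (λ i → ≡.trans (partial-x (suc t) k i) (≡.trans (sum-step k i)
                      (≡.cong (ℕ._+ sumF (below t (contribution k i))) (contribution-0 k i e))))
                    (λ q → ≡.trans (partial-z (suc t) k q) (from-step-0 k q e)))
        ... | inj₂ e = inj₂
                ( h
                , ≡.sym (mk-ext (ε z ·ₘ h) {fx} {from t (b k)}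
                    (λ i → ≡.trans (lookup-· (i ↑ˡ N) (ε z) h) (≡.cong₂ ℕ._+_ (z-x i) (hx i)))
                    (λ q → ≡.trans (lookup-· (n ↑ʳ q) (ε z) h)
                      (≡.trans (≡.cong (V.lookup (ε z) (n ↑ʳ q) ℕ.+_) (hz q)) (≡.sym (from-step k q e)))))
                , ≡.sym (mk-ext (ε x ·ₘ h) {λ i → sumF (below (suc t) (contribution k i))} {from (suc t) (b k)}
                    (λ i → ≡.trans (lookup-· (i ↑ˡ N) (ε x) h)
                      (≡.trans (≡.cong₂ ℕ._+_ (≡.sym (lookup-x k i e)) (hx i)) (≡.sym (sum-step k i))))
                    (λ q → ≡.trans (lookup-· (n ↑ʳ q) (ε x) h) (≡.cong₂ ℕ._+_ (x-z q) (hz q))))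
                , ≡.trans (hz q₀) (from-< (b k) {suc t} {q₀} ℕₚ.≤-refl)
                , ≡.trans (hx (row q₀)) (sumF-cong (below-full k e)))
          where
          fx : Fin n → ℕ
          fx i = sumF (below t (contribution k i))
          h : Mon (n ℕ.+ N)
          h = mk fx (from (suc t) (b k))
          hx : ∀ i → V.lookup h (i ↑ˡ N) ≡ fx i
          hx = lookup-mkˡ fx (from (suc t) (b k))
          hz : ∀ q → V.lookup h (n ↑ʳ q) ≡ from (suc t) (b k) q
          hz = lookup-mkʳ fx (from (suc t) (b k))

      exact-step : ∀ {d} xs → var z ∈ₗ xs → var x ∈ₗ xs →
        ExactFrom (multiple-ideal (partial (suc t))) d xs → ExactFrom (multiple-ideal (partial t)) d xs
      exact-step = polarization-step (partial t) (partial (suc t)) (↑ˡ≢↑ʳ (row q₀) q₀) top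
        (λ k → ≡.subst (ℕ._≤ top) (≡.sym (partial-x t k (row q₀))) (sumF-mono (below-≤ k))) related

    module _ (xs : List Poly) (vars∈ : ∀ i → var i ∈ₗ xs) where

      -- `partial N` are the generators of I in the x_i alone and `partial 0` those of I^p in the
      -- z_q alone; each step splits off one more z_q, the last ones first.
      exact-polarized : ∀ {d} → ExactFrom (multiple-ideal (partial N)) d xs → ExactFrom (multiple-ideal (partial 0)) d xs
      exact-polarized {d} ex = go N ℕₚ.≤-refl ex
        where
        go : ∀ t → t ℕ.≤ N → ExactFrom (multiple-ideal (partial t)) d xs → ExactFrom (multiple-ideal (partial 0)) d xs
        go zero _ ex = ex
        go (suc t) lt ex = go t (ℕₚ.<⇒≤ lt) (≡.subst (λ t → ExactFrom (multiple-ideal (partial t)) d xs) (Finₚ.toℕ-fromℕ< lt)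
          (Step.exact-step q₀ xs (vars∈ _) (vars∈ _)
            (≡.subst (λ t → ExactFrom (multiple-ideal (partial (suc t))) d xs) (≡.sym (Finₚ.toℕ-fromℕ< lt)) ex)))
          where q₀ = Fin.fromℕ< lt

      private
        z-free : ∀ k q → V.lookup (partial N k) (n ↑ʳ q) ≡ 0
        z-free k q = ≡.trans (partial-z N k q) (from-< (b k) {N} {q} (Finₚ.toℕ<n q))

      Killed : ℕ → Mon (n ℕ.+ N) → Set
      Killed j w = Multiple (partial N) w ⊎ ∃[ q ] (toℕ q ℕ.< j × 1 ℕ.≤ V.lookup w (n ↑ʳ q))

      killed? : ∀ j → Decidable (Killed j)
      killed? j w = multiple? (partial N) w ⊎-dec Finₚ.any? (λ q → (toℕ q ℕ.<? j) ×-dec (1 ℕ.≤? V.lookup w (n ↑ʳ q)))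

      killed-· : ∀ j v {w} → Killed j w → Killed j (v ·ₘ w)
      killed-· j v (inj₁ d) = inj₁ (multiple-· (partial N) v d)
      killed-· j v {w} (inj₂ (q , lt , le)) = inj₂ (q , lt ,
        ≡.subst (1 ℕ.≤_) (≡.sym (lookup-· (n ↑ʳ q) v w)) (ℕₚ.≤-trans le (ℕₚ.m≤n+m _ _)))

      killed-ideal : ∀ j → IsIdeal (MI (Killed j))
      killed-ideal j = MI-ideal (killed? j) (killed-· j)

      private
        MI-mono : ∀ {M M′ : Mon (n ℕ.+ N) → Set} → (∀ {w} → M w → M′ w) → MI M ⊆ᵢ MI M′
        MI-mono M⊆M′ p w ¬M′w = p w (λ Mw → ¬M′w (M⊆M′ Mw))

      -- `killed-ideal N` is generated by I and all z_q. The z_q form a regular sequence on B/IB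
      -- since no generator of I contains them, and restoring each of them lowers the bound by one.
      exact-unkill : ∀ {d} → ExactFrom (killed-ideal N) (N ℕ.+ d) xs → ExactFrom (multiple-ideal (partial N)) d xs
      exact-unkill {d} ex = exactFrom-resp (killed-ideal 0) (multiple-ideal (partial N))
        (λ {f} → MI-mono {Killed 0} {Multiple (partial N)} (λ { (inj₁ d) → d }) {f})
        (λ {f} → MI-mono {Multiple (partial N)} {Killed 0} inj₁ {f}) xs (go N ℕₚ.≤-refl ex)
        where
        go : ∀ j → j ℕ.≤ N → ExactFrom (killed-ideal j) (j ℕ.+ d) xs → ExactFrom (killed-ideal 0) d xs
        go zero _ ex = ex
        go (suc j) lt ex = go j (ℕₚ.<⇒≤ lt) (exactFrom-descend I (var z) nzd xs (comb-gen I (vars∈ z))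
          (exactFrom-resp (killed-ideal (suc j)) J (λ {f} → to {f}) (λ {f} → back {f}) xs ex))
          where
          q₀ = Fin.fromℕ< lt
          z = n ↑ʳ q₀
          I = killed-ideal j
          J = comb-ideal I (var z ∷ [])
          to : MI (Killed (suc j)) ⊆ᵢ Comb (MI (Killed j)) (var z ∷ [])
          to {f} = MI-elim (killed? (suc j)) J gen {f}
            where
            gen : ∀ w → Killed (suc j) w → Comb (MI (Killed j)) (var z ∷ []) (monomial w)
            gen w (inj₁ d) = comb-base I (var z ∷ []) {monomial w} (MI-monomial {Killed j} {w} (inj₁ d))
            gen w (inj₂ (q , s≤s le , w≥)) with ℕₚ.m≤n⇒m<n∨m≡n le
            ... | inj₁ lt′ = comb-base I (var z ∷ []) {monomial w} (MI-monomial {Killed j} {w} (inj₂ (q , lt′ , w≥)))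
            ... | inj₂ e with Finₚ.toℕ-injective (≡.trans e (≡.sym (Finₚ.toℕ-fromℕ< lt)))
            ...   | ≡.refl with ε-∣ {w = w} w≥
            ...     | v , ≡.refl = resp {var z P.* monomial v} {monomial (ε z ·ₘ v)}
                        (P.sym {monomial (ε z ·ₘ v)} {var z P.* monomial v} (monomial-· (ε z) v))
                        (*∈ʳ (monomial v) {var z} (comb-gen I {var z ∷ []} (here ≡.refl)))
              where open IsIdeal J
          back : Comb (MI (Killed j)) (var z ∷ []) ⊆ᵢ MI (Killed (suc j))
          back {f} = comb-elim I (killed-ideal (suc j))
            (λ {f} → MI-mono {Killed j} {Killed (suc j)}
              (λ { (inj₁ d) → inj₁ d ; (inj₂ (q , lt , le)) → inj₂ (q , ℕₚ.m≤n⇒m≤1+n lt , le) }) {f})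
            (var z ∷ [])
            (MI-monomial {Killed (suc j)} {ε z} (inj₂ (q₀ , s≤s (ℕₚ.≤-reflexive (Finₚ.toℕ-fromℕ< lt)) , ℕₚ.≤-reflexive (≡.sym (lookup-ε-≡ z)))) ∷ []) {f}
          nzd : NZD (MI (Killed j)) (var z)
          nzd = var-NZD z down
            where
            down : ∀ w → Killed j (ε z ·ₘ w) → Killed j w
            down w (inj₁ (k , d)) = inj₁ (k , ≤⇒∣ₘ (split-index _
              (λ i → ≡.subst (V.lookup (partial N k) (i ↑ˡ N) ℕ.≤_)
                (lookup-ε·-≢ w (λ e → ↑ˡ≢↑ʳ i q₀ (≡.sym e))) (∣ₘ⇒≤ d (i ↑ˡ N)))
              (λ q → ≡.subst (ℕ._≤ V.lookup w (n ↑ʳ q)) (≡.sym (z-free k q)) z≤n)))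
            down w (inj₂ (q , lt′ , le)) = inj₂ (q , lt′ , ≡.subst (1 ℕ.≤_) (lookup-ε·-≢ w ne) le)
              where
              ne : n ↑ʳ q ≢ z
              ne e = ℕₚ.<⇒≢ lt′ (≡.trans (≡.cong toℕ (Finₚ.↑ʳ-injective n q q₀ e)) (Finₚ.toℕ-fromℕ< lt))

-- Face ideals are prime

-- The lexicographic order; any monomial order would do.
infix 4 _<ₘ_ _≤ₘ_
_<ₘ_ : ∀ {m} → Mon m → Mon m → Set
[] <ₘ [] = ⊥
(a ∷ u) <ₘ (b ∷ v) = a ℕ.< b ⊎ (a ≡ b × u <ₘ v)

_≤ₘ_ : ∀ {m} → Mon m → Mon m → Set
u ≤ₘ v = u ≡ v ⊎ u <ₘ v

<ₘ-irrefl : ∀ {m} (u : Mon m) → ¬ (u <ₘ u)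
<ₘ-irrefl (a ∷ u) (inj₁ lt) = ℕₚ.<-irrefl ≡.refl lt
<ₘ-irrefl (a ∷ u) (inj₂ (_ , lt)) = <ₘ-irrefl u lt

<ₘ-trans : ∀ {m} {u v w : Mon m} → u <ₘ v → v <ₘ w → u <ₘ w
<ₘ-trans {u = []} {[]} {[]} ()
<ₘ-trans {u = _ ∷ _} {_ ∷ _} {_ ∷ _} (inj₁ p) (inj₁ q) = inj₁ (ℕₚ.<-trans p q)
<ₘ-trans {u = _ ∷ _} {_ ∷ _} {_ ∷ _} (inj₁ p) (inj₂ (≡.refl , _)) = inj₁ p
<ₘ-trans {u = _ ∷ _} {_ ∷ _} {_ ∷ _} (inj₂ (≡.refl , _)) (inj₁ q) = inj₁ q
<ₘ-trans {u = _ ∷ _} {_ ∷ _} {_ ∷ _} (inj₂ (≡.refl , p)) (inj₂ (≡.refl , q)) = inj₂ (≡.refl , <ₘ-trans p q)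

≤ₘ-total : ∀ {m} (u v : Mon m) → u ≤ₘ v ⊎ v ≤ₘ u
≤ₘ-total [] [] = inj₁ (inj₁ ≡.refl)
≤ₘ-total (a ∷ u) (b ∷ v) with ℕₚ.<-cmp a b
... | tri< lt _ _ = inj₁ (inj₂ (inj₁ lt))
... | tri> _ _ gt = inj₂ (inj₂ (inj₁ gt))
... | tri≈ _ ≡.refl _ with ≤ₘ-total u v
...   | inj₁ (inj₁ ≡.refl) = inj₁ (inj₁ ≡.refl)
...   | inj₁ (inj₂ lt) = inj₁ (inj₂ (inj₂ (≡.refl , lt)))
...   | inj₂ (inj₁ ≡.refl) = inj₁ (inj₁ ≡.refl)
...   | inj₂ (inj₂ lt) = inj₂ (inj₂ (inj₂ (≡.refl , lt)))

≤ₘ-trans : ∀ {m} {u v w : Mon m} → u ≤ₘ v → v ≤ₘ w → u ≤ₘ w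
≤ₘ-trans (inj₁ ≡.refl) q = q
≤ₘ-trans (inj₂ p) (inj₁ ≡.refl) = inj₂ p
≤ₘ-trans (inj₂ p) (inj₂ q) = inj₂ (<ₘ-trans p q)

·ₘ-monoˡ-< : ∀ {m} {u v : Mon m} w → u <ₘ v → (u ·ₘ w) <ₘ (v ·ₘ w)
·ₘ-monoˡ-< {u = []} {[]} [] ()
·ₘ-monoˡ-< {u = _ ∷ _} {_ ∷ _} (c ∷ w) (inj₁ lt) = inj₁ (ℕₚ.+-monoˡ-< c lt)
·ₘ-monoˡ-< {u = _ ∷ _} {_ ∷ _} (c ∷ w) (inj₂ (≡.refl , lt)) = inj₂ (≡.refl , ·ₘ-monoˡ-< w lt)

·ₘ-monoʳ-≤ : ∀ {m} w {u v : Mon m} → u ≤ₘ v → (w ·ₘ u) ≤ₘ (w ·ₘ v)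
·ₘ-monoʳ-≤ w (inj₁ ≡.refl) = inj₁ ≡.refl
·ₘ-monoʳ-≤ w {u} {v} (inj₂ lt) = inj₂ (≡.subst₂ _<ₘ_ (·ₘ-comm u w) (·ₘ-comm v w) (·ₘ-monoˡ-< w lt))

-- In a product of polynomials only the pair of the two largest monomials can reach their product;
-- this excludes the other pairs.
·ₘ-<-≤-≢ : ∀ {m} {u v α β : Mon m} → u <ₘ α → v ≤ₘ β → u ·ₘ v ≢ α ·ₘ β
·ₘ-<-≤-≢ {v = v} {α} {β} u<α v≤β e with ·ₘ-monoʳ-≤ α v≤β
... | inj₁ e′ = <ₘ-irrefl _ (≡.subst (_<ₘ (α ·ₘ v)) (≡.trans e (≡.sym e′)) (·ₘ-monoˡ-< v u<α))
... | inj₂ lt = <ₘ-irrefl _ (≡.subst (_<ₘ (α ·ₘ β)) e (<ₘ-trans (·ₘ-monoˡ-< v u<α) lt))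

supportedIn? : ∀ {m} (v : Mon m) (Z : Subset m) → Dec (SupportedIn v Z)
supportedIn? v Z = Finₚ.all? (λ j → (V.lookup Z j Bool.≟ false) →-dec (V.lookup v j ℕ.≟ 0))

module MonomialPrimes {c ℓ} (F : Field c ℓ) (m : ℕ) where
  open Polynomials F
  open Linear m
  open MonomialIdeals m
  open MonomialNZD F m using (coeff-monomial*; coeff-shift; coeff-∤)
  open Eval scalars id-hom using (ev-without)
  private
    module F = Field F
    module P = CommutativeRing (polyRing m)
    open PolyRing F m
    open P using () renaming (_*_ to _*′_; _+_ to _+′_; -_ to -′_)

  -- The largest exponent listed in f, whether or not its coefficient vanishes: this cannot be
  -- decided, and the primality proof only needs that the list becomes shorter.
  leading : ∀ (t : F.Carrier × Mon m) f → ∃[ α ] (α ∈ₗ L.map proj₂ (t ∷ f) × All (λ s → proj₂ s ≤ₘ α) (t ∷ f))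
  leading (a , v) [] = v , here ≡.refl , inj₁ ≡.refl ∷ []
  leading (a , v) (t ∷ f) with leading t f
  ... | α , α∈ , le with ≤ₘ-total v α
  ...   | inj₁ v≤α = α , there α∈ , v≤α ∷ le
  ...   | inj₂ α≤v = v , here ≡.refl , inj₁ ≡.refl ∷ All.map (λ s≤α → ≤ₘ-trans s≤α α≤v) le

  length-without-< : ∀ α f → α ∈ₗ L.map proj₂ f → length (without α f) ℕ.< length f
  length-without-< α ((a , v) ∷ f) α∈ with Vₚ.≡-dec ℕ._≟_ v α
  ... | yes _ = s≤s (length-without α f)
  length-without-< α ((a , v) ∷ f) (here e) | no ne = contradiction (≡.sym e) ne
  length-without-< α ((a , v) ∷ f) (there α∈) | no ne = s≤s (length-without-< α f α∈)

  without-< : ∀ α f → All (λ s → proj₂ s ≤ₘ α) f → All (λ s → proj₂ s <ₘ α) (without α f)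
  without-< α [] [] = []
  without-< α ((a , v) ∷ f) (le ∷ les) with Vₚ.≡-dec ℕ._≟_ v α
  ... | yes _ = without-< α f les
  without-< α ((a , v) ∷ f) (inj₁ e ∷ les) | no ne = contradiction e ne
  without-< α ((a , v) ∷ f) (inj₂ lt ∷ les) | no ne = lt ∷ without-< α f les

  evK-zero-on : ∀ {h} f → All (λ s → h (proj₂ s) F.≈ F.0#) f → evK h f F.≈ F.0#
  evK-zero-on [] [] = F.refl
  evK-zero-on ((a , v) ∷ f) (e ∷ es) = F.trans (F.+-cong (F.trans (F.*-congˡ e) (F.zeroʳ a)) (evK-zero-on f es)) (F.+-identityˡ _)

  coeff-leading : ∀ α β f g → All (λ s → proj₂ s ≤ₘ α) f → All (λ s → proj₂ s ≤ₘ β) g →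
    coeff (f *′ g) (α ·ₘ β) F.≈ coeff f α F.* coeff g β
  coeff-leading α β f g f≤ g≤ = begin
    coeff (f *′ g) (α ·ₘ β)                                   ≈⟨ coeff-evK (f *′ g) (α ·ₘ β) ⟩
    evK (indicator (α ·ₘ β)) (f *′ g)                         ≈⟨ evK-* (indicator (α ·ₘ β)) f g ⟩
    evK h f                                                   ≈⟨ ev-without h α f ⟩
    coeff f α F.* h α F.+ evK h (without α f)                 ≈⟨ F.+-cong (F.*-congˡ hα) (evK-zero-on (without α f) rest) ⟩
    coeff f α F.* coeff g β F.+ F.0#                          ≈⟨ F.+-identityʳ _ ⟩
    coeff f α F.* coeff g β ∎
    where
    open Relation.Binary.Reasoning.Setoid F.setoid
    h : Mon m → F.Carrier
    h u = evK (λ v → indicator (α ·ₘ β) (u ·ₘ v)) g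
    hα : h α F.≈ coeff g β
    hα = F.trans (F.sym (coeff-monomial* α g (α ·ₘ β))) (coeff-shift α g β)
    indicator-≢ : ∀ {w v} → v ≢ w → indicator w v F.≈ F.0#
    indicator-≢ {w} {v} ne with Vₚ.≡-dec ℕ._≟_ v w
    ... | yes e = contradiction e ne
    ... | no _ = F.refl
    rest : All (λ s → h (proj₂ s) F.≈ F.0#) (without α f)
    rest = All.map (λ u<α → evK-zero-on g (All.map (λ v≤β → indicator-≢ (·ₘ-<-≤-≢ u<α v≤β)) g≤)) (without-< α f f≤)

  coeff-+ : ∀ p q v → coeff (p ++ q) v F.≈ coeff p v F.+ coeff q v
  coeff-+ p q v = F.trans (coeff-evK (p ++ q) v) (F.trans (evK-++ _ p q)
    (F.+-cong (F.sym (coeff-evK p v)) (F.sym (coeff-evK q v))))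

  coeff-∷* : ∀ a u g f v → coeff (((a , u) ∷ g) *′ f) v F.≈ a F.* coeff (monomial u *′ f) v F.+ coeff (g *′ f) v
  coeff-∷* a u g f v = F.trans (coeff-evK (((a , u) ∷ g) *′ f) v) (F.trans (evK-* (indicator v) ((a , u) ∷ g) f)
    (F.+-cong (F.*-congˡ (F.sym (coeff-monomial* u f v)))
      (F.trans (F.sym (evK-* (indicator v) g f)) (F.sym (coeff-evK (g *′ f) v)))))

  ≃-leading : ∀ α f → f ≃ (((coeff f α , α) ∷ []) +′ without α f)
  ≃-leading α f = ≃-by-evK {f} {(coeff f α , α) ∷ without α f} (λ h → ev-without h α f)

  module _ {P₀ : Poly → Set (c ⊔ ℓ)} (P₀-prime : IsPrimeIdeal P₀) where
    open IsPrimeIdeal P₀-prime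

    private
      -- Classically this holds of 0 only, a proper ideal containing no unit. Using it in place of a
      -- ≈ 0 makes the disjunction in `prime` available for products of coefficients.
      p : F.Carrier → Set (c ⊔ ℓ)
      p a = P₀ (const a)
      module C = IsHom (const-hom m)

      p-resp : ∀ {a b} → a F.≈ b → p a → p b
      p-resp e = respects (C.φ-cong e)

      p-0 : p F.0#
      p-0 = respects (P.sym {const F.0#} {[]} C.φ-0) has-zero

      p-+ : ∀ {a b} → p a → p b → p (a F.+ b)
      p-+ {a} {b} x y = respects (P.sym {const (a F.+ b)} {const a +′ const b} (C.φ-+ a b)) (+-closed x y)

      p-* : ∀ a {b} → p b → p (a F.* b)
      p-* a {b} x = respects (P.sym {const (a F.* b)} {const a *′ const b} (C.φ-* a b)) (*-closed (const a) x)

    -- The prime ideal generated by the constants of P₀ and the variables outside Z.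
    face-prime : Subset m → Poly → Set (c ⊔ ℓ)
    face-prime Z f = ∀ v → SupportedIn v Z → p (coeff f v)

    module _ (Z : Subset m) where
      private
        PZ = face-prime Z

        PZ-resp : ∀ {f g} → f ≃ g → PZ f → PZ g
        PZ-resp e x v sv = p-resp (e v) (x v sv)

        PZ-+ : ∀ {f g} → PZ f → PZ g → PZ (f ++ g)
        PZ-+ {f} {g} x y v sv = p-resp (F.sym (coeff-+ f g v)) (p-+ (x v sv) (y v sv))

        PZ-* : ∀ g {f} → PZ f → PZ (g *′ f)
        PZ-* [] x v sv = p-0
        PZ-* ((a , u) ∷ g) {f} x v sv = p-resp (F.sym (coeff-∷* a u g f v)) (p-+ (p-* a shifted) (PZ-* g {f} x v sv))
          where
          shifted : p (coeff (monomial u *′ f) v)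
          shifted with u ∣ₘ? v
          ... | no nd = p-resp (F.sym (coeff-∤ u f nd)) p-0
          ... | yes (w , ≡.refl) = p-resp (F.sym (coeff-shift u f w)) (x w λ j e →
                  ℕₚ.m+n≡0⇒n≡0 (V.lookup u j) (≡.trans (≡.sym (lookup-· j u w)) (sv j e)))

        PZ-term : ∀ a α → (SupportedIn α Z → p a) → PZ ((a , α) ∷ [])
        PZ-term a α x v sv with Vₚ.≡-dec ℕ._≟_ α v
        ... | yes ≡.refl = p-resp (F.sym (F.+-identityʳ a)) (x sv)
        ... | no _ = p-0

        PZ-neg : ∀ {f} → PZ f → PZ (-′ f)
        PZ-neg {f} x = IsIdeal.-∈ ideal {f} x
          where
          ideal : IsIdeal PZ
          ideal = record { resp = λ {f} {g} → PZ-resp {f} {g} ; 0∈ = λ _ _ → p-0 ; +∈ = λ {f} {g} → PZ-+ {f} {g} ; *∈ = λ g {f} → PZ-* g {f} }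

        module _ (f g : Poly) (fg∈ : PZ (f *′ g)) (α : Mon m) (x : PZ ((coeff f α , α) ∷ [])) where
          private
            t f⁻ : Poly
            t = (coeff f α , α) ∷ []
            f⁻ = without α f

          drop-leading : PZ (f⁻ *′ g)
          drop-leading = PZ-resp {(f *′ g) +′ (-′ (t *′ g))} {f⁻ *′ g}
            (add-*-cancel f t f⁻ g (≃-leading α f))
            (PZ-+ {f *′ g} { -′ (t *′ g)} fg∈ (PZ-neg {t *′ g} (PZ-resp {g *′ t} {t *′ g} (P.*-comm g t) (PZ-* g {t} x))))

          restore-leading : PZ f⁻ → PZ f
          restore-leading y = PZ-resp {t ++ f⁻} {f} (P.sym {f} {t ++ f⁻} (≃-leading α f)) (PZ-+ {t} {f⁻} x y)

        -- If both leading monomials are supported in Z, the leading coefficient of f g lies in P₀,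
        -- hence so does that of f or g; if one of them is not, its term is in the ideal anyway. The
        -- term found is dropped and the induction goes on, with n bounding the total number of
        -- terms.
        PZ-prime : ∀ n f g → length f ℕ.+ length g ℕ.≤ n → PZ (f *′ g) → PZ f ⊎ PZ g
        PZ-prime n [] g le x = inj₁ (λ _ _ → p-0)
        PZ-prime n (t ∷ f) [] le x = inj₂ (λ _ _ → p-0)
        PZ-prime (suc n) f@(t ∷ f₀) g@(t′ ∷ g₀) le x = by (term-prime (supportedIn? α Z) (supportedIn? β Z))
          where
          lf = leading t f₀
          lg = leading t′ g₀
          α = proj₁ lf
          β = proj₁ lg

          term-prime : Dec (SupportedIn α Z) → Dec (SupportedIn β Z) →
            PZ ((coeff f α , α) ∷ []) ⊎ PZ ((coeff g β , β) ∷ [])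
          term-prime (no ns) _ = inj₁ (PZ-term (coeff f α) α (λ s → contradiction s ns))
          term-prime (yes _) (no ns) = inj₂ (PZ-term (coeff g β) β (λ s → contradiction s ns))
          term-prime (yes sα) (yes sβ) = Sum.map
            (λ y → PZ-term (coeff f α) α (λ _ → y)) (λ y → PZ-term (coeff g β) β (λ _ → y))
            (prime (const (coeff f α)) (const (coeff g β))
              (respects (C.φ-* (coeff f α) (coeff g β))
                (p-resp (coeff-leading α β f g (proj₂ (proj₂ lf)) (proj₂ (proj₂ lg)))
                  (x (α ·ₘ β) (λ j e → ≡.trans (lookup-· j α β) (≡.cong₂ ℕ._+_ (sα j e) (sβ j e)))))))

          gf∈ : PZ (g *′ f)
          gf∈ = PZ-resp {f *′ g} {g *′ f} (P.*-comm f g) x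

          by : PZ ((coeff f α , α) ∷ []) ⊎ PZ ((coeff g β , β) ∷ []) → PZ f ⊎ PZ g
          by (inj₁ y) = Sum.map (restore-leading f g x α y) (λ z → z) (PZ-prime n (without α f) g
            (ℕₚ.≤-pred (ℕₚ.≤-trans (ℕₚ.+-monoˡ-≤ (length g) (length-without-< α f (proj₁ (proj₂ lf)))) le))
            (drop-leading f g x α y))
          by (inj₂ y) = Sum.map (λ z → z) (restore-leading g f gf∈ β y) (PZ-prime n f (without β g)
            (ℕₚ.≤-pred (ℕₚ.≤-trans (ℕₚ.≤-reflexive (≡.sym (ℕₚ.+-suc (length f) (length (without β g)))))
              (ℕₚ.≤-trans (ℕₚ.+-monoʳ-≤ (length f) (length-without-< β g (proj₁ (proj₂ lg)))) le)))
            (PZ-resp {without β g *′ f} {f *′ without β g} (P.*-comm (without β g) f) (drop-leading g f gf∈ β y)))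

      face-prime-isPrime : IsPrimeIdeal PZ
      face-prime-isPrime = record
        { respects = λ {f} {g} → PZ-resp {f} {g}
        ; has-zero = λ _ _ → p-0
        ; +-closed = λ {f} {g} → PZ-+ {f} {g}
        ; *-closed = λ g {f} → PZ-* g {f}
        ; proper = λ x → proper (p-resp (coeff-monomial oneₘ) (x oneₘ (λ j _ → Vₚ.lookup-replicate j 0)))
        ; prime = λ f g → PZ-prime (length f ℕ.+ length g) f g ℕₚ.≤-refl
        }

      monomial∈face-prime : ∀ {w} → ¬ SupportedIn w Z → PZ (monomial w)
      monomial∈face-prime {w} ns = PZ-term F.1# w (λ s → contradiction s ns)

      monomial∉face-prime : ∀ {w} → SupportedIn w Z → ¬ PZ (monomial w)
      monomial∉face-prime {w} s x = proper (p-resp (coeff-monomial w) (x w s))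

  -- Z without its first t elements: the steps of a chain of faces in which one variable leaves at a
  -- time.
  shrink : ∀ {k} → ℕ → Subset k → Subset k
  shrink zero Z = Z
  shrink (suc t) [] = []
  shrink (suc t) (false ∷ Z) = false ∷ shrink (suc t) Z
  shrink (suc t) (true ∷ Z) = false ∷ shrink t Z

  shrink-suc : ∀ {k} t (Z : Subset k) j → V.lookup (shrink t Z) j ≡ false → V.lookup (shrink (suc t) Z) j ≡ false
  shrink-suc zero (false ∷ Z) Fin.zero e = ≡.refl
  shrink-suc zero (true ∷ Z) Fin.zero ()
  shrink-suc zero (false ∷ Z) (Fin.suc j) e = shrink-suc zero Z j e
  shrink-suc zero (true ∷ Z) (Fin.suc j) e = e
  shrink-suc (suc t) (false ∷ Z) Fin.zero e = ≡.refl
  shrink-suc (suc t) (true ∷ Z) Fin.zero e = ≡.refl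
  shrink-suc (suc t) (false ∷ Z) (Fin.suc j) e = shrink-suc (suc t) Z j e
  shrink-suc (suc t) (true ∷ Z) (Fin.suc j) e = shrink-suc t Z j e

  shrink-⊆ : ∀ {k} t (Z : Subset k) j → V.lookup Z j ≡ false → V.lookup (shrink t Z) j ≡ false
  shrink-⊆ zero Z j e = e
  shrink-⊆ (suc t) Z j e = shrink-suc t Z j (shrink-⊆ t Z j e)

  shrink-strict : ∀ {k} t (Z : Subset k) → t ℕ.< ∣ Z ∣ →
    ∃[ j ] (V.lookup (shrink t Z) j ≡ true × V.lookup (shrink (suc t) Z) j ≡ false)
  shrink-strict zero (false ∷ Z) lt with shrink-strict zero Z lt
  ... | j , e , e′ = Fin.suc j , e , e′
  shrink-strict zero (true ∷ Z) lt = Fin.zero , ≡.refl , ≡.refl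
  shrink-strict (suc t) (false ∷ Z) lt with shrink-strict (suc t) Z lt
  ... | j , e , e′ = Fin.suc j , e , e′
  shrink-strict (suc t) (true ∷ Z) (s≤s lt) with shrink-strict t Z lt
  ... | j , e , e′ = Fin.suc j , e , e′

  -- Each variable that leaves Z enters the prime and makes it strictly larger, which gives |Z|
  -- inclusions. All primes of the new chain have the constants of the bottom prime of the given
  -- one.
  face-chain : ∀ {s} (u : Fin s → Mon m) {e} → PrimeChain (monIdeal u) e →
    ∀ Z → (∀ k → ¬ SupportedIn (u k) Z) → PrimeChain (monIdeal u) ∣ Z ∣
  face-chain u chain Z face = record
    { P = λ i → face-prime P₀ (shrink (toℕ i) Z)
    ; isPrime = λ i → face-prime-isPrime P₀ (shrink (toℕ i) Z)
    ; contains = contains′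
    ; ascending = λ i f x v sv → ≡.subst (λ t → face-prime P₀ (shrink t Z) f) (Finₚ.toℕ-inject₁ i) x v
        (λ j e → sv j (shrink-suc (toℕ i) Z j e))
    ; strict = strict′
    }
    where
    P₀ = PrimeChain.isPrime chain Fin.zero
    contains′ : ∀ (i : Fin (suc ∣ Z ∣)) g → g ∈ₗ monIdeal u → face-prime P₀ (shrink (toℕ i) Z) g
    contains′ i g g∈ = All.lookup {P = face-prime P₀ (shrink (toℕ i) Z)} (Allₚ.map⁺ (All.tabulate (λ {k} _ → monomial∈face-prime P₀ (shrink (toℕ i) Z) {u k}
      (λ s → face k (λ j e → s j (shrink-⊆ (toℕ i) Z j e)))))) g∈

    supported : ∀ t j → V.lookup (shrink t Z) j ≡ true → SupportedIn (ε j) (shrink t Z)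
    supported t j e l l∉ = lookup-ε-≢ {j = j} {i = l} λ { ≡.refl → true≢false (≡.trans (≡.sym e) l∉) }
      where
      true≢false : ¬ (true ≡ false)
      true≢false ()

    new-variable : ∀ t → ∃[ j ] (V.lookup (shrink t Z) j ≡ true × V.lookup (shrink (suc t) Z) j ≡ false) →
      ∃[ f ] (face-prime P₀ (shrink (suc t) Z) f × ¬ face-prime P₀ (shrink t Z) f)
    new-variable t (j , e , e′) = monomial (ε j) ,
      monomial∈face-prime P₀ (shrink (suc t) Z) {ε j} (λ s → ℕₚ.1+n≢0 (≡.trans (≡.sym (lookup-ε-≡ j)) (s j e′))) ,
      monomial∉face-prime P₀ (shrink t Z) {ε j} (supported t j e)

    strict′ : ∀ (i : Fin ∣ Z ∣) → ∃[ f ] (face-prime P₀ (shrink (suc (toℕ i)) Z) f × ¬ face-prime P₀ (shrink (toℕ (Fin.inject₁ i)) Z) f)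
    strict′ i = ≡.subst (λ t → ∃[ f ] (face-prime P₀ (shrink (suc (toℕ i)) Z) f × ¬ face-prime P₀ (shrink t Z) f))
      (≡.sym (Finₚ.toℕ-inject₁ i)) (new-variable (toℕ i) (shrink-strict (toℕ i) Z (Finₚ.toℕ<n i)))

-- The Stanley decomposition of the polarization

lookup-injective : ∀ {A : Set} {xs : List A} → Unique xs → ∀ i j → L.lookup xs i ≡ L.lookup xs j → i ≡ j
lookup-injective (x≢ ∷ un) Fin.zero Fin.zero e = ≡.refl
lookup-injective {xs = x ∷ xs} (x≢ ∷ un) Fin.zero (Fin.suc j) e = contradiction e (All.lookup x≢ (∈-lookup j))
lookup-injective {xs = x ∷ xs} (x≢ ∷ un) (Fin.suc i) Fin.zero e = contradiction (≡.sym e) (All.lookup x≢ (∈-lookup i))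
lookup-injective (x≢ ∷ un) (Fin.suc i) (Fin.suc j) e = ≡.cong Fin.suc (lookup-injective un i j e)

bit : ℕ → ℕ → ℕ
bit a j = if j ℕ.<ᵇ a then 1 else 0

bit-< : ∀ {a j} → j ℕ.< a → bit a j ≡ 1
bit-< {a} {j} lt with j ℕ.<ᵇ a | ℕₚ.<⇒<ᵇ lt
... | true | _ = ≡.refl

bit-≥ : ∀ {a j} → ¬ j ℕ.< a → bit a j ≡ 0
bit-≥ {a} {j} nlt with j ℕ.<ᵇ a in eq
... | false = ≡.refl
... | true = contradiction (ℕₚ.<ᵇ⇒< j a (Equivalence.from T-≡ eq)) nlt

bit-1 : ∀ {a j} → bit a j ≡ 1 → j ℕ.< a
bit-1 {a} {j} e with j ℕ.<? a
... | yes lt = lt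
... | no nlt with ≡.trans (≡.sym e) (bit-≥ nlt)
...   | ()

-- x_{ij} is the variable of T in row i and column j - 1.
row : ∀ {n} (r : Fin n → ℕ) → Fin (blocks n r) → Fin n
row {suc n} r q with Fin.splitAt (r Fin.zero) q
... | inj₁ j = Fin.zero
... | inj₂ q′ = Fin.suc (row (r ∘ Fin.suc) q′)

col : ∀ {n} (r : Fin n → ℕ) → Fin (blocks n r) → ℕ
col {suc n} r q with Fin.splitAt (r Fin.zero) q
... | inj₁ j = toℕ j
... | inj₂ q′ = col (r ∘ Fin.suc) q′

row-↑ˡ : ∀ {n} (r : Fin (suc n) → ℕ) j → row r (j ↑ˡ blocks n (r ∘ Fin.suc)) ≡ Fin.zero
row-↑ˡ {n} r j rewrite Finₚ.splitAt-↑ˡ (r Fin.zero) j (blocks n (r ∘ Fin.suc)) = ≡.refl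

col-↑ˡ : ∀ {n} (r : Fin (suc n) → ℕ) j → col r (j ↑ˡ blocks n (r ∘ Fin.suc)) ≡ toℕ j
col-↑ˡ {n} r j rewrite Finₚ.splitAt-↑ˡ (r Fin.zero) j (blocks n (r ∘ Fin.suc)) = ≡.refl

row-↑ʳ : ∀ {n} (r : Fin (suc n) → ℕ) q → row r (r Fin.zero ↑ʳ q) ≡ Fin.suc (row (r ∘ Fin.suc) q)
row-↑ʳ {n} r q rewrite Finₚ.splitAt-↑ʳ (r Fin.zero) (blocks n (r ∘ Fin.suc)) q = ≡.refl

col-↑ʳ : ∀ {n} (r : Fin (suc n) → ℕ) q → col r (r Fin.zero ↑ʳ q) ≡ col (r ∘ Fin.suc) q
col-↑ʳ {n} r q rewrite Finₚ.splitAt-↑ʳ (r Fin.zero) (blocks n (r ∘ Fin.suc)) q = ≡.refl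

lookup-polarize : ∀ {n} (r : Fin n → ℕ) (u : Mon n) q →
  V.lookup (polarize r u) q ≡ bit (V.lookup u (row r q)) (col r q)
lookup-polarize {suc n} r (a ∷ u) q
  rewrite Vₚ.lookup-splitAt (r Fin.zero) (block (r Fin.zero) a) (polarize (r ∘ Fin.suc) u) q
  with Fin.splitAt (r Fin.zero) q
... | inj₁ j = Vₚ.lookup∘tabulate _ j
... | inj₂ q′ = lookup-polarize (r ∘ Fin.suc) u q′

position : ∀ {n} (r : Fin n → ℕ) i {j} → j ℕ.< r i → ∃[ q ] (row r q ≡ i × col r q ≡ j)
position {suc n} r Fin.zero lt = Fin.fromℕ< lt ↑ˡ _ , row-↑ˡ r _ , ≡.trans (col-↑ˡ r _) (Finₚ.toℕ-fromℕ< lt)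
position {suc n} r (Fin.suc i) lt with position (r ∘ Fin.suc) i lt
... | q , e , e′ = r Fin.zero ↑ʳ q , ≡.trans (row-↑ʳ r q) (≡.cong Fin.suc e) , ≡.trans (col-↑ʳ r q) e′

col-< : ∀ {n} (r : Fin n → ℕ) q → col r q ℕ.< r (row r q)
col-< {suc n} r q with Fin.splitAt (r Fin.zero) q
... | inj₁ j = Finₚ.toℕ<n j
... | inj₂ q′ = col-< (r ∘ Fin.suc) q′

row-col-injective : ∀ {n} (r : Fin n → ℕ) {q q′} → row r q ≡ row r q′ → col r q ≡ col r q′ → q ≡ q′
row-col-injective {suc n} r {q} {q′} e e′
  with Fin.splitAt (r Fin.zero) q in eq | Fin.splitAt (r Fin.zero) q′ in eq′
... | inj₁ j | inj₁ j′ = ≡.trans (≡.sym (Finₚ.splitAt⁻¹-↑ˡ eq))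
        (≡.trans (≡.cong (_↑ˡ _) (Finₚ.toℕ-injective e′)) (Finₚ.splitAt⁻¹-↑ˡ eq′))
... | inj₂ p | inj₂ p′ = ≡.trans (≡.sym (Finₚ.splitAt⁻¹-↑ʳ eq))
        (≡.trans (≡.cong (r Fin.zero ↑ʳ_) (row-col-injective (r ∘ Fin.suc) (Finₚ.suc-injective e) e′)) (Finₚ.splitAt⁻¹-↑ʳ eq′))
... | inj₁ _ | inj₂ _ with e
...   | ()
row-col-injective {suc n} r {q} {q′} e e′ | inj₂ _ | inj₁ _ with e
...   | ()

col-mono : ∀ {n} (r : Fin n → ℕ) {q q′} → toℕ q ℕ.< toℕ q′ → row r q ≡ row r q′ → col r q ℕ.< col r q′
col-mono {suc n} r {q} {q′} lt e
  with Fin.splitAt (r Fin.zero) q in eq | Fin.splitAt (r Fin.zero) q′ in eq′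
... | inj₁ j | inj₁ j′ = ≡.subst₂ ℕ._<_
        (≡.trans (≡.cong toℕ (≡.sym (Finₚ.splitAt⁻¹-↑ˡ eq))) (Finₚ.toℕ-↑ˡ j _))
        (≡.trans (≡.cong toℕ (≡.sym (Finₚ.splitAt⁻¹-↑ˡ eq′))) (Finₚ.toℕ-↑ˡ j′ _)) lt
... | inj₂ p | inj₂ p′ = col-mono (r ∘ Fin.suc) (ℕₚ.+-cancelˡ-< (r Fin.zero) _ _ (≡.subst₂ ℕ._<_
        (≡.trans (≡.cong toℕ (≡.sym (Finₚ.splitAt⁻¹-↑ʳ eq))) (Finₚ.toℕ-↑ʳ (r Fin.zero) p))
        (≡.trans (≡.cong toℕ (≡.sym (Finₚ.splitAt⁻¹-↑ʳ eq′))) (Finₚ.toℕ-↑ʳ (r Fin.zero) p′)) lt)) (Finₚ.suc-injective e)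
... | inj₁ _ | inj₂ _ with e
...   | ()
col-mono {suc n} r {q} {q′} lt e | inj₂ _ | inj₁ _ with e
...   | ()

sumF-++ : ∀ a {b} (f : Fin (a ℕ.+ b) → ℕ) → sumF f ≡ sumF (λ j → f (j ↑ˡ b)) ℕ.+ sumF (λ q → f (a ↑ʳ q))
sumF-++ zero f = ≡.refl
sumF-++ (suc a) f = ≡.trans (≡.cong (f Fin.zero ℕ.+_) (sumF-++ a (f ∘ Fin.suc))) (≡.sym (ℕₚ.+-assoc (f Fin.zero) _ _))

sum-bit : ∀ {k a} → a ℕ.≤ k → sumF {k} (λ j → bit a (toℕ j)) ≡ a
sum-bit {zero} z≤n = ≡.refl
sum-bit {suc k} {zero} z≤n = sumF-zero {suc k} (λ _ → ≡.refl)
sum-bit {suc k} {suc a} (s≤s le) = ≡.cong suc (sum-bit le)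

row-total : ∀ {n} (r : Fin n → ℕ) i {a} → a ℕ.≤ r i →
  sumF (λ q → if ⌊ row r q Fin.≟ i ⌋ then bit a (col r q) else 0) ≡ a
row-total {suc n} r Fin.zero {a} le = ≡.trans (sumF-++ (r Fin.zero) _) (≡.trans (≡.cong₂ ℕ._+_
  (≡.trans (sumF-cong own) (sum-bit le)) (sumF-zero other)) (ℕₚ.+-identityʳ a))
  where
  own : ∀ j → (if ⌊ row r (j ↑ˡ blocks n (r ∘ Fin.suc)) Fin.≟ Fin.zero ⌋ then bit a (col r (j ↑ˡ blocks n (r ∘ Fin.suc))) else 0) ≡ bit a (toℕ j)
  own j rewrite row-↑ˡ r j | col-↑ˡ r j = ≡.refl
  other : ∀ q → (if ⌊ row r (r Fin.zero ↑ʳ q) Fin.≟ Fin.zero ⌋ then bit a (col r (r Fin.zero ↑ʳ q)) else 0) ≡ 0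
  other q rewrite row-↑ʳ r q = ≡.refl
row-total {suc n} r (Fin.suc i) {a} le = ≡.trans (sumF-++ (r Fin.zero) _) (≡.cong₂ ℕ._+_
  (sumF-zero other) (≡.trans (sumF-cong own) (row-total (r ∘ Fin.suc) i le)))
  where
  other : ∀ j → (if ⌊ row r (j ↑ˡ blocks n (r ∘ Fin.suc)) Fin.≟ Fin.suc i ⌋ then bit a (col r (j ↑ˡ blocks n (r ∘ Fin.suc))) else 0) ≡ 0
  other j rewrite row-↑ˡ r j = ≡.refl
  own : ∀ q → (if ⌊ row r (r Fin.zero ↑ʳ q) Fin.≟ Fin.suc i ⌋ then bit a (col r (r Fin.zero ↑ʳ q)) else 0) ≡
    (if ⌊ row (r ∘ Fin.suc) q Fin.≟ i ⌋ then bit a (col (r ∘ Fin.suc) q) else 0)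
  own q rewrite row-↑ʳ r q | col-↑ʳ r q with row (r ∘ Fin.suc) q Fin.≟ i
  ... | yes _ = ≡.refl
  ... | no _ = ≡.refl

≤-polR : ∀ {n s} (u : Fin s → Mon n) k i → V.lookup (u k) i ℕ.≤ polR u i
≤-polR {s = s} u k i = ≡.subst (ℕ._≤ polR u i)
  (≡.trans (Vₚ.lookup-map k _ (V.allFin s)) (≡.cong (λ k → V.lookup (u k) i) (Vₚ.lookup-allFin k)))
  (below-max (V.map (λ k → V.lookup (u k) i) (V.allFin s)) k)
  where
  below-max : ∀ {s} (v : Vec ℕ s) k → V.lookup v k ℕ.≤ V.foldr (λ _ → ℕ) (λ a b → a ℕ.⊔ b) 0 v
  below-max (a ∷ v) Fin.zero = ℕₚ.m≤m⊔n a _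
  below-max (a ∷ v) (Fin.suc k) = ℕₚ.≤-trans (below-max v k) (ℕₚ.m≤n⊔m a _)

-- The head of A is matched with its image, which is then removed from B. The map takes the
-- membership proof because in one application its value is a witness extracted from that proof.
card-injective : ∀ {a b} (A : Subset a) (B : Subset b) (f : ∀ i → i ∈ A → Fin b) →
  (∀ i i∈ → f i i∈ ∈ B) → (∀ i j i∈ j∈ → f i i∈ ≡ f j j∈ → i ≡ j) → ∣ A ∣ ℕ.≤ ∣ B ∣
card-injective [] B f f∈ inj = z≤n
card-injective (outside ∷ A) B f f∈ inj = card-injective A B (λ i i∈ → f (Fin.suc i) (V.there i∈))
  (λ i i∈ → f∈ _ _) (λ i j i∈ j∈ e → Finₚ.suc-injective (inj _ _ _ _ e))
card-injective (inside ∷ A) B f f∈ inj = ℕₚ.≤-<-trans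
  (card-injective A (B Subset.- f Fin.zero V.here) (λ i i∈ → f (Fin.suc i) (V.there i∈))
    (λ i i∈ → Subsetₚ.x∈p∧x≢y⇒x∈p-y (f∈ _ _) (λ e → Finₚ.0≢1+n (≡.sym (inj _ _ _ _ e))))
    (λ i j i∈ j∈ e → Finₚ.suc-injective (inj _ _ _ _ e)))
  (Subsetₚ.x∈p⇒∣p-x∣<∣p∣ (f∈ Fin.zero V.here))

prefix : ∀ {P : ℕ → Set} → (∀ j → Dec (P j)) → ∀ b →
  ∃[ e ] (e ℕ.≤ b × (∀ {j} → j ℕ.< e → P j) × (e ℕ.< b → ¬ P e))
prefix P? zero = 0 , z≤n , (λ ()) , (λ ())
prefix P? (suc b) with prefix P? b
... | e , le , pre , stop with ℕₚ.m≤n⇒m<n∨m≡n le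
...   | inj₁ lt = e , ℕₚ.m≤n⇒m≤1+n le , pre , (λ _ → stop lt)
...   | inj₂ ≡.refl with P? b
...     | yes p = suc b , ℕₚ.≤-refl , (λ {j} lt → at lt) , (λ lt → contradiction lt (ℕₚ.n≮n _))
  where
  at : ∀ {j} → j ℕ.< suc b → _
  at (s≤s le) with ℕₚ.m≤n⇒m<n∨m≡n le
  ... | inj₁ lt = pre lt
  ... | inj₂ ≡.refl = p
...     | no np = b , ℕₚ.n≤1+n b , pre , (λ _ → np)

module MonomialMembership {c ℓ} (F : Field c ℓ) (m : ℕ) where
  open Polynomials F
  open Linear m
  open MonomialIdeals m
  open MonomialNZD F m
  private
    module F = Field F
    module P = CommutativeRing (polyRing m)
    open PolyRing F m

  monIdeal⊆multiples : ∀ {s} (u : Fin s → Mon m) → ⟨ monIdeal u ⟩ ⊆ᵢ MI (Multiple u)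
  monIdeal⊆multiples u {f} = ⟨⟩-elim (multiple-ideal u) (monIdeal u)
    (Allₚ.map⁺ (All.tabulate (λ {k} _ → MI-monomial (k , oneₘ , ·ₘ-identityʳ (u k))))) {f}

  multiple⇒∈ : ∀ {s} (u : Fin s → Mon m) {w} → Multiple u w → monomial w ∈⟨ monIdeal u ⟩
  multiple⇒∈ u (k , v , ≡.refl) = resp {monomial (u k) P.* monomial v} {monomial (u k ·ₘ v)}
    (P.sym {monomial (u k ·ₘ v)} {monomial (u k) P.* monomial v} (monomial-· (u k) v))
    (*∈ʳ (monomial v) {monomial (u k)} (⟨⟩-gen (∈-map⁺ (λ k → monomial (u k)) (∈-toList⁺ (∈ᵥ-allFin k)))))
    where open IsIdeal (⟨⟩-ideal (monIdeal u))

  ∈⇒multiple : ∀ {s} (u : Fin s → Mon m) {w} → monomial w ∈⟨ monIdeal u ⟩ → Multiple u w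
  ∈⇒multiple u {w} p with multiple? u w
  ... | yes d = d
  ... | no nd = contradiction (F.trans (F.sym (coeff-monomial w)) (lower (monIdeal⊆multiples u {monomial w} p w nd))) F.1≉0

module Runs {n : ℕ} (r : Fin n → ℕ) where

  N : ℕ
  N = blocks n r

  Occurs : Mon N → Fin n → ℕ → Set
  Occurs w i j = ∃[ q ] (row r q ≡ i × col r q ≡ j × 1 ℕ.≤ V.lookup w q)

  occurs? : ∀ w i j → Dec (Occurs w i j)
  occurs? w i j = Finₚ.any? (λ q → (row r q Fin.≟ i) ×-dec (col r q ℕ.≟ j) ×-dec (1 ℕ.≤? V.lookup w q))

  run : Mon N → Fin n → ℕ
  run w i = proj₁ (prefix (occurs? w i) (r i))

  runs : Mon N → Mon n
  runs w = V.tabulate (run w)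

  lookup-runs : ∀ w i → V.lookup (runs w) i ≡ run w i
  lookup-runs w i = Vₚ.lookup∘tabulate (run w) i

  run-≤ : ∀ w i → run w i ℕ.≤ r i
  run-≤ w i = proj₁ (proj₂ (prefix (occurs? w i) (r i)))

  run-occurs : ∀ w i {j} → j ℕ.< run w i → Occurs w i j
  run-occurs w i = proj₁ (proj₂ (proj₂ (prefix (occurs? w i) (r i))))

  run-stop : ∀ w i → run w i ℕ.< r i → ¬ Occurs w i (run w i)
  run-stop w i = proj₂ (proj₂ (proj₂ (prefix (occurs? w i) (r i))))

  occurs-at : ∀ w q → Occurs w (row r q) (col r q) → 1 ℕ.≤ V.lookup w q
  occurs-at w q (q′ , e , e′ , le) = ≡.subst (λ q → 1 ℕ.≤ V.lookup w q) (row-col-injective r e e′) le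

  -- Together with the converse below this is an adjunction: v^p divides w exactly when v divides
  -- x^e(w). Hence e pulls I back to I^p.
  ≤runs⇒polarize∣ : ∀ v w → (∀ i → V.lookup v i ℕ.≤ run w i) → polarize r v ∣ₘ w
  ≤runs⇒polarize∣ v w le = ≤⇒∣ₘ at
    where
    at : ∀ q → V.lookup (polarize r v) q ℕ.≤ V.lookup w q
    at q rewrite lookup-polarize r v q with col r q ℕ.<? V.lookup v (row r q)
    ... | yes lt rewrite bit-< lt = occurs-at w q (run-occurs w (row r q) (ℕₚ.<-≤-trans lt (le (row r q))))
    ... | no nlt rewrite bit-≥ nlt = z≤n

  -- The bound by r is essential: `polarize r` cuts larger exponents off at the length of the row,
  -- so the divisibility would not see them.
  polarize∣⇒≤runs : ∀ v w → (∀ i → V.lookup v i ℕ.≤ r i) → polarize r v ∣ₘ w → ∀ i → V.lookup v i ℕ.≤ run w i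
  polarize∣⇒≤runs v w v≤r d i with ℕₚ.≤-<-connex (V.lookup v i) (run w i)
  ... | inj₁ le = le
  ... | inj₂ gt with position r i (ℕₚ.<-≤-trans gt (v≤r i))
  ...   | q , ≡.refl , e = contradiction (q , ≡.refl , e , 1≤) (run-stop w i (ℕₚ.<-≤-trans gt (v≤r i)))
    where
    1≤ : 1 ℕ.≤ V.lookup w q
    1≤ = ≡.subst (ℕ._≤ V.lookup w q) (≡.trans (lookup-polarize r v q)
      (bit-< (≡.subst (ℕ._< V.lookup v i) (≡.sym e) gt))) (∣ₘ⇒≤ d q)

module PolarizedStanley {c ℓ} (F : Field c ℓ) {n s : ℕ} (u : Fin s → Mon n) {d : ℕ}
  (SD : PolyRing.StanleyDecomposition F n (PolyRing.monIdeal F n u) d) where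

  private
    r = polR u
    module S = MonomialMembership F n
    module T′ = MonomialMembership F (polVars u)
    module SD = PolyRing.StanleyDecomposition SD
  open Runs r

  Bounded : Fin SD.k → Set
  Bounded t = ∀ i → V.lookup (SD.u t) i ℕ.≤ r i

  bounded? : Decidable Bounded
  bounded? t = Finₚ.all? (λ i → V.lookup (SD.u t) i ℕ.≤? r i)

  -- A Stanley space whose `u` exceeds r in some row contains no x^e(w), since e(w) is bounded by r.
  -- Its preimage is empty, while its polarization would be cut off, so it has to be discarded.
  kept : List (Fin SD.k)
  kept = L.filter bounded? (L.allFin SD.k)

  kept-unique : Unique kept
  kept-unique = Uniqueₚ.filter⁺ bounded? (Uniqueₚ.allFin⁺ SD.k)

  kept-bounded : ∀ t → Bounded (L.lookup kept t)
  kept-bounded t = proj₂ (∈-filter⁻ bounded? {xs = L.allFin SD.k} (∈-lookup t))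

  -- Columns are counted from 0, so the omitted variable x_{i,a_i+1} is the one in column a_i. If
  -- a_i fills the whole row, there is no such variable and row i omits nothing.
  W : Fin SD.k → Subset N
  W t = V.tabulate (λ q → if V.lookup (SD.Z t) (row r q) then true else not ⌊ col r q ℕ.≟ V.lookup (SD.u t) (row r q) ⌋)

  W-outside : ∀ t q → V.lookup (SD.Z t) (row r q) ≡ false → col r q ≡ V.lookup (SD.u t) (row r q) → V.lookup (W t) q ≡ false
  W-outside t q e e′ rewrite Vₚ.lookup∘tabulate (λ q → if V.lookup (SD.Z t) (row r q) then true else not ⌊ col r q ℕ.≟ V.lookup (SD.u t) (row r q) ⌋) q | e
    with col r q ℕ.≟ V.lookup (SD.u t) (row r q)
  ... | yes _ = ≡.refl
  ... | no ne = contradiction e′ ne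

  outside-W : ∀ t q → V.lookup (W t) q ≡ false → V.lookup (SD.Z t) (row r q) ≡ false × col r q ≡ V.lookup (SD.u t) (row r q)
  outside-W t q e rewrite Vₚ.lookup∘tabulate (λ q → if V.lookup (SD.Z t) (row r q) then true else not ⌊ col r q ℕ.≟ V.lookup (SD.u t) (row r q) ⌋) q
    with V.lookup (SD.Z t) (row r q) | col r q ℕ.≟ V.lookup (SD.u t) (row r q)
  ... | false | yes e′ = ≡.refl , e′
  outside-W t q () | false | no _
  outside-W t q () | true | _

  -- In a row i outside Z_t the variable in column a_i occurs neither in u_t^p nor in v, so the run
  -- stops exactly at a_i; in the other rows it may go on.
  runs-in : ∀ t → Bounded t → ∀ v → SupportedIn v (W t) →
    ∃[ v′ ] (SupportedIn v′ (SD.Z t) × SD.u t ·ₘ v′ ≡ runs (polarize r (SD.u t) ·ₘ v))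
  runs-in t bd v sv with ≤⇒∣ₘ {u = SD.u t} {w = runs w} (λ i → ≡.subst (V.lookup (SD.u t) i ℕ.≤_) (≡.sym (lookup-runs w i)) (u≤ i))
    where
    w = polarize r (SD.u t) ·ₘ v
    u≤ : ∀ i → V.lookup (SD.u t) i ℕ.≤ run w i
    u≤ = polarize∣⇒≤runs (SD.u t) w bd (v , ≡.refl)
  ... | v′ , e = v′ , supported , e
    where
    w = polarize r (SD.u t) ·ₘ v
    supported : SupportedIn v′ (SD.Z t)
    supported i i∉ with V.lookup v′ i in ev
    ... | zero = ≡.refl
    ... | suc a with position r i u<r | run-occurs w i u<run
      where
      u<run : V.lookup (SD.u t) i ℕ.< run w i
      u<run = ≡.subst (V.lookup (SD.u t) i ℕ.<_) (≡.trans (≡.cong (λ w → V.lookup w i) e) (lookup-runs w i))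
        (≡.subst (V.lookup (SD.u t) i ℕ.<_) (≡.sym (≡.trans (lookup-· i (SD.u t) v′) (≡.cong (V.lookup (SD.u t) i ℕ.+_) ev)))
          (ℕₚ.m<m+n _ (s≤s z≤n)))
      u<r : V.lookup (SD.u t) i ℕ.< r i
      u<r = ℕₚ.<-≤-trans u<run (run-≤ w i)
    ...   | q , ≡.refl , eq | oc = contradiction wq≡0 (ℕₚ.>⇒≢ (occurs-at w q (≡.subst (Occurs w (row r q)) (≡.sym eq) oc)))
      where
      wq≡0 : V.lookup w q ≡ 0
      wq≡0 = ≡.trans (lookup-· q (polarize r (SD.u t)) v) (≡.cong₂ ℕ._+_
        (≡.trans (lookup-polarize r (SD.u t) q) (bit-≥ (λ lt → ℕₚ.<⇒≢ lt eq)))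
        (sv q (W-outside t q i∉ eq)))

  runs-∉ : ∀ w → ¬ Multiple (polGens u) w → ¬ Multiple u (runs w)
  runs-∉ w nd (k , dv) = nd (k , ≤runs⇒polarize∣ (u k) w (λ i → ≡.subst (V.lookup (u k) i ℕ.≤_) (lookup-runs w i) (∣ₘ⇒≤ dv i)))

  ∉-runs : ∀ w → ¬ Multiple u (runs w) → ¬ Multiple (polGens u) w
  ∉-runs w nd (k , dv) = nd (k , ≤⇒∣ₘ (λ i → ≡.subst (V.lookup (u k) i ℕ.≤_) (≡.sym (lookup-runs w i))
    (polarize∣⇒≤runs (u k) w (≤-polR u k) dv i)))

  decomposition : PolyRing.StanleyDecomposition F (polVars u) (PolyRing.monIdeal F (polVars u) (polGens u)) (polVars u ℕ.∸ (n ℕ.∸ d))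
  decomposition = record
    { k = length kept
    ; u = λ t → polarize r (SD.u (L.lookup kept t))
    ; Z = λ t → W (L.lookup kept t)
    ; free = free
    ; cover = cover
    ; disjoint = disjoint
    ; large = large
    }
    where
    free : ∀ t v → SupportedIn v (W (L.lookup kept t)) →
      ¬ PolyRing._∈⟨_⟩ F N (PolyRing.monomial F N (polarize r (SD.u (L.lookup kept t)) ·ₘ v)) (PolyRing.monIdeal F N (polGens u))
    free t v sv p = from-runs (runs-in (L.lookup kept t) (kept-bounded t) v sv)
      where
      w : Mon N
      w = polarize r (SD.u (L.lookup kept t)) ·ₘ v
      from-runs : ¬ (∃[ v′ ] (SupportedIn v′ (SD.Z (L.lookup kept t)) × SD.u (L.lookup kept t) ·ₘ v′ ≡ runs w))
      from-runs (v′ , sv′ , e) = ∉-runs w (λ dv → SD.free (L.lookup kept t) v′ sv′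
        (S.multiple⇒∈ u {SD.u (L.lookup kept t) ·ₘ v′} (≡.subst (Multiple u) (≡.sym e) dv))) (T′.∈⇒multiple (polGens u) {w} p)

    module Cover (w : Mon N) (t : Fin SD.k) (v : Mon n) (sv : SupportedIn v (SD.Z t)) (e : SD.u t ·ₘ v ≡ runs w) where
      u≤run : ∀ i → V.lookup (SD.u t) i ℕ.≤ run w i
      u≤run i = ≡.subst (V.lookup (SD.u t) i ℕ.≤_) (lookup-runs w i) (∣ₘ⇒≤ (v , e) i)

      t∈ : t ∈ₗ kept
      t∈ = ∈-filter⁺ bounded? (∈-allFin t) (λ i → ℕₚ.≤-trans (u≤run i) (run-≤ w i))

      quotient : polarize r (SD.u t) ∣ₘ w
      quotient = ≤runs⇒polarize∣ (SD.u t) w u≤run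

      v′ : Mon N
      v′ = proj₁ quotient

      run≡ : ∀ i → V.lookup (SD.Z t) i ≡ false → run w i ≡ V.lookup (SD.u t) i
      run≡ i i∉ = ≡.trans (≡.sym (lookup-runs w i)) (≡.trans (≡.cong (λ w → V.lookup w i) (≡.sym e))
        (≡.trans (lookup-· i (SD.u t) v) (≡.trans (≡.cong (V.lookup (SD.u t) i ℕ.+_) (sv i i∉)) (ℕₚ.+-identityʳ _))))

      supported : SupportedIn v′ (W t)
      -- Outside `W t` the column of q is the place where the run of w in this row stops, and there
      -- w has exponent 0.
      supported q q∉ = ℕₚ.n≤0⇒n≡0 (ℕₚ.≮⇒≥ λ 0<v′ →
        run-stop w (row r q) (≡.subst (ℕ._< r (row r q)) col≡ (col-< r q))
          (q , ≡.refl , col≡ , ℕₚ.≤-trans 0<v′ v′≤w))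
        where
        col≡ : col r q ≡ run w (row r q)
        col≡ = ≡.trans (proj₂ (outside-W t q q∉)) (≡.sym (run≡ (row r q) (proj₁ (outside-W t q q∉))))
        v′≤w : V.lookup v′ q ℕ.≤ V.lookup w q
        v′≤w = ≡.subst (V.lookup v′ q ℕ.≤_) (≡.trans (≡.sym (lookup-· q (polarize r (SD.u t)) v′))
          (≡.cong (λ w → V.lookup w q) (proj₂ quotient))) (ℕₚ.m≤n+m _ _)

      covered : ∃[ t ] ∃[ v ] (SupportedIn v (W (L.lookup kept t)) × polarize r (SD.u (L.lookup kept t)) ·ₘ v ≡ w)
      covered = index t∈ , v′ ,
        ≡.subst (λ t → SupportedIn v′ (W t)) (Anyₚ.lookup-index t∈) supported ,
        ≡.subst (λ t → polarize r (SD.u t) ·ₘ v′ ≡ w) (Anyₚ.lookup-index t∈) (proj₂ quotient)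

    cover : ∀ w → ¬ PolyRing._∈⟨_⟩ F N (PolyRing.monomial F N w) (PolyRing.monIdeal F N (polGens u)) →
      ∃[ t ] ∃[ v ] (SupportedIn v (W (L.lookup kept t)) × polarize r (SD.u (L.lookup kept t)) ·ₘ v ≡ w)
    cover w w∉ = from-cover (SD.cover (runs w)
        (λ p → runs-∉ w (λ dv → w∉ (T′.multiple⇒∈ (polGens u) {w} dv)) (S.∈⇒multiple u {runs w} p)))
      where
      from-cover : ∃[ t ] ∃[ v ] (SupportedIn v (SD.Z t) × SD.u t ·ₘ v ≡ runs w) →
        ∃[ t ] ∃[ v ] (SupportedIn v (W (L.lookup kept t)) × polarize r (SD.u (L.lookup kept t)) ·ₘ v ≡ w)
      from-cover (t , v , sv , e) = Cover.covered w t v sv e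

    disjoint : ∀ t t′ v v′ → SupportedIn v (W (L.lookup kept t)) → SupportedIn v′ (W (L.lookup kept t′)) →
      polarize r (SD.u (L.lookup kept t)) ·ₘ v ≡ polarize r (SD.u (L.lookup kept t′)) ·ₘ v′ → t ≡ t′ × v ≡ v′
    disjoint t t′ v v′ sv sv′ e = t≡t′ , same t≡t′ e
      where
      a = runs-in (L.lookup kept t) (kept-bounded t) v sv
      a′ = runs-in (L.lookup kept t′) (kept-bounded t′) v′ sv′
      t≡t′ : t ≡ t′
      -- Both spaces contain the same x^e(w), so the original disjointness identifies them; `kept`
      -- has no repetitions, hence the positions agree too.
      t≡t′ = lookup-injective kept-unique t t′
        (proj₁ (SD.disjoint _ _ (proj₁ a) (proj₁ a′) (proj₁ (proj₂ a)) (proj₁ (proj₂ a′))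
          (≡.trans (proj₂ (proj₂ a)) (≡.trans (≡.cong runs e) (≡.sym (proj₂ (proj₂ a′)))))))
      same : ∀ {t t′} → t ≡ t′ →
        polarize r (SD.u (L.lookup kept t)) ·ₘ v ≡ polarize r (SD.u (L.lookup kept t′)) ·ₘ v′ → v ≡ v′
      same ≡.refl e = ·ₘ-cancelˡ _ e

    large : ∀ t → polVars u ℕ.∸ (n ℕ.∸ d) ℕ.≤ ∣ W (L.lookup kept t) ∣
    large t′ = ℕₚ.m≤n+o⇒m∸n≤o _ (n ℕ.∸ d) (ℕₚ.≤-trans (ℕₚ.m≤n+m∸n N ∣ W t ∣)
      (ℕₚ.≤-trans (ℕₚ.≤-reflexive (ℕₚ.+-comm ∣ W t ∣ _)) (ℕₚ.+-monoˡ-≤ ∣ W t ∣ outside-count)))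
      where
      t = L.lookup kept t′
      ∁-outside : ∀ {k} (A : Subset k) {x} → x ∈ ∁ A → V.lookup A x ≡ false
      ∁-outside A {x} x∈ with V.lookup A x in e
      ... | false = ≡.refl
      ... | true = contradiction (Vₚ.lookup⇒[]= x A e) (Subsetₚ.x∈∁p⇒x∉p x∈)
      outside-∁ : ∀ {k} (A : Subset k) {x} → V.lookup A x ≡ false → x ∈ ∁ A
      outside-∁ A {x} e = Subsetₚ.x∉p⇒x∈∁p λ x∈ → case (≡.trans (≡.sym e) (Vₚ.[]=⇒lookup x∈))
        where
        case : false ≡ true → _
        case ()
      outside-count : N ℕ.∸ ∣ W t ∣ ℕ.≤ n ℕ.∸ d
      -- Taking the row is injective on the omitted variables: two of them in the same row i would
      -- both lie in column a_i.
      outside-count = ℕₚ.≤-trans (ℕₚ.≤-reflexive (≡.sym (Subsetₚ.∣∁p∣≡n∸∣p∣ (W t)))) (ℕₚ.≤-trans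
        (card-injective (∁ (W t)) (∁ (SD.Z t)) (λ q _ → row r q)
          (λ q q∈ → outside-∁ (SD.Z t) (proj₁ (outside-W t q (∁-outside (W t) q∈))))
          (λ q q′ q∈ q′∈ e → row-col-injective r e (≡.trans (proj₂ (outside-W t q (∁-outside (W t) q∈)))
            (≡.trans (≡.cong (V.lookup (SD.u t)) e) (≡.sym (proj₂ (outside-W t q′ (∁-outside (W t) q′∈))))))))
        (ℕₚ.≤-trans (ℕₚ.≤-reflexive (Subsetₚ.∣∁p∣≡n∸∣p∣ (SD.Z t))) (ℕₚ.∸-monoʳ-≤ n (SD.large t))))

-- Truncation by degree

degree : ∀ {m} → Mon m → ℕ
degree = V.sum

degree-· : ∀ {m} (u v : Mon m) → degree (u ·ₘ v) ≡ degree u ℕ.+ degree v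
degree-· [] [] = ≡.refl
degree-· (a ∷ u) (b ∷ v) = ≡.trans (≡.cong (a ℕ.+ b ℕ.+_) (degree-· u v)) (interchange a b (degree u) (degree v))
  where
  interchange : ∀ a b x y → (a ℕ.+ b) ℕ.+ (x ℕ.+ y) ≡ (a ℕ.+ x) ℕ.+ (b ℕ.+ y)
  interchange a b x y = ≡.trans (ℕₚ.+-assoc a b (x ℕ.+ y)) (≡.trans (≡.cong (a ℕ.+_)
    (≡.trans (≡.sym (ℕₚ.+-assoc b x y)) (≡.trans (≡.cong (ℕ._+ y) (ℕₚ.+-comm b x)) (ℕₚ.+-assoc x b y)))) (≡.sym (ℕₚ.+-assoc a x (b ℕ.+ y))))

degree-ε : ∀ {m} (j : Fin m) → degree (ε j) ≡ 1
degree-ε {suc m} Fin.zero = ≡.cong suc (zeros m)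
  where
  zeros : ∀ m → degree (V.tabulate {n = m} (λ i → 0)) ≡ 0
  zeros zero = ≡.refl
  zeros (suc m) = zeros m
degree-ε {suc m} (Fin.suc j) = ≡.trans (≡.cong degree (Vₚ.tabulate-cong at)) (degree-ε j)
  where
  at : ∀ i → (if ⌊ Fin.suc i Fin.≟ Fin.suc j ⌋ then 1 else 0) ≡ (if ⌊ i Fin.≟ j ⌋ then 1 else 0)
  at i with i Fin.≟ j
  ... | yes _ = ≡.refl
  ... | no _ = ≡.refl

module PolyTruncation {c ℓ} (F : Field c ℓ) {m s : ℕ} (g : Fin s → Mon m) where
  open Polynomials F
  open Linear m
  open MonomialIdeals m
  open MonomialNZD F m
  open KoszulProperties (polyRing m)
  private
    module F = Field F
    module P = CommutativeRing (polyRing m)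
    open PolyRing F m
    I = multiple-ideal g

  τ : ℕ → Poly → Poly
  τ e = keep (λ w → degree w ℕ.<? e)

  coeff-τ-< : ∀ e f {w} → degree w ℕ.< e → coeff (τ e f) w F.≈ coeff f w
  coeff-τ-< e f = coeff-keep (λ w → degree w ℕ.<? e) f

  coeff-τ-≥ : ∀ e f {w} → ¬ degree w ℕ.< e → coeff (τ e f) w F.≈ F.0#
  coeff-τ-≥ e f {w} nlt = lower (All-MI {λ w → degree w ℕ.< e} (keep-All (λ w → degree w ℕ.<? e) f) w nlt)

  -- Membership in a monomial ideal is a condition on one coefficient at a time, which is why
  -- cutting by degree is compatible with it.
  truncation : Truncation I
  truncation = record
    { τ = τ
    ; τ-cong = τ-cong
    ; τ-+ = λ e f f′ → ≈⇒-∈ I {τ e (f ++ f′)} {τ e f ++ τ e f′} (τ-++ e f f′)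
    ; τ-zero = λ f → ≈⇒-∈ I {τ 0 f} {[]} (λ w → coeff-τ-≥ 0 f λ ())
    ; τ-bound = λ f → proj₁ (bound f) , λ e le → ≈⇒-∈ I {τ e f} {f} (P.reflexive {τ e f} (proj₂ (bound f) e le))
    }
    where
    τ-cong : ∀ e {f f′} → MI (Multiple g) (f P.- f′) → MI (Multiple g) (τ e f P.- τ e f′)
    τ-cong e {f} {f′} p w ¬Mw with degree w ℕ.<? e
    ... | yes lt = lift (F.trans (coeff-sub (τ e f) (τ e f′) w)
            (F.trans (F.+-cong (coeff-τ-< e f lt) (F.-‿cong (coeff-τ-< e f′ lt)))
              (F.trans (F.sym (coeff-sub f f′ w)) (lower (p w ¬Mw)))))
    ... | no nlt = lift (F.trans (coeff-sub (τ e f) (τ e f′) w)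
            (F.trans (F.+-cong (coeff-τ-≥ e f nlt) (F.-‿cong (coeff-τ-≥ e f′ nlt))) (F.-‿inverseʳ F.0#)))
    τ-++ : ∀ e f f′ → τ e (f ++ f′) ≃ (τ e f ++ τ e f′)
    τ-++ e f f′ = P.reflexive {τ e (f ++ f′)} (at f)
      where
      at : ∀ f → τ e (f ++ f′) ≡ τ e f ++ τ e f′
      at [] = ≡.refl
      at ((a , v) ∷ f) with degree v ℕ.<? e
      ... | yes _ = ≡.cong ((a , v) ∷_) (at f)
      ... | no _ = at f
    bound : ∀ f → ∃[ d ] (∀ e → d ℕ.≤ e → τ e f ≡ f)
    bound [] = 0 , λ _ _ → ≡.refl
    bound ((a , v) ∷ f) with bound f
    ... | d , p = suc (degree v) ℕ.⊔ d , at
      where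
      at : ∀ e → suc (degree v) ℕ.⊔ d ℕ.≤ e → τ e ((a , v) ∷ f) ≡ (a , v) ∷ f
      at e le with degree v ℕ.<? e
      ... | yes _ = ≡.cong ((a , v) ∷_) (p e (ℕₚ.≤-trans (ℕₚ.m≤n⊔m (suc (degree v)) d) le))
      ... | no nlt = contradiction (ℕₚ.≤-trans (ℕₚ.m≤m⊔n (suc (degree v)) d) le) nlt

  open Truncation truncation using (Homogeneous)

  var-homogeneous : ∀ j → Homogeneous 1 (var j)
  var-homogeneous j e f = ≈⇒-∈ I {τ e (var j P.* f)} {var j P.* τ (e ℕ.∸ 1) f} λ w → at w (ε j ∣ₘ? w)
    where
    at : ∀ w → Dec (ε j ∣ₘ w) → coeff (τ e (var j P.* f)) w F.≈ coeff (var j P.* τ (e ℕ.∸ 1) f) w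
    at w (no nd) with degree w ℕ.<? e
    ... | yes lt = F.trans (coeff-τ-< e (var j P.* f) lt) (F.trans (coeff-∤ (ε j) f nd) (F.sym (coeff-∤ (ε j) (τ (e ℕ.∸ 1) f) nd)))
    ... | no nlt = F.trans (coeff-τ-≥ e (var j P.* f) nlt) (F.sym (coeff-∤ (ε j) (τ (e ℕ.∸ 1) f) nd))
    at _ (yes (v , ≡.refl)) with degree v ℕ.<? e ℕ.∸ 1
    ... | yes lt = F.trans (coeff-τ-< e (var j P.* f) (shift e lt)) (F.trans (coeff-shift (ε j) f v)
            (F.sym (F.trans (coeff-shift (ε j) (τ (e ℕ.∸ 1) f) v) (coeff-τ-< (e ℕ.∸ 1) f lt))))
      where
      shift : ∀ e → degree v ℕ.< e ℕ.∸ 1 → degree (ε j ·ₘ v) ℕ.< e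
      shift (suc e) lt = ≡.subst (ℕ._< suc e) (≡.sym (≡.trans (degree-· (ε j) v) (≡.cong (ℕ._+ degree v) (degree-ε j)))) (s≤s lt)
    ... | no nlt = F.trans (coeff-τ-≥ e (var j P.* f) (λ lt → nlt (unshift e lt)))
            (F.sym (F.trans (coeff-shift (ε j) (τ (e ℕ.∸ 1) f) v) (coeff-τ-≥ (e ℕ.∸ 1) f nlt)))
      where
      unshift : ∀ e → degree (ε j ·ₘ v) ℕ.< e → degree v ℕ.< e ℕ.∸ 1
      unshift (suc e) lt = ℕₚ.≤-pred (≡.subst (ℕ._< suc e) (≡.trans (degree-· (ε j) v) (≡.cong (ℕ._+ degree v) (degree-ε j))) lt)

-- Faces

module Faces {c ℓ} (F : Field c ℓ) {n s : ℕ} (u : Fin s → Mon n) {d : ℕ}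
  (face-bound : ∀ Z → (∀ k → ¬ SupportedIn (u k) Z) → ∣ Z ∣ ℕ.≤ d)
  where

  private
    r = polR u
    N = polVars u
    p = polGens u

  -- The rows occupied by the complement of A form a vertex cover of I.
  cover-bound : ∀ (A : Subset N) → (∀ k → ∃[ q ] (V.lookup (p k) q ≡ 1 × V.lookup A q ≡ false)) → n ℕ.∸ d ℕ.≤ N ℕ.∸ ∣ A ∣
  cover-bound A hit = ℕₚ.≤-trans (ℕₚ.∸-monoʳ-≤ n (face-bound Z face))
    (ℕₚ.≤-trans (ℕₚ.≤-reflexive (≡.sym (Subsetₚ.∣∁p∣≡n∸∣p∣ Z)))
      (ℕₚ.≤-trans (card-injective (∁ Z) (∁ A) (λ i i∈ → proj₁ (missing i i∈))
          (λ i i∈ → Subsetₚ.x∉p⇒x∈∁p λ q∈ → false≢true (≡.trans (≡.sym (proj₂ (proj₂ (missing i i∈)))) (Vₚ.[]=⇒lookup q∈)))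
          (λ i j i∈ j∈ e → ≡.trans (≡.sym (proj₁ (proj₂ (missing i i∈)))) (≡.trans (≡.cong (row r) e) (proj₁ (proj₂ (missing j j∈))))))
        (ℕₚ.≤-reflexive (Subsetₚ.∣∁p∣≡n∸∣p∣ A))))
    where
    false≢true : ¬ (false ≡ true)
    false≢true ()
    missing? : ∀ i → Dec (∃[ q ] (row r q ≡ i × V.lookup A q ≡ false))
    missing? i = Finₚ.any? (λ q → (row r q Fin.≟ i) ×-dec (V.lookup A q Bool.≟ false))
    Z : Subset n
    Z = V.tabulate (λ i → not ⌊ missing? i ⌋)
    missing : ∀ i → i ∈ ∁ Z → ∃[ q ] (row r q ≡ i × V.lookup A q ≡ false)
    missing i i∈ with missing? i in eq
    ... | yes m = m
    ... | no _ = contradiction (Vₚ.lookup⇒[]= i Z (≡.trans (Vₚ.lookup∘tabulate _ i) (≡.cong (λ m → not ⌊ m ⌋) eq))) (Subsetₚ.x∈∁p⇒x∉p i∈)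
    Z-false : ∀ q → V.lookup A q ≡ false → V.lookup Z (row r q) ≡ false
    Z-false q e with missing? (row r q) in eq
    ... | yes _ = ≡.trans (Vₚ.lookup∘tabulate _ (row r q)) (≡.cong (λ m → not ⌊ m ⌋) eq)
    ... | no nm = contradiction (q , ≡.refl , e) nm
    face : ∀ k → ¬ SupportedIn (u k) Z
    face k sup with hit k
    ... | q , e , e′ = ℕₚ.n≮0 (≡.subst (col r q ℕ.<_) (sup (row r q) (Z-false q e′))
            (bit-1 (≡.trans (≡.sym (lookup-polarize r (u k) q)) e)))

  Divides : Fin s → Subset N → Set
  Divides k A = ∀ q → V.lookup (p k) q ≡ 1 → V.lookup A q ≡ true

  -- The contrapositive of `cover-bound`: if every generator had a variable outside A, then |A| + (n
  -- - d) ≤ |A| + (N - |A|) = N.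
  nonface : ∀ A → N ℕ.∸ (n ℕ.∸ d) ℕ.< ∣ A ∣ → ∃[ k ] Divides k A
  nonface A lt with Finₚ.any? (λ k → Finₚ.all? (λ q → (V.lookup (p k) q ℕ.≟ 1) →-dec (V.lookup A q Bool.≟ true)))
  ... | yes d = d
  ... | no nd = contradiction lt (ℕₚ.≤⇒≯ (ℕₚ.m+n≤o⇒m≤o∸n ∣ A ∣ (ℕₚ.≤-trans
          (ℕₚ.+-monoʳ-≤ ∣ A ∣ (cover-bound A hit)) (ℕₚ.≤-reflexive (ℕₚ.m+[n∸m]≡n (Subsetₚ.∣p∣≤n A))))))
    where
    hit : ∀ k → ∃[ q ] (V.lookup (p k) q ≡ 1 × V.lookup A q ≡ false)
    hit k with Finₚ.any? (λ q → (V.lookup (p k) q ℕ.≟ 1) ×-dec (V.lookup A q Bool.≟ false))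
    ... | yes h = h
    ... | no nh = contradiction (k , at) nd
      where
      at : Divides k A
      at q e with V.lookup A q in eq
      ... | true = ≡.refl
      ... | false = contradiction (q , e , eq) nh

  gen-≢1 : (∀ k → u k ≢ oneₘ) → ∀ k → ∃[ q ] (V.lookup (p k) q ≡ 1)
  gen-≢1 u≢1 k with Finₚ.any? (λ i → 1 ℕ.≤? V.lookup (u k) i)
  ... | no none = contradiction (lookup-ext (λ i → ≡.trans (ℕₚ.n≤0⇒n≡0 (ℕₚ.≮⇒≥ (λ 1≤ → none (i , 1≤)))) (≡.sym (Vₚ.lookup-replicate i 0)))) (u≢1 k)
  ... | yes (i , 1≤) with position r i (ℕₚ.≤-trans 1≤ (≤-polR u k i))
  ...   | q , ≡.refl , e = q , ≡.trans (lookup-polarize r (u k) q) (bit-< (≡.subst (ℕ._< V.lookup (u k) (row r q)) (≡.sym e) 1≤))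

  -- The empty face already gives the inequality, provided that no generator is 1. It makes the
  -- truncated subtraction in N ∸ (n ∸ d) an honest one.
  codimension-bound : (∀ k → u k ≢ oneₘ) → n ℕ.∸ d ℕ.≤ N
  codimension-bound u≢1 = ℕₚ.≤-trans (cover-bound ∅ hit) (ℕₚ.m∸n≤m N ∣ ∅ {N} ∣)
    where
    hit : ∀ k → ∃[ q ] (V.lookup (p k) q ≡ 1 × V.lookup (∅ {N}) q ≡ false)
    hit k = proj₁ (gen-≢1 u≢1 k) , proj₂ (gen-≢1 u≢1 k) , Vₚ.lookup-replicate (proj₁ (gen-≢1 u≢1 k)) false

module SelectedVariables {c ℓ} (F : Field c ℓ) (m : ℕ) where
  open Polynomials F
  open MonomialIdeals m
  open Symmetric (polyRing m)
  private
    module P = CommutativeRing (polyRing m)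
    open PolyRing F m

  -- The length of a tabulated list equals N only propositionally, so a selection from the list must
  -- be converted into a subset of `Fin N`.
  selection : ∀ {N} (g : Fin N → Fin m) → Vec Bool (length (L.tabulate (λ q → var (g q)))) → Subset N
  selection {zero} g S = []
  selection {suc N} g (b ∷ S) = b ∷ selection (λ q → g (Fin.suc q)) S

  ∣selection∣ : ∀ {N} (g : Fin N → Fin m) S → ∣ selection g S ∣ ≡ ∣ S ∣
  ∣selection∣ {zero} g [] = ≡.refl
  ∣selection∣ {suc N} g (false ∷ S) = ∣selection∣ (λ q → g (Fin.suc q)) S
  ∣selection∣ {suc N} g (true ∷ S) = ≡.cong suc (∣selection∣ (λ q → g (Fin.suc q)) S)

  product : ∀ {N} (g : Fin N → Fin m) → Subset N → Mon m
  product {zero} g [] = oneₘ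
  product {suc N} g (false ∷ A) = product (λ q → g (Fin.suc q)) A
  product {suc N} g (true ∷ A) = ε (g Fin.zero) ·ₘ product (λ q → g (Fin.suc q)) A

  product-≥1 : ∀ {N} (g : Fin N → Fin m) A q → V.lookup A q ≡ true → 1 ℕ.≤ V.lookup (product g A) (g q)
  product-≥1 {suc N} g (true ∷ A) Fin.zero e = ≡.subst (1 ℕ.≤_) (≡.sym (lookup-ε·-≡ (g Fin.zero) _)) (s≤s z≤n)
  product-≥1 {suc N} g (false ∷ A) (Fin.suc q) e = product-≥1 (λ q → g (Fin.suc q)) A q e
  product-≥1 {suc N} g (true ∷ A) (Fin.suc q) e = ≡.subst (1 ℕ.≤_) (≡.sym (lookup-· (g (Fin.suc q)) (ε (g Fin.zero)) _))
    (ℕₚ.≤-trans (product-≥1 (λ q → g (Fin.suc q)) A q e) (ℕₚ.m≤n+m _ _))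

  select-product : ∀ {N} (g : Fin N → Fin m) S → select (L.tabulate (λ q → var (g q))) S ≃ monomial (product g (selection g S))
  select-product {zero} g [] = P.refl {oneₚ}
  select-product {suc N} g (false ∷ S) = select-product (λ q → g (Fin.suc q)) S
  select-product {suc N} g (true ∷ S) = P.trans {var (g Fin.zero) P.* select zs S} {var (g Fin.zero) P.* monomial w} {monomial (ε (g Fin.zero) ·ₘ w)}
    (P.*-congˡ {var (g Fin.zero)} {select zs S} {monomial w} (select-product (λ q → g (Fin.suc q)) S))
    (P.sym {monomial (ε (g Fin.zero) ·ₘ w)} {var (g Fin.zero) P.* monomial w} (monomial-· (ε (g Fin.zero)) w))
    where
    zs = L.tabulate (λ q → var (g (Fin.suc q)))
    w = product (λ q → g (Fin.suc q)) (selection (λ q → g (Fin.suc q)) S)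

module LiftedVariables {c ℓ} (F : Field c ℓ) (n N : ℕ) where
  open Polynomials F
  private
    module PS = PolyRing F n
    module PT = PolyRing F N
    module PB = PolyRing F (n ℕ.+ N)
    module RB = CommutativeRing (polyRing (n ℕ.+ N))
    module Hˡ = RetractHoms F (retractˡ n N)
    module Hʳ = RetractHoms F (retractʳ n N)

  embedʳ-ε : ∀ (q : Fin N) → oneₘ {n} V.++ ε q ≡ ε (n ↑ʳ q)
  embedʳ-ε q = lookup-ext (split-index _
    (λ i → ≡.trans (Vₚ.lookup-++ˡ (oneₘ {n}) (ε q) i) (≡.trans (Vₚ.lookup-replicate i 0) (≡.sym (lookup-ε-≢ (λ e → ↑ˡ≢↑ʳ i q (≡.sym e))))))
    (λ q′ → ≡.trans (Vₚ.lookup-++ʳ (oneₘ {n}) (ε q) q′) (at q′)))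
    where
    at : ∀ q′ → V.lookup (ε q) q′ ≡ V.lookup (ε (n ↑ʳ q)) (n ↑ʳ q′)
    at q′ with q′ Fin.≟ q
    ... | yes ≡.refl = ≡.trans (lookup-ε-≡ q) (≡.sym (lookup-ε-≡ (n ↑ʳ q)))
    ... | no ne = ≡.trans (lookup-ε-≢ ne) (≡.sym (lookup-ε-≢ (λ e → ne (Finₚ.↑ʳ-injective n q′ q e))))

  embedˡ-ε : ∀ (i : Fin n) → ε i V.++ oneₘ {N} ≡ ε (i ↑ˡ N)
  embedˡ-ε i = lookup-ext (split-index _
    (λ i′ → ≡.trans (Vₚ.lookup-++ˡ (ε i) (oneₘ {N}) i′) (at i′))
    (λ q → ≡.trans (Vₚ.lookup-++ʳ (ε i) (oneₘ {N}) q) (≡.trans (Vₚ.lookup-replicate q 0) (≡.sym (lookup-ε-≢ (↑ˡ≢↑ʳ i q))))))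
    where
    at : ∀ i′ → V.lookup (ε i) i′ ≡ V.lookup (ε (i ↑ˡ N)) (i′ ↑ˡ N)
    at i′ with i′ Fin.≟ i
    ... | yes ≡.refl = ≡.trans (lookup-ε-≡ i) (≡.sym (lookup-ε-≡ (i ↑ˡ N)))
    ... | no ne = ≡.trans (lookup-ε-≢ ne) (≡.sym (lookup-ε-≢ (λ e → ne (Finₚ.↑ˡ-injective N i′ i e))))

  liftʳ-var : ∀ q → Hʳ.lift-poly (PT.var q) RB.≈ PB.var (n ↑ʳ q)
  liftʳ-var q = RB.trans {Hʳ.lift-poly (PT.var q)} {PB.monomial (oneₘ {n} V.++ ε q)} {PB.var (n ↑ʳ q)} (Hʳ.lift-monomial (ε q))
    (RB.reflexive {PB.monomial (oneₘ {n} V.++ ε q)} {PB.var (n ↑ʳ q)} (≡.cong PB.monomial (embedʳ-ε q)))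

  liftˡ-var : ∀ i → Hˡ.lift-poly (PS.var i) RB.≈ PB.var (i ↑ˡ N)
  liftˡ-var i = RB.trans {Hˡ.lift-poly (PS.var i)} {PB.monomial (ε i V.++ oneₘ {N})} {PB.var (i ↑ˡ N)} (Hˡ.lift-monomial (ε i))
    (RB.reflexive {PB.monomial (ε i V.++ oneₘ {N})} {PB.var (i ↑ˡ N)} (≡.cong PB.monomial (embedˡ-ε i)))

  liftʳ-σ : ∀ k → Hʳ.lift-poly (Symmetric.σ (polyRing N) (L.tabulate PT.var) k) RB.≈
    Symmetric.σ (polyRing (n ℕ.+ N)) (L.tabulate (λ q → PB.var (n ↑ʳ q))) k
  liftʳ-σ = σ-hom Hʳ.lift-isHom {N} {PT.var} {λ q → PB.var (n ↑ʳ q)} liftʳ-var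

-- The depth of the polarization

-- The properties of a polarization that determine its depth. `nonface` puts the high θ's into I^p
-- and so bounds D from below; `D-bound` bounds it from above and leaves room for D regular
-- elements.
module PolarizedDepth {c ℓ} (F : Field c ℓ) {n N s d D : ℕ} (u : Fin s → Mon n) (p : Fin s → Mon N) (row : Fin N → Fin n)
  (p-01 : ∀ k q → V.lookup (p k) q ≡ 0 ⊎ V.lookup (p k) q ≡ 1)
  (p-down : ∀ k {q q′} → toℕ q ℕ.< toℕ q′ → row q ≡ row q′ → V.lookup (p k) q′ ≡ 1 → V.lookup (p k) q ≡ 1)
  (p-total : ∀ k i → sumF (λ q → if ⌊ row q Fin.≟ i ⌋ then V.lookup (p k) q else 0) ≡ V.lookup (u k) i)
  (p-positive : ∀ k → ∃[ q ] (1 ℕ.≤ V.lookup (p k) q))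
  (nonface : ∀ A → D ℕ.< ∣ A ∣ → ∃[ k ] (∀ q → V.lookup (p k) q ≡ 1 → V.lookup A q ≡ true))
  (D-bound : D ℕ.+ n ℕ.≤ N ℕ.+ d)
  (fs : List (PolyRing.Poly F n)) (fs-regular : PolyRing.RegularSeq F n (PolyRing.monIdeal F n u) fs) (length-fs : length fs ≡ d)
  where

  open Polynomials F
  private
    module F = Field F
    module PS = PolyRing F n
    module PT = PolyRing F N
    module PB = PolyRing F (n ℕ.+ N)
    module RS = CommutativeRing (polyRing n)
    module RT = CommutativeRing (polyRing N)
    module RB = CommutativeRing (polyRing (n ℕ.+ N))
    module IS = MonomialIdeals n
    module IT = MonomialIdeals N
    module IB = MonomialIdeals (n ℕ.+ N)
    module ST = Symmetric (polyRing N)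
    module SB = Symmetric (polyRing (n ℕ.+ N))

  -- MI Positive is the graded maximal ideal of T.
  Positive : Mon N → Set
  Positive w = ∃[ q ] (1 ℕ.≤ V.lookup w q)

  positive? : Decidable Positive
  positive? w = Finₚ.any? (λ q → 1 ℕ.≤? V.lookup w q)

  positive-· : ∀ v {w} → Positive w → Positive (v ·ₘ w)
  positive-· v {w} (q , le) = q , ≡.subst (1 ℕ.≤_) (≡.sym (lookup-· q v w)) (ℕₚ.≤-trans le (ℕₚ.m≤n+m _ _))

  positive-ideal : IT.IsIdeal (IT.MI Positive)
  positive-ideal = IT.MI-ideal positive? positive-·

  1∉positive : ¬ IT.MI Positive PT.oneₚ
  1∉positive x = F.1≉0 (F.trans (F.sym (Linear.coeff-monomial N oneₘ)) (lower (x oneₘ not-positive)))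
    where
    not-positive : ¬ Positive oneₘ
    not-positive (q , le) with ≡.subst (1 ℕ.≤_) (Vₚ.lookup-replicate q 0) le
    ... | ()

  gens-positive : All (IT.MI Positive) (PT.monIdeal p)
  gens-positive = Allₚ.map⁺ (All.tabulate (λ {k} _ → IT.MI-monomial {Positive} {p k} (p-positive k)))

  zs : List PT.Poly
  zs = L.tabulate PT.var

  zs-positive : All (IT.MI Positive) zs
  zs-positive = Allₚ.tabulate⁺ (λ q → IT.MI-monomial {Positive} {ε q} (q , ℕₚ.≤-reflexive (≡.sym (lookup-ε-≡ q))))

  -- The index is shifted: `θ k` has degree k + 1, since the constant σ of degree 0 must not take
  -- part. The D elements of `Θ` are thus `θ 0` to `θ (D - 1)`, of degrees 1 to D.
  θ : ℕ → PT.Poly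
  θ k = ST.σ zs (suc k)

  Θ : List PT.Poly
  Θ = L.applyDownFrom θ D

  θ-positive : ∀ k → IT.MI Positive (θ k)
  θ-positive = ST.σ-∈ positive-ideal zs zs-positive

  IT-gens : IT.IsIdeal IT.⟨ PT.monIdeal p ⟩
  IT-gens = IT.⟨⟩-ideal (PT.monIdeal p)

  θ-vanish : ∀ k → D ℕ.≤ k → IT.⟨ PT.monIdeal p ⟩ (θ k)
  θ-vanish k D≤k = resp {PT.oneₚ RT.* θ k} {θ k} (RT.*-identityˡ (θ k))
    (ST.σ-∈-selections IT-gens zs (suc k) PT.oneₚ at)
    where
    open IT.IsIdeal IT-gens
    open SelectedVariables F N
    at : ∀ S → ∣ S ∣ ≡ suc k → IT.⟨ PT.monIdeal p ⟩ (PT.oneₚ RT.* ST.select zs S)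
    at S e = *∈ PT.oneₚ {ST.select zs S} (resp {PT.monomial w} {ST.select zs S} (RT.sym {ST.select zs S} {PT.monomial w} (select-product (λ q → q) S))
      (MonomialMembership.multiple⇒∈ F N p {w} (proj₁ hit , ≤⇒∣ₘ divides)))
      where
      A = selection (λ q → q) S
      w = product (λ q → q) A
      hit : ∃[ k ] (∀ q → V.lookup (p k) q ≡ 1 → V.lookup A q ≡ true)
      hit = nonface A (≡.subst (D ℕ.<_) (≡.sym (≡.trans (∣selection∣ (λ q → q) S) e)) (s≤s D≤k))
      divides : ∀ q → V.lookup (p (proj₁ hit)) q ℕ.≤ V.lookup w q
      divides q with p-01 (proj₁ hit) q
      ... | inj₁ e = ≡.subst (ℕ._≤ V.lookup w q) (≡.sym e) z≤n
      ... | inj₂ e = ≡.subst (ℕ._≤ V.lookup w q) (≡.sym e) (product-≥1 (λ q → q) A q (proj₂ hit q e))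

  -- A longer sequence would make H₀ of the Koszul complex of Θ vanish.
  regular-length-≤ : ∀ hs → PT.RegularSeq (PT.monIdeal p) hs → length hs ℕ.≤ D
  regular-length-≤ hs reg = ℕₚ.≮⇒≥ λ D< → 1∉positive (1∈ D<)
    where
    open Koszul (polyRing N)
    open ExactTransfer (polyRing N)
    module _ (D< : D ℕ.< length hs) where
      J = comb-ideal IT-gens Θ
      var∈ : ∀ {G} (I : IsIdeal G) i → Comb G (zs ++ Θ) (PT.var i)
      var∈ I i = comb-gen I (∈-++⁺ˡ (∈-tabulate⁺ i))
      -- The list has N + D elements, so more than D regular elements make the homology vanish from
      -- degree N on; dropping the N variables then brings this down to degree 0.
      shorter : length (zs ++ Θ) ℕ.< (length zs ℕ.+ 0) ℕ.+ length hs
      shorter = ≡.subst₂ ℕ._<_ (≡.sym (≡.trans (Lₚ.length-++ zs) (≡.cong (length zs ℕ.+_) (Lₚ.length-applyDownFrom θ D))))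
        (≡.cong (ℕ._+ length hs) (≡.sym (ℕₚ.+-identityʳ (length zs)))) (ℕₚ.+-monoʳ-< (length zs) D<)
      θ∈ : ∀ k → Comb IT.⟨ PT.monIdeal p ⟩ Θ (θ k)
      θ∈ = KoszulSymmetric.comb-applyDownFrom (polyRing N) IT-gens θ D θ-vanish
      exact : Cycles.Exact IT-gens 0 Θ
      exact = KoszulSymmetric.exact-drop-roots (polyRing N) IT-gens {0} zs Θ θ∈
        (regular-exact F N (zs ++ Θ) var∈ (PT.monIdeal p) hs reg (length zs ℕ.+ 0) shorter (length zs ℕ.+ 0) ℕₚ.≤-refl)
      1∈ : IT.MI Positive PT.oneₚ
      1∈ = comb-elim IT-gens positive-ideal (λ {f} → IT.⟨⟩-elim positive-ideal (PT.monIdeal p) gens-positive {f})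
        Θ (Allₚ.applyDownFrom⁺₂ θ D θ-positive) {PT.oneₚ} (Cycles.exact-0⇒1∈ IT-gens Θ exact)

  private
    module Hˡ = RetractHoms F (retractˡ n N)
    module Hʳ = RetractHoms F (retractʳ n N)
    module KL = IsHom Hˡ.kill-isHom
    module KR = IsHom Hʳ.kill-isHom
    module LR = IsHom Hʳ.lift-isHom

  open Polarize F u row (λ k → V.lookup (p k)) p-01 p-down
  open LiftedVariables F n N

  g₀ : Fin s → Mon (n ℕ.+ N)
  g₀ = partial p-total 0

  g₀-lift : ∀ k → g₀ k ≡ oneₘ V.++ p k
  g₀-lift k = lookup-ext (split-index _
    (λ i → ≡.trans (partial-x p-total 0 k i) (≡.trans (sumF-zero {N} (λ q → below-≥ (contribution k i) {0} {q} (λ ())))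
      (≡.sym (≡.trans (Vₚ.lookup-++ˡ (oneₘ {n}) (p k) i) (Vₚ.lookup-replicate i 0)))))
    (λ q → ≡.trans (partial-z p-total 0 k q) (≡.trans (from-≥ (V.lookup (p k)) {0} {q} (λ ()))
      (≡.sym (Vₚ.lookup-++ʳ (oneₘ {n}) (p k) q)))))

  IG : IB.IsIdeal (IB.MI (Multiple g₀))
  IG = MonomialNZD.multiple-ideal F (n ℕ.+ N) g₀

  xS : List PB.Poly
  xS = L.tabulate (λ i → PB.var (i ↑ˡ N))

  zB : List PB.Poly
  zB = L.tabulate (λ q → PB.var (n ↑ʳ q))

  θB : ℕ → PB.Poly
  θB k = Hʳ.lift-poly (θ k)

  θB-σ : ∀ k → θB k RB.≈ SB.σ zB (suc k)
  θB-σ k = liftʳ-σ (suc k)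

  lift-gens : IT.⟨ PT.monIdeal p ⟩ IT.⊆ᵢ (λ f → IB.MI (Multiple g₀) (Hʳ.lift-poly f))
  lift-gens {f} = IT.⟨⟩-elim (LR.preimage-ideal IG) (PT.monIdeal p)
    (Allₚ.map⁺ (All.tabulate (λ {k} _ → IB.IsIdeal.resp IG {PB.monomial (oneₘ {n} V.++ p k)} {Hʳ.lift-poly (PT.monomial (p k))}
      (RB.sym {Hʳ.lift-poly (PT.monomial (p k))} {PB.monomial (oneₘ {n} V.++ p k)} (Hʳ.lift-monomial (p k)))
      (IB.MI-monomial {Multiple g₀} {oneₘ {n} V.++ p k} (k , oneₘ , ≡.trans (·ₘ-identityʳ (g₀ k)) (g₀-lift k)))))) {f}

  kill-gens : IB.MI (Multiple g₀) IB.⊆ᵢ (λ f → IT.⟨ PT.monIdeal p ⟩ (Hʳ.kill f))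
  kill-gens {f} = IB.MI-elim (multiple? g₀) J gen {f}
    where
    J : IB.IsIdeal (λ f → IT.⟨ PT.monIdeal p ⟩ (Hʳ.kill f))
    J = KR.preimage-ideal IT-gens
    gen : ∀ w → Multiple g₀ w → IT.⟨ PT.monIdeal p ⟩ (Hʳ.kill (PB.monomial w))
    gen w (k , v , ≡.refl) = resp {PB.monomial (g₀ k) RB.* PB.monomial v} {PB.monomial (g₀ k ·ₘ v)}
      (RB.sym {PB.monomial (g₀ k ·ₘ v)} {PB.monomial (g₀ k) RB.* PB.monomial v} (IB.monomial-· (g₀ k) v))
      (*∈ʳ (PB.monomial v) {PB.monomial (g₀ k)} killed)
      where
      open IB.IsIdeal J
      killed : IT.⟨ PT.monIdeal p ⟩ (Hʳ.kill (PB.monomial (g₀ k)))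
      killed = IT.IsIdeal.resp IT-gens {PT.monomial (p k)} {Hʳ.kill (PB.monomial (g₀ k))}
        (RT.sym {Hʳ.kill (PB.monomial (g₀ k))} {PT.monomial (p k)} (Hʳ.kill-monomial (g₀ k)
          (≡.trans (≡.cong (Retract.retract (retractʳ n N)) (g₀-lift k)) (Retract.retract-embed (retractʳ n N) (p k)))))
        (MonomialMembership.multiple⇒∈ F N p {p k} (k , oneₘ , ·ₘ-identityʳ (p k)))

  kill-x : ∀ i → Hʳ.kill (PB.var (i ↑ˡ N)) RT.≈ PT.zeroₚ
  kill-x i = Hʳ.kill-outside (ε (i ↑ˡ N)) λ v e → ℕₚ.1+n≢0
    (≡.trans (≡.sym (lookup-ε-≡ (i ↑ˡ N))) (≡.trans (≡.cong (λ w → V.lookup w (i ↑ˡ N)) e)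
      (≡.trans (Vₚ.lookup-++ˡ (oneₘ {n}) v i) (Vₚ.lookup-replicate i 0))))

  ΘB : List PB.Poly
  ΘB = L.map Hʳ.lift-poly Θ

  -- The x_i come last so that peeling off the θ's ends at B/(I^p, x) = T/I^p, and the θ's are
  -- reversed for `exact-regular`. With `zB` in front the list contains all variables of B, hence
  -- every element that is divided out or restored below.
  ds : List PB.Poly
  ds = ΘB L.ʳ++ xS

  xs : List PB.Poly
  xs = zB ++ ds

  vars∈ : ∀ i → PB.var i ∈ₗ xs
  vars∈ = split-index (λ i → PB.var i ∈ₗ xs)
    (λ i → ∈-++⁺ʳ zB (Anyₚ.reverseAcc⁺ {P = PB.var (i ↑ˡ N) ≡_} xS ΘB (inj₁ (∈-tabulate⁺ i))))
    (λ q → ∈-++⁺ˡ {xs = zB} (∈-tabulate⁺ q))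

  length-xs : length xs ≡ N ℕ.+ (D ℕ.+ n)
  length-xs = ≡.trans (Lₚ.length-++ zB) (≡.cong₂ ℕ._+_ (Lₚ.length-tabulate (λ q → PB.var (n ↑ʳ q)))
    (≡.trans (Lₚ.length-ʳ++ ΘB) (≡.cong₂ ℕ._+_ (≡.trans (Lₚ.length-map Hʳ.lift-poly Θ) (Lₚ.length-applyDownFrom θ D))
      (Lₚ.length-tabulate (λ i → PB.var (i ↑ˡ N))))))

  module E = RegularExact F Hˡ.kill-isHom Hˡ.lift-isHom Hˡ.kill-lift
  open IB using (_⊆ᵢ_)
  open ExactTransfer (polyRing (n ℕ.+ N))

  -- B modulo this preimage is S/I. The bound 2N + 1 allows for what follows: N is spent on
  -- restoring the z_q, N on dropping them from the complex, and degree 1 is left for Nakayama.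
  exact-S : ExactFrom (E.preimage (PS.monIdeal u)) (N ℕ.+ (N ℕ.+ 1)) xs
  exact-S = E.regular-exact xs
    (λ I i → IB.IsIdeal.resp (IB.comb-ideal I xs) {PB.var (i ↑ˡ N)} {Hˡ.lift-poly (PS.var i)}
      (RB.sym {Hˡ.lift-poly (PS.var i)} {PB.var (i ↑ˡ N)} (liftˡ-var i)) (IB.comb-gen I (vars∈ (i ↑ˡ N))))
    (PS.monIdeal u) fs fs-regular (N ℕ.+ (N ℕ.+ 1)) shorter
    where
    shorter : length xs ℕ.< (N ℕ.+ (N ℕ.+ 1)) ℕ.+ length fs
    -- The complex has N + D + n elements, at most 2N + d by `D-bound`, and the given sequence has
    -- d.
    shorter = ≡.subst₂ ℕ._<_ (≡.sym length-xs)
      (≡.trans (≡.cong (N ℕ.+_) (≡.trans (≡.sym (ℕₚ.+-suc N d)) (≡.sym (ℕₚ.+-assoc N 1 d))))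
        (≡.trans (≡.sym (ℕₚ.+-assoc N (N ℕ.+ 1) d)) (≡.cong ((N ℕ.+ (N ℕ.+ 1)) ℕ.+_) (≡.sym length-fs))))
      (ℕₚ.+-monoʳ-< N (s≤s D-bound))

  private
    Kill : Mon (n ℕ.+ N) → Set
    Kill = Killed p-total xs vars∈ N

    not-killed : ∀ w → ¬ Kill w → w ≡ V.tabulate (λ i → V.lookup w (i ↑ˡ N)) V.++ oneₘ {N}
    not-killed w nk = lookup-ext (split-index _
      (λ i → ≡.sym (≡.trans (Vₚ.lookup-++ˡ v (oneₘ {N}) i) (Vₚ.lookup∘tabulate (λ i → V.lookup w (i ↑ˡ N)) i)))
      (λ q → ≡.trans (ℕₚ.n≤0⇒n≡0 (ℕₚ.≮⇒≥ (λ 0< → nk (inj₂ (q , Finₚ.toℕ<n q , 0<)))))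
        (≡.sym (≡.trans (Vₚ.lookup-++ʳ v (oneₘ {N}) q) (Vₚ.lookup-replicate q 0)))))
      where v = V.tabulate (λ i → V.lookup w (i ↑ˡ N))

    partial-N : ∀ k → partial p-total N k ≡ u k V.++ oneₘ {N}
    partial-N k = lookup-ext (split-index _
      (λ i → ≡.trans (partial-x p-total N k i) (≡.trans (sumF-cong (λ q → below-< (contribution k i) {N} {q} (Finₚ.toℕ<n q)))
        (≡.trans (p-total k i) (≡.sym (Vₚ.lookup-++ˡ (u k) (oneₘ {N}) i)))))
      (λ q → ≡.trans (partial-z p-total N k q) (≡.trans (from-< (V.lookup (p k)) {N} {q} (Finₚ.toℕ<n q))
        (≡.sym (≡.trans (Vₚ.lookup-++ʳ (u k) (oneₘ {N}) q) (Vₚ.lookup-replicate q 0))))))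

  -- Setting z to zero keeps exactly the coefficients of monomials free of z, and those outside
  -- `Kill` are among them; so the kernel of B → S/I is a monomial ideal and the polarization steps
  -- apply to it.
  preimage⊆killed : (λ f → IS.⟨ PS.monIdeal u ⟩ (Hˡ.kill f)) ⊆ᵢ IB.MI Kill
  preimage⊆killed {f} f∈ w nk = lift (F.trans (F.reflexive (≡.cong (PB.coeff f) w≡))
    (F.trans (F.sym (Hˡ.coeff-kill f v)) (lower (MonomialMembership.monIdeal⊆multiples F n u {Hˡ.kill f} f∈ v not-multiple))))
    where
    v : Mon n
    v = V.tabulate (λ i → V.lookup w (i ↑ˡ N))
    w≡ : w ≡ v V.++ oneₘ {N}
    w≡ = not-killed w nk
    not-multiple : ¬ Multiple u v
    not-multiple (k , v′ , e) = nk (inj₁ (k , v′ V.++ oneₘ {N} ,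
      ≡.trans (≡.cong (_·ₘ (v′ V.++ oneₘ {N})) (partial-N k)) (≡.trans (≡.sym (Retract.embed-· (retractˡ n N) (u k) v′))
        (≡.trans (≡.cong (V._++ oneₘ {N}) e) (≡.sym w≡)))))

  killed⊆preimage : IB.MI Kill ⊆ᵢ (λ f → IS.⟨ PS.monIdeal u ⟩ (Hˡ.kill f))
  killed⊆preimage {f} = IB.MI-elim (killed? p-total xs vars∈ N) J gen {f}
    where
    IS-gens : IS.IsIdeal IS.⟨ PS.monIdeal u ⟩
    IS-gens = IS.⟨⟩-ideal (PS.monIdeal u)
    J : IB.IsIdeal (λ f → IS.⟨ PS.monIdeal u ⟩ (Hˡ.kill f))
    J = KL.preimage-ideal IS-gens
    open IB.IsIdeal J
    multiple∈ : ∀ a b → IS.⟨ PS.monIdeal u ⟩ (Hˡ.kill (PB.monomial a)) → IS.⟨ PS.monIdeal u ⟩ (Hˡ.kill (PB.monomial (a ·ₘ b)))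
    multiple∈ a b a∈ = resp {PB.monomial a RB.* PB.monomial b} {PB.monomial (a ·ₘ b)}
      (RB.sym {PB.monomial (a ·ₘ b)} {PB.monomial a RB.* PB.monomial b} (IB.monomial-· a b))
      (*∈ʳ (PB.monomial b) {PB.monomial a} a∈)
    gen-x : ∀ k → IS.⟨ PS.monIdeal u ⟩ (Hˡ.kill (PB.monomial (partial p-total N k)))
    gen-x k = IS.IsIdeal.resp IS-gens {PS.monomial (u k)} {Hˡ.kill (PB.monomial (partial p-total N k))}
      (RS.sym {Hˡ.kill (PB.monomial (partial p-total N k))} {PS.monomial (u k)} (Hˡ.kill-monomial (partial p-total N k)
        (≡.trans (≡.cong (Retract.retract (retractˡ n N)) (partial-N k)) (Retract.retract-embed (retractˡ n N) (u k)))))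
      (MonomialMembership.multiple⇒∈ F n u {u k} (k , oneₘ , ·ₘ-identityʳ (u k)))
    gen-z : ∀ q → IS.⟨ PS.monIdeal u ⟩ (Hˡ.kill (PB.var (n ↑ʳ q)))
    gen-z q = IS.IsIdeal.resp IS-gens {PS.zeroₚ} {Hˡ.kill (PB.var (n ↑ʳ q))}
      (RS.sym {Hˡ.kill (PB.var (n ↑ʳ q))} {PS.zeroₚ} kill-z) (IS.IsIdeal.0∈ IS-gens)
      where
      kill-z : Hˡ.kill (PB.var (n ↑ʳ q)) RS.≈ PS.zeroₚ
      kill-z = Hˡ.kill-outside (ε (n ↑ʳ q)) λ v e → ℕₚ.1+n≢0
        (≡.trans (≡.sym (lookup-ε-≡ (n ↑ʳ q))) (≡.trans (≡.cong (λ w → V.lookup w (n ↑ʳ q)) e)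
          (≡.trans (Vₚ.lookup-++ʳ v (oneₘ {N}) q) (Vₚ.lookup-replicate q 0))))
    gen : ∀ w → Kill w → IS.⟨ PS.monIdeal u ⟩ (Hˡ.kill (PB.monomial w))
    gen w (inj₁ (k , v , ≡.refl)) = multiple∈ (partial p-total N k) v (gen-x k)
    gen w (inj₂ (q , _ , le)) = ≡.subst (λ w → IS.⟨ PS.monIdeal u ⟩ (Hˡ.kill (PB.monomial w))) (proj₂ z∣w)
      (multiple∈ (ε (n ↑ʳ q)) (proj₁ z∣w) (gen-z q))
      where
      z∣w : ε (n ↑ʳ q) ∣ₘ w
      z∣w = ε-∣ le

  exact-B : ExactFrom IG (N ℕ.+ 1) xs
  exact-B = exact-polarized p-total xs vars∈ (exact-unkill p-total xs vars∈
    (exactFrom-resp (E.preimage (PS.monIdeal u)) (killed-ideal p-total xs vars∈ N)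
      (λ {f} → preimage⊆killed {f}) (λ {f} → killed⊆preimage {f}) xs exact-S))

  open Koszul (polyRing (n ℕ.+ N)) using (module Cycles)

  exact-ds : Cycles.Exact IG 1 ds
  -- The z_q are the roots of the polynomial whose coefficients are the lifted θ's, and every θ lies
  -- in the ideal of `ds` or already in I^p; dropping all N of them leaves degree 1.
  exact-ds = KoszulSymmetric.exact-drop-roots (polyRing (n ℕ.+ N)) IG {1} zB ds σ∈
    (exact-B (length zB ℕ.+ 1) (ℕₚ.≤-reflexive (≡.cong (ℕ._+ 1) (≡.sym (Lₚ.length-tabulate (λ q → PB.var (n ↑ʳ q)))))))
    where
    θB∈ : ∀ k → Dec (k ℕ.< D) → IB.Comb (IB.MI (Multiple g₀)) ds (θB k)
    θB∈ k (yes lt) = IB.comb-gen IG (Anyₚ.reverseAcc⁺ {P = θB k ≡_} xS ΘB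
      (inj₂ (∈-map⁺ Hʳ.lift-poly (Anyₚ.applyDownFrom⁺ {P = θ k ≡_} θ {k} {D} ≡.refl lt))))
    θB∈ k (no nlt) = IB.comb-base IG ds {θB k} (lift-gens {θ k} (θ-vanish k (ℕₚ.≮⇒≥ nlt)))
    σ∈ : ∀ k → IB.Comb (IB.MI (Multiple g₀)) ds (SB.σ zB (suc k))
    σ∈ k = IB.IsIdeal.resp (IB.comb-ideal IG ds) {θB k} {SB.σ zB (suc k)} (θB-σ k) (θB∈ k (k ℕ.<? D))

  private
    module PTr = PolyTruncation F g₀

  open KoszulProperties (polyRing (n ℕ.+ N))
  open Truncation PTr.truncation using (Homogeneous)

  θB-homogeneous : ∀ k → Homogeneous (suc k) (θB k)
  θB-homogeneous k = SB.homogeneous-resp IG PTr.truncation {suc k} {SB.σ zB (suc k)} {θB k}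
    (IB.≈⇒-∈ IG {SB.σ zB (suc k)} {θB k} (RB.sym {θB k} {SB.σ zB (suc k)} (θB-σ k)))
    (SB.σ-homogeneous IG PTr.truncation zB (Allₚ.tabulate⁺ (λ q → PTr.var-homogeneous (n ↑ʳ q))) (suc k))

  θ-max : ∀ k → PT.InMax (θ k)
  θ-max = ST.σ-∈ (IT.⟨⟩-ideal _) zs (Allₚ.tabulate⁺ (λ q → IT.⟨⟩-gen (∈-map⁺ PT.var (∈-toList⁺ (∈ᵥ-allFin q)))))

  Θ-regular : PT.RegularSeq (PT.monIdeal p) Θ
  Θ-regular = ExactRegular.exact-regular F Hʳ.kill-isHom Hʳ.lift-isHom Hʳ.kill-lift IG PTr.truncation
    positive-ideal 1∉positive (PT.monIdeal p) Θ xS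
    (λ {f} f∈ → IB.comb-base IG xS {Hʳ.lift-poly f} (lift-gens {f} f∈))
    (λ {a} → IB.comb-elim IG (KR.preimage-ideal IT-gens) (λ {f} → kill-gens {f}) xS
      (Allₚ.tabulate⁺ (λ i → IT.IsIdeal.resp IT-gens {PT.zeroₚ} {Hʳ.kill (PB.var (i ↑ˡ N))}
        (RT.sym {Hʳ.kill (PB.var (i ↑ˡ N))} {PT.zeroₚ} (kill-x i)) (IT.IsIdeal.0∈ IT-gens))) {a})
    (Allₚ.applyDownFrom⁺₂ θ D θ-max)
    (Allₚ.applyDownFrom⁺₂ θ D (λ k → k , θB-homogeneous k))
    (Allₚ.tabulate⁺ (λ i → 1 , PTr.var-homogeneous (i ↑ˡ N)))
    gens-positive (Allₚ.applyDownFrom⁺₂ θ D θ-positive) exact-ds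

  depth : PT.IsDepth (PT.monIdeal p) D
  depth = (Θ , Θ-regular , Lₚ.length-applyDownFrom θ D) , regular-length-≤

module _ {c ℓ} (F : Field c ℓ) {n : ℕ} where
  open PolyRing F n
  open Polynomials F
  open MonomialIdeals n

  regular⇒proper : ∀ gs fs → RegularSeq gs fs → ¬ (oneₚ ∈⟨ gs ⟩)
  regular⇒proper gs [] proper = proper
  regular⇒proper gs (f ∷ fs) (_ , _ , reg) 1∈ = regular⇒proper (gs ++ f ∷ []) fs reg (⟨⟩-snoc gs f {oneₚ} 1∈)

  regular⇒gens≢1 : ∀ {s} (u : Fin s → Mon n) fs → RegularSeq (monIdeal u) fs → ∀ k → u k ≢ oneₘ
  regular⇒gens≢1 u fs reg k e = regular⇒proper (monIdeal u) fs reg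
    (MonomialMembership.multiple⇒∈ F n u {oneₘ} (k , oneₘ , ≡.trans (·ₘ-identityʳ (u k)) e))

theorem2p5 : ∀ {c ℓ} (K : Field c ℓ) (n s : ℕ) (u : Fin s → Mon n) →
    MinimalGens u →
    PolyRing.CohenMacaulay K n (PolyRing.monIdeal K n u) →
    PolyRing.IsStanleyIdeal K n u →
    PolyRing.IsStanleyIdeal K (polVars u) (polGens u)
theorem2p5 K n s u _ (d₀ , ((fs₀ , reg₀ , len₀) , _) , chain , chain-bound) (d , ((fs , reg , len) , sup) , SD) =
  D , PolarizedDepth.depth K {D = D} u (polGens u) (row r) p-01 p-down p-total (λ k → proj₁ (gen-≢1 u≢1 k) , ℕₚ.≤-reflexive (≡.sym (proj₂ (gen-≢1 u≢1 k)))) nonface D-bound fs reg len ,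
  PolarizedStanley.decomposition K u SD
  where
  r = polR u
  D = polVars u ℕ.∸ (n ℕ.∸ d)

  -- The two hypotheses bring a depth each. Only the one from the Stanley decomposition is maximal
  -- by `sup`, and it has to dominate the dimension d₀ from the Cohen-Macaulay property.
  d₀≤d : d₀ ℕ.≤ d
  d₀≤d = ≡.subst (ℕ._≤ d) len₀ (sup fs₀ reg₀)

  face-bound : ∀ Z → (∀ k → ¬ SupportedIn (u k) Z) → ∣ Z ∣ ℕ.≤ d
  face-bound Z face = ℕₚ.≤-trans (chain-bound ∣ Z ∣ (MonomialPrimes.face-chain K n u chain Z face)) d₀≤d

  open Faces K u face-bound

  u≢1 : ∀ k → u k ≢ oneₘ
  u≢1 = regular⇒gens≢1 K u fs reg

  p-01 : ∀ k q → V.lookup (polGens u k) q ≡ 0 ⊎ V.lookup (polGens u k) q ≡ 1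
  p-01 k q with col r q ℕ.<? V.lookup (u k) (row r q)
  ... | yes lt = inj₂ (≡.trans (lookup-polarize r (u k) q) (bit-< lt))
  ... | no nlt = inj₁ (≡.trans (lookup-polarize r (u k) q) (bit-≥ nlt))

  p-down : ∀ k {q q′} → toℕ q ℕ.< toℕ q′ → row r q ≡ row r q′ →
    V.lookup (polGens u k) q′ ≡ 1 → V.lookup (polGens u k) q ≡ 1
  p-down k {q} {q′} lt e e′ = ≡.trans (lookup-polarize r (u k) q) (bit-< (ℕₚ.<-trans (col-mono r lt e)
    (≡.subst (λ i → col r q′ ℕ.< V.lookup (u k) i) (≡.sym e) (bit-1 (≡.trans (≡.sym (lookup-polarize r (u k) q′)) e′)))))

  p-total : ∀ k i → sumF (λ q → if ⌊ row r q Fin.≟ i ⌋ then V.lookup (polGens u k) q else 0) ≡ V.lookup (u k) i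
  p-total k i = ≡.trans (sumF-cong at) (row-total r i (≤-polR u k i))
    where
    at : ∀ q → (if ⌊ row r q Fin.≟ i ⌋ then V.lookup (polGens u k) q else 0) ≡
      (if ⌊ row r q Fin.≟ i ⌋ then bit (V.lookup (u k) i) (col r q) else 0)
    at q with row r q Fin.≟ i
    ... | yes ≡.refl = lookup-polarize r (u k) q
    ... | no _ = ≡.refl

  D-bound : D ℕ.+ n ℕ.≤ polVars u ℕ.+ d
  -- As n ≤ d + (n ∸ d), it suffices that D + (n ∸ d) = N, which is where `codimension-bound`
  -- enters.
  D-bound = ℕₚ.≤-trans (ℕₚ.+-monoʳ-≤ D (ℕₚ.m≤n+m∸n n d)) (ℕₚ.≤-reflexive (≡.trans
    (≡.cong (D ℕ.+_) (ℕₚ.+-comm d (n ℕ.∸ d))) (≡.trans (≡.sym (ℕₚ.+-assoc D (n ℕ.∸ d) d))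
      (≡.cong (ℕ._+ d) (ℕₚ.m∸n+n≡m (codimension-bound u≢1))))))
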